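{- Let $k\in\mathbb N$. If $f:\{ -1,1\}^k\to\{0,1\}$ supports one-wise independence, then $\mathsf{Max\text{ - }CSP}(f)$ is approximation resistant in the streaming setting.
   Context: $\mathbb{N}=\{1,2,\dots\}$, $[n]=\{1,\dots,n\}$. $f$ supports one-wise independence if there is a probability distribution $D$ supported on $f^{ -1}(1)\subseteq\{ -1,1\}^k$ with $\mathbb E_{\mathbf a\sim D}[a_j]=0$ for every $j\in[k]$. $\rho(f)=2^{ -k}|\{\mathbf a\in\{ -1,1\}^k: f(\mathbf a)=1\}|$. $\mathsf{Max\text{ - }CSP}(f)$ is approximation resistant in the streaming setting if for every $\epsilon>0$ there exists $\delta>0$ such that every (randomized) streaming algorithm solving $(1,\rho(f)+\epsilon)$-$\mathsf{Max\text{ - }CSP}(f)$ requires $\Omega(n^\delta)$ space. CSPs. A constraint on $n$ variables is a pair $C=(\mathbf j,\mathbf b)$ with $\mathbf j=(j_1,\dots,j_k)\in[n]^k$ having distinct entries and $\mathbf b\in\{ -1,1\}^k$; for $\sigma\in\{ -1,1\}^n$ let $C(\sigma)=f(b_1\sigma_{j_1},\dots,b_k\sigma_{j_k})$. An instance $\Psi=(C_1,\dots,C_m)$, $m\ge 1$, is a finite sequence of constraints on $n$ variables (repetitions allowed), presented as a stream. Put $\mathrm{val}_\Psi(\sigma)=\frac1m\sum_i C_i(\sigma)$ and $\mathrm{val}_\Psi=\max_{\sigma\in\{ -1,1\}^n}\mathrm{val}_\Psi(\sigma)$. For reals $\gamma,\beta$, an algorithm solves $(\gamma,\beta)$-$\mathsf{Max\text{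 - }CSP}(f)$ if, on instances with $m\le\mathrm{poly}(n)$ (a fixed, sufficiently large polynomial bound), it outputs $1$ with probability at least $2/3$ whenever $\mathrm{val}_\Psi\ge\gamma$ and outputs $1$ with probability at most $1/3$ whenever $\mathrm{val}_\Psi\le\beta$. (If the two classes of instances overlap no algorithm solves the problem and lower bounds hold vacuously.) Streaming algorithms. Let $\mathcal C_n$ be the set of constraints on $n$ variables. A deterministic space-$s$ streaming algorithm is a pair $(S,v)$, $S:\{0,1\}^s\times\mathcal C_n\to\{0,1\}^s$, $v:\{0,1\}^s\to[0,1]$; starting from state $0^s$ it updates its state by $z\mapsto S(z,C)$ as each constraint $C$ of the stream arrives, and outputs $v$ of the final state. A randomized streaming algorithm is a probability distribution over deterministic ones. "Requires $\Omega(n^\delta)$ space" means there are $c>0$ and $n_0$ such that for all $n\ge n_0$ every such algorithm for instances on $n$ variables has $s\ge c\,n^\delta$. -}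

module Defs where

open import Data.Bool.Base using (Bool; false)
open import Data.Fin.Base using (Fin)
open import Data.Integer.Base as ℤ using (_◃_)
open import Data.List.Base as List using (List; []; _∷_)
open import Data.List.NonEmpty.Base as List⁺ using (List⁺)
open import Data.Nat.Base as ℕ using (ℕ; zero; suc)
import Data.Nat.Properties as ℕ
open import Data.Product.Base using (Σ; ∃; _×_; _,_; proj₁)
open import Data.Rational.Base as ℚ using (ℚ; 0ℚ; 1ℚ; ½)
import Data.Rational.Properties as ℚ
open import Data.Rational.Solver using (module +-*-Solver)
open import Data.Sign.Base as Sign using (Sign)
open import Data.Sum.Base using (inj₁; inj₂)
open import Data.Vec.Base as Vec using (Vec; []; _∷_)
open import Data.Vec.Relation.Unary.Unique.Propositional using (Unique)
open import Relation.Binary.PropositionalEquality.Core using (_≡_; refl; sym; cong; cong₂)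

------------------------------------------------------------------------
-- Real numbers: Cauchy sequences of rationals with an arbitrary modulus
-- of convergence, so that the operations are computed termwise.

IsCauchy : (ℕ → ℚ) → Set
IsCauchy x = ∀ ε → 0ℚ ℚ.< ε →
  ∃ λ N → ∀ m n → N ℕ.≤ m → N ℕ.≤ n → ℚ.∣ x m ℚ.- x n ∣ ℚ.≤ ε

record ℝ : Set where
  no-eta-equality
  field
    seq    : ℕ → ℚ
    cauchy : IsCauchy seq

open ℝ public

infix 4 _≤ℝ_ _<ℝ_ _≈ℝ_
infixl 6 _+ℝ_
infixl 7 _*ℝ_

_≤ℝ_ : ℝ → ℝ → Set
x ≤ℝ y = ∀ ε → 0ℚ ℚ.< ε → ∃ λ N → ∀ n → N ℕ.≤ n → seq x n ℚ.≤ seq y n ℚ.+ ε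

_<ℝ_ : ℝ → ℝ → Set
x <ℝ y = ∃ λ ε → 0ℚ ℚ.< ε × ∃ λ N → ∀ n → N ℕ.≤ n → seq x n ℚ.+ ε ℚ.≤ seq y n

_≈ℝ_ : ℝ → ℝ → Set
x ≈ℝ y = x ≤ℝ y × y ≤ℝ x

private
  half-pos : ∀ ε → 0ℚ ℚ.< ε → 0ℚ ℚ.< ½ ℚ.* ε
  half-pos ε 0<ε = ℚ.*-monoʳ-<-pos ½ 0<ε

  half+half : ∀ ε → ½ ℚ.* ε ℚ.+ ½ ℚ.* ε ≡ ε
  half+half = solve 1 (λ e → con ½ :* e :+ con ½ :* e := e) refl
    where open +-*-Solver

  0≤∣_∣ : ∀ p → 0ℚ ℚ.≤ ℚ.∣ p ∣
  0≤∣ p ∣ = ℚ.nonNegative⁻¹ ℚ.∣ p ∣ {{ℚ.∣-∣-nonNeg p}}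

  const-cauchy : ∀ q → IsCauchy (λ _ → q)
  const-cauchy q ε 0<ε = 0 , λ _ _ _ _ → begin
    ℚ.∣ q ℚ.- q ∣  ≡⟨ cong ℚ.∣_∣ (ℚ.+-inverseʳ q) ⟩
    0ℚ             ≤⟨ ℚ.<⇒≤ 0<ε ⟩
    ε              ∎
    where open ℚ.≤-Reasoning

  +-cauchy : ∀ {x y} → IsCauchy x → IsCauchy y → IsCauchy (λ n → x n ℚ.+ y n)
  +-cauchy {x} {y} cx cy ε 0<ε
    with cx (½ ℚ.* ε) (half-pos ε 0<ε) | cy (½ ℚ.* ε) (half-pos ε 0<ε)
  ... | M , hx | N , hy = M ℕ.⊔ N , λ m n M≤m M≤n → begin
    ℚ.∣ (x m ℚ.+ y m) ℚ.- (x n ℚ.+ y n) ∣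
      ≡⟨ cong ℚ.∣_∣ (rearrange (x m) (y m) (x n) (y n)) ⟩
    ℚ.∣ (x m ℚ.- x n) ℚ.+ (y m ℚ.- y n) ∣
      ≤⟨ ℚ.∣p+q∣≤∣p∣+∣q∣ (x m ℚ.- x n) (y m ℚ.- y n) ⟩
    ℚ.∣ x m ℚ.- x n ∣ ℚ.+ ℚ.∣ y m ℚ.- y n ∣
      ≤⟨ ℚ.+-mono-≤
           (hx m n (ℕ.m⊔n≤o⇒m≤o M N M≤m) (ℕ.m⊔n≤o⇒m≤o M N M≤n))
           (hy m n (ℕ.m⊔n≤o⇒n≤o M N M≤m) (ℕ.m⊔n≤o⇒n≤o M N M≤n)) ⟩
    ½ ℚ.* ε ℚ.+ ½ ℚ.* ε
      ≡⟨ half+half ε ⟩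
    ε ∎
    where
    open ℚ.≤-Reasoning
    rearrange : ∀ a b c d → (a ℚ.+ b) ℚ.- (c ℚ.+ d) ≡ (a ℚ.- c) ℚ.+ (b ℚ.- d)
    rearrange = solve 4 (λ a b c d → (a :+ b) :- (c :+ d) := (a :- c) :+ (b :- d)) refl
      where open +-*-Solver

  ∣p∣≤∣p-q∣+∣q∣ : ∀ p q → ℚ.∣ p ∣ ℚ.≤ ℚ.∣ p ℚ.- q ∣ ℚ.+ ℚ.∣ q ∣
  ∣p∣≤∣p-q∣+∣q∣ p q = begin
    ℚ.∣ p ∣                        ≡⟨ cong ℚ.∣_∣ (cancel p q) ⟩
    ℚ.∣ (p ℚ.- q) ℚ.+ q ∣          ≤⟨ ℚ.∣p+q∣≤∣p∣+∣q∣ (p ℚ.- q) q ⟩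
    ℚ.∣ p ℚ.- q ∣ ℚ.+ ℚ.∣ q ∣      ∎
    where
    open ℚ.≤-Reasoning
    cancel : ∀ a b → a ≡ (a ℚ.- b) ℚ.+ b
    cancel = solve 2 (λ a b → a := (a :- b) :+ b) refl
      where open +-*-Solver

  ∣p∣-∣q∣≤∣p-q∣ : ∀ p q → ℚ.∣ p ∣ ℚ.- ℚ.∣ q ∣ ℚ.≤ ℚ.∣ p ℚ.- q ∣
  ∣p∣-∣q∣≤∣p-q∣ p q = begin
    ℚ.∣ p ∣ ℚ.- ℚ.∣ q ∣
      ≤⟨ ℚ.+-monoˡ-≤ (ℚ.- ℚ.∣ q ∣) (∣p∣≤∣p-q∣+∣q∣ p q) ⟩
    (ℚ.∣ p ℚ.- q ∣ ℚ.+ ℚ.∣ q ∣) ℚ.- ℚ.∣ q ∣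
      ≡⟨ cancel ℚ.∣ p ℚ.- q ∣ ℚ.∣ q ∣ ⟩
    ℚ.∣ p ℚ.- q ∣ ∎
    where
    open ℚ.≤-Reasoning
    cancel : ∀ a b → (a ℚ.+ b) ℚ.- b ≡ a
    cancel = solve 2 (λ a b → (a :+ b) :- b := a) refl
      where open +-*-Solver

  neg-sub : ∀ a b → ℚ.- (a ℚ.- b) ≡ b ℚ.- a
  neg-sub = solve 2 (λ a b → :- (a :- b) := b :- a) refl
    where open +-*-Solver

  ∣p-q∣≡∣q-p∣ : ∀ p q → ℚ.∣ p ℚ.- q ∣ ≡ ℚ.∣ q ℚ.- p ∣
  ∣p-q∣≡∣q-p∣ p q = begin-equality
    ℚ.∣ p ℚ.- q ∣          ≡⟨ sym (ℚ.∣-p∣≡∣p∣ (p ℚ.- q)) ⟩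
    ℚ.∣ ℚ.- (p ℚ.- q) ∣    ≡⟨ cong ℚ.∣_∣ (neg-sub p q) ⟩
    ℚ.∣ q ℚ.- p ∣          ∎
    where open ℚ.≤-Reasoning

  ∣∣p∣-∣q∣∣≤∣p-q∣ : ∀ p q → ℚ.∣ ℚ.∣ p ∣ ℚ.- ℚ.∣ q ∣ ∣ ℚ.≤ ℚ.∣ p ℚ.- q ∣
  ∣∣p∣-∣q∣∣≤∣p-q∣ p q with ℚ.∣p∣≡p∨∣p∣≡-p (ℚ.∣ p ∣ ℚ.- ℚ.∣ q ∣)
  ... | inj₁ eq = ℚ.≤-trans (ℚ.≤-reflexive eq) (∣p∣-∣q∣≤∣p-q∣ p q)
  ... | inj₂ eq = begin
    ℚ.∣ ℚ.∣ p ∣ ℚ.- ℚ.∣ q ∣ ∣     ≡⟨ eq ⟩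
    ℚ.- (ℚ.∣ p ∣ ℚ.- ℚ.∣ q ∣)     ≡⟨ neg-sub ℚ.∣ p ∣ ℚ.∣ q ∣ ⟩
    ℚ.∣ q ∣ ℚ.- ℚ.∣ p ∣           ≤⟨ ∣p∣-∣q∣≤∣p-q∣ q p ⟩
    ℚ.∣ q ℚ.- p ∣                 ≡⟨ ∣p-q∣≡∣q-p∣ q p ⟩
    ℚ.∣ p ℚ.- q ∣                 ∎
    where open ℚ.≤-Reasoning

  ∣∣-cauchy : ∀ {x} → IsCauchy x → IsCauchy (λ n → ℚ.∣ x n ∣)
  ∣∣-cauchy {x} cx ε 0<ε with cx ε 0<ε
  ... | N , h = N , λ m n N≤m N≤n →
    ℚ.≤-trans (∣∣p∣-∣q∣∣≤∣p-q∣ (x m) (x n)) (h m n N≤m N≤n)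

  0<1ℚ : 0ℚ ℚ.< 1ℚ
  0<1ℚ = ℚ.positive⁻¹ 1ℚ

  bounded : ∀ {x} → IsCauchy x →
    ∃ λ B → 0ℚ ℚ.< B × ∃ λ N → ∀ n → N ℕ.≤ n → ℚ.∣ x n ∣ ℚ.≤ B
  bounded {x} cx with cx 1ℚ 0<1ℚ
  ... | N , h = 1ℚ ℚ.+ ℚ.∣ x N ∣
              , ℚ.+-mono-<-≤ 0<1ℚ 0≤∣ x N ∣
              , N
              , λ n N≤n → ℚ.≤-trans (∣p∣≤∣p-q∣+∣q∣ (x n) (x N))
                            (ℚ.+-monoˡ-≤ ℚ.∣ x N ∣ (h n N N≤n ℕ.≤-refl))

  divide : ∀ B → 0ℚ ℚ.< B → ∀ ε → 0ℚ ℚ.< ε → ∃ λ δ → 0ℚ ℚ.< δ × B ℚ.* δ ≡ ε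
  divide B 0<B ε 0<ε = B⁻¹ ℚ.* ε , 0<δ , (begin-equality
    B ℚ.* (B⁻¹ ℚ.* ε)    ≡⟨ sym (ℚ.*-assoc B B⁻¹ ε) ⟩
    (B ℚ.* B⁻¹) ℚ.* ε    ≡⟨ cong (ℚ._* ε) (ℚ.*-inverseʳ B) ⟩
    1ℚ ℚ.* ε             ≡⟨ ℚ.*-identityˡ ε ⟩
    ε                    ∎)
    where
    open ℚ.≤-Reasoning
    instance
      B-pos : ℚ.Positive B
      B-pos = ℚ.positive 0<B
      B-nonZero : ℚ.NonZero B
      B-nonZero = ℚ.pos⇒nonZero B
    B⁻¹ : ℚ
    B⁻¹ = ℚ.1/ B
    0<δ : 0ℚ ℚ.< B⁻¹ ℚ.* ε
    0<δ = begin-strict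
      0ℚ          ≡⟨ sym (ℚ.*-zeroʳ B⁻¹) ⟩
      B⁻¹ ℚ.* 0ℚ  <⟨ ℚ.*-monoʳ-<-pos B⁻¹ {{ℚ.1/pos⇒pos B}} 0<ε ⟩
      B⁻¹ ℚ.* ε   ∎

  *-mono-≤∣∣ : ∀ p q {a b} → ℚ.∣ p ∣ ℚ.≤ a → ℚ.∣ q ∣ ℚ.≤ b → ℚ.∣ p ℚ.* q ∣ ℚ.≤ a ℚ.* b
  *-mono-≤∣∣ p q {a} {b} p≤a q≤b = begin
    ℚ.∣ p ℚ.* q ∣          ≡⟨ ℚ.∣p*q∣≡∣p∣*∣q∣ p q ⟩
    ℚ.∣ p ∣ ℚ.* ℚ.∣ q ∣    ≤⟨ ℚ.*-monoʳ-≤-nonNeg ℚ.∣ q ∣ {{ℚ.∣-∣-nonNeg q}} p≤a ⟩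
    a ℚ.* ℚ.∣ q ∣          ≤⟨ ℚ.*-monoˡ-≤-nonNeg a
                               {{ℚ.nonNegative (ℚ.≤-trans 0≤∣ p ∣ p≤a)}} q≤b ⟩
    a ℚ.* b                ∎
    where open ℚ.≤-Reasoning

  *-difference : ∀ {A B α β ε} p q r s → A ℚ.* α ≡ ½ ℚ.* ε → B ℚ.* β ≡ ½ ℚ.* ε →
    ℚ.∣ p ∣ ℚ.≤ A → ℚ.∣ q ℚ.- s ∣ ℚ.≤ α → ℚ.∣ s ∣ ℚ.≤ B → ℚ.∣ p ℚ.- r ∣ ℚ.≤ β →
    ℚ.∣ p ℚ.* q ℚ.- r ℚ.* s ∣ ℚ.≤ ε
  *-difference {A} {B} {α} {β} {ε} p q r s Aα Bβ p≤A q-s≤α s≤B p-r≤β = begin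
    ℚ.∣ p ℚ.* q ℚ.- r ℚ.* s ∣
      ≡⟨ cong ℚ.∣_∣ (rearrange p q r s) ⟩
    ℚ.∣ p ℚ.* (q ℚ.- s) ℚ.+ s ℚ.* (p ℚ.- r) ∣
      ≤⟨ ℚ.∣p+q∣≤∣p∣+∣q∣ (p ℚ.* (q ℚ.- s)) (s ℚ.* (p ℚ.- r)) ⟩
    ℚ.∣ p ℚ.* (q ℚ.- s) ∣ ℚ.+ ℚ.∣ s ℚ.* (p ℚ.- r) ∣
      ≤⟨ ℚ.+-mono-≤ (*-mono-≤∣∣ p (q ℚ.- s) p≤A q-s≤α)
                    (*-mono-≤∣∣ s (p ℚ.- r) s≤B p-r≤β) ⟩
    A ℚ.* α ℚ.+ B ℚ.* β
      ≡⟨ cong₂ ℚ._+_ Aα Bβ ⟩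
    ½ ℚ.* ε ℚ.+ ½ ℚ.* ε
      ≡⟨ half+half ε ⟩
    ε ∎
    where
    open ℚ.≤-Reasoning
    rearrange : ∀ a b c d → a ℚ.* b ℚ.- c ℚ.* d ≡ a ℚ.* (b ℚ.- d) ℚ.+ d ℚ.* (a ℚ.- c)
    rearrange = solve 4 (λ a b c d → a :* b :- c :* d := a :* (b :- d) :+ d :* (a :- c)) refl
      where open +-*-Solver

  Bound : (ℕ → ℚ) → ℚ → Set
  Bound x B = 0ℚ ℚ.< B × ∃ λ N → ∀ n → N ℕ.≤ n → ℚ.∣ x n ∣ ℚ.≤ B

  *-cauchy-within : ∀ {x y A B ε} → IsCauchy x → IsCauchy y → Bound x A → Bound y B →
    (∃ λ α → 0ℚ ℚ.< α × A ℚ.* α ≡ ½ ℚ.* ε) → (∃ λ β → 0ℚ ℚ.< β × B ℚ.* β ≡ ½ ℚ.* ε) →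
    ∃ λ N → ∀ m n → N ℕ.≤ m → N ℕ.≤ n → ℚ.∣ x m ℚ.* y m ℚ.- x n ℚ.* y n ∣ ℚ.≤ ε
  *-cauchy-within {x} {y} cx cy (_ , K , hA) (_ , L , hB) (α , 0<α , Aα) (β , 0<β , Bβ) =
    merge (cx β 0<β) (cy α 0<α)
    where
    merge : (∃ λ M → ∀ m n → M ℕ.≤ m → M ℕ.≤ n → ℚ.∣ x m ℚ.- x n ∣ ℚ.≤ β) →
            (∃ λ N → ∀ m n → N ℕ.≤ m → N ℕ.≤ n → ℚ.∣ y m ℚ.- y n ∣ ℚ.≤ α) → _
    merge (M , hx) (N , hy) = (K ℕ.⊔ L) ℕ.⊔ (M ℕ.⊔ N) , λ m n ≤m ≤n →
      let ≤m₁ = ℕ.m⊔n≤o⇒m≤o (K ℕ.⊔ L) (M ℕ.⊔ N) ≤m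
          ≤m₂ = ℕ.m⊔n≤o⇒n≤o (K ℕ.⊔ L) (M ℕ.⊔ N) ≤m
          ≤n₁ = ℕ.m⊔n≤o⇒m≤o (K ℕ.⊔ L) (M ℕ.⊔ N) ≤n
          ≤n₂ = ℕ.m⊔n≤o⇒n≤o (K ℕ.⊔ L) (M ℕ.⊔ N) ≤n
      in *-difference (x m) (y m) (x n) (y n) Aα Bβ
           (hA m (ℕ.m⊔n≤o⇒m≤o K L ≤m₁))
           (hy m n (ℕ.m⊔n≤o⇒n≤o M N ≤m₂) (ℕ.m⊔n≤o⇒n≤o M N ≤n₂))
           (hB n (ℕ.m⊔n≤o⇒n≤o K L ≤n₁))
           (hx m n (ℕ.m⊔n≤o⇒m≤o M N ≤m₂) (ℕ.m⊔n≤o⇒m≤o M N ≤n₂))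

  *-cauchy-bounded : ∀ {x y} → IsCauchy x → IsCauchy y → ∃ (Bound x) → ∃ (Bound y) →
    IsCauchy (λ n → x n ℚ.* y n)
  *-cauchy-bounded {x} {y} cx cy (A , bA) (B , bB) ε 0<ε =
    *-cauchy-within {x} {y} cx cy bA bB
      (divide A (proj₁ bA) (½ ℚ.* ε) (half-pos ε 0<ε))
      (divide B (proj₁ bB) (½ ℚ.* ε) (half-pos ε 0<ε))

  *-cauchy : ∀ {x y} → IsCauchy x → IsCauchy y → IsCauchy (λ n → x n ℚ.* y n)
  *-cauchy {x} {y} cx cy =
    *-cauchy-bounded {x} {y} cx cy (bounded {x} cx) (bounded {y} cy)

fromℚ : ℚ → ℝ
seq    (fromℚ q) _ = q
cauchy (fromℚ q)   = const-cauchy q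

0ℝ 1ℝ : ℝ
0ℝ = fromℚ 0ℚ
1ℝ = fromℚ 1ℚ

_+ℝ_ : ℝ → ℝ → ℝ
seq    (x +ℝ y) n = seq x n ℚ.+ seq y n
cauchy (x +ℝ y)   = +-cauchy {seq x} {seq y} (cauchy x) (cauchy y)

_*ℝ_ : ℝ → ℝ → ℝ
seq    (x *ℝ y) n = seq x n ℚ.* seq y n
cauchy (x *ℝ y)   = *-cauchy {seq x} {seq y} (cauchy x) (cauchy y)

∣_∣ℝ : ℝ → ℝ
seq    ∣ x ∣ℝ n = ℚ.∣ seq x n ∣
cauchy ∣ x ∣ℝ   = ∣∣-cauchy {seq x} (cauchy x)

∑ : {A : Set} → List A → (A → ℝ) → ℝ
∑ xs g = List.foldr (λ a r → g a +ℝ r) 0ℝ xs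

TendsToZero : (ℕ → ℝ) → Set
TendsToZero x = ∀ ε → 0ℝ <ℝ ε → ∃ λ N → ∀ n → N ℕ.≤ n → ∣ x n ∣ℝ ≤ℝ ε

------------------------------------------------------------------------
-- A probability distribution on an arbitrary type, given by its
-- expectation in the sense of Daniell: a normalised, positive, linear
-- functional on a vector lattice of real random variables containing the
-- constants, continuous along sequences decreasing pointwise to 0.  By the
-- Daniell–Stone theorem these are the probability measures.

record Distribution (A : Set) : Set₁ where
  field
    RandomVariable : (A → ℝ) → Set
    rv-resp : ∀ {X Y} → (∀ a → X a ≈ℝ Y a) → RandomVariable X → RandomVariable Y
    rv-const : ∀ c → RandomVariable (λ _ → c)
    rv-+ : ∀ {X Y} → RandomVariable X → RandomVariable Y →
           RandomVariable (λ a → X a +ℝ Y a)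
    rv-* : ∀ c {X} → RandomVariable X → RandomVariable (λ a → c *ℝ X a)
    rv-∣∣ : ∀ {X} → RandomVariable X → RandomVariable (λ a → ∣ X a ∣ℝ)

    𝔼 : ∀ {X} → RandomVariable X → ℝ
    𝔼-const : ∀ c → 𝔼 (rv-const c) ≈ℝ c
    𝔼-+ : ∀ {X Y} (p : RandomVariable X) (q : RandomVariable Y) →
          𝔼 (rv-+ p q) ≈ℝ 𝔼 p +ℝ 𝔼 q
    𝔼-* : ∀ c {X} (p : RandomVariable X) → 𝔼 (rv-* c p) ≈ℝ c *ℝ 𝔼 p
    𝔼-mono : ∀ {X Y} (p : RandomVariable X) (q : RandomVariable Y) →
             (∀ a → X a ≤ℝ Y a) → 𝔼 p ≤ℝ 𝔼 q
    𝔼-continuous : ∀ (X : ℕ → A → ℝ) (p : ∀ n → RandomVariable (X n)) →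
                   (∀ n a → X (suc n) a ≤ℝ X n a) →
                   (∀ a → TendsToZero (λ n → X n a)) →
                   TendsToZero (λ n → 𝔼 (p n))

------------------------------------------------------------------------
-- Predicates on {-1,1}ᵏ.  The value 1 of a {0,1}-valued function is true.

Predicate : ℕ → Set
Predicate k = Vec Sign k → Bool

signVectors : ∀ n → List (Vec Sign n)
signVectors zero    = [] ∷ []
signVectors (suc n) =
  List.cartesianProductWith _∷_ (Sign.- ∷ Sign.+ ∷ []) (signVectors n)

ρ : ∀ {k} → Predicate k → ℚ
ρ {k} f = (ℤ.+ List.length (List.filterᵇ f (signVectors k)) ℚ./ (2 ℕ.^ k)) {{ℕ.m^n≢0 2 k}}

signℝ : Sign → ℝ
signℝ s = fromℚ ((s ◃ 1) ℚ./ 1)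

record SupportsOneWiseIndependence {k : ℕ} (f : Predicate k) : Set where
  field
    D         : Vec Sign k → ℝ
    D-nonneg  : ∀ a → 0ℝ ≤ℝ D a
    D-total   : ∑ (signVectors k) D ≈ℝ 1ℝ
    D-support : ∀ a → f a ≡ false → D a ≈ℝ 0ℝ
    D-mean    : ∀ j → ∑ (signVectors k) (λ a → D a *ℝ signℝ (Vec.lookup a j)) ≈ℝ 0ℝ

------------------------------------------------------------------------
-- Constraint satisfaction problems

-- Distinctness is irrelevant so that two constraints with the same
-- variables and signs are equal, even though _≢_ is a function type.
record Constraint (k n : ℕ) : Set where
  field
    variables : Vec (Fin n) k
    signs     : Vec Sign k
    .distinct : Unique variables

open Constraint public

Instance : ℕ → ℕ → Set
Instance k n = List⁺ (Constraint k n)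

module _ {k n : ℕ} (f : Predicate k) where

  satisfies : Vec Sign n → Constraint k n → Bool
  satisfies σ C = f (Vec.zipWith (λ b j → b Sign.* Vec.lookup σ j) (signs C) (variables C))

  valAt : Instance k n → Vec Sign n → ℚ
  valAt Ψ σ =
    ℤ.+ List.length (List.filterᵇ (satisfies σ) (List⁺.toList Ψ)) ℚ./ List⁺.length Ψ

  -- Starting the maximum at 0 is harmless: all values are nonnegative.
  val : Instance k n → ℚ
  val Ψ = List.foldr (λ σ r → valAt Ψ σ ℚ.⊔ r) 0ℚ (signVectors n)

------------------------------------------------------------------------
-- Streaming algorithms

record DeterministicAlgorithm (k n s : ℕ) : Set where
  field
    S   : Vec Bool s → Constraint k n → Vec Bool s
    v   : Vec Bool s → ℝ
    0≤v : ∀ z → 0ℝ ≤ℝ v z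
    v≤1 : ∀ z → v z ≤ℝ 1ℝ

  run : List (Constraint k n) → ℝ
  run stream = v (List.foldl S (Vec.replicate s false) stream)

open DeterministicAlgorithm public

record RandomizedAlgorithm (k n s : ℕ) : Set₁ where
  field
    law : Distribution (DeterministicAlgorithm k n s)
  open Distribution law public
  field
    run-rv : ∀ stream → RandomVariable (λ A → run A stream)

  Pr[outputs-1] : Instance k n → ℝ
  Pr[outputs-1] Ψ = 𝔼 (run-rv (List⁺.toList Ψ))

open RandomizedAlgorithm public using (Pr[outputs-1])

-- On instances with at most M constraints.
Solves : ∀ {k n s} → Predicate k → (γ β : ℝ) (M : ℕ) → RandomizedAlgorithm k n s → Set
Solves {k} {n} f γ β M 𝒜 = ∀ (Ψ : Instance k n) → List⁺.length Ψ ℕ.≤ M →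
  (γ ≤ℝ fromℚ (val f Ψ) → fromℚ (ℤ.+ 2 ℚ./ 3) ≤ℝ Pr[outputs-1] 𝒜 Ψ) ×
  (fromℚ (val f Ψ) ≤ℝ β → Pr[outputs-1] 𝒜 Ψ ≤ℝ fromℚ (ℤ.+ 1 ℚ./ 3))

-- Coefficients in order of increasing degree.
Polynomial : Set
Polynomial = List ℕ

eval : Polynomial → ℕ → ℕ
eval P n = List.foldr (λ a r → a ℕ.+ n ℕ.* r) 0 P

-- s ≥ c·nᵟ for positive rationals c = a/b and δ = p/q, cleared of roots and
-- denominators: aᵠ·nᵖ ≤ (b·s)ᵠ.
AtLeast : (s : ℕ) (c : ℚ) (n : ℕ) (δ : ℚ) → Set
AtLeast s c n δ =
  ℤ.∣ ℚ.↥ c ∣ ℕ.^ ℚ.↧ₙ δ ℕ.* n ℕ.^ ℤ.∣ ℚ.↥ δ ∣ ℕ.≤ (ℚ.↧ₙ c ℕ.* s) ℕ.^ ℚ.↧ₙ δ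

RequiresSpace : ∀ {k} → Predicate k → (γ β : ℝ) → Polynomial → (δ : ℚ) → Set₁
RequiresSpace {k} f γ β P δ =
  Σ ℚ λ c → 0ℚ ℚ.< c × Σ ℕ λ n₀ → ∀ n → n₀ ℕ.≤ n →
    ∀ s (𝒜 : RandomizedAlgorithm k n s) → Solves f γ β (eval P n) 𝒜 → AtLeast s c n δ

-- The bound on the number of constraints is any sufficiently large
-- polynomial, fixed before ε.  The exponent may be taken rational since
-- decreasing δ only weakens the lower bound.
ApproximationResistant : ∀ {k} → Predicate k → Set₁
ApproximationResistant f =
  Σ Polynomial λ P₀ → ∀ P → (∀ n → eval P₀ n ℕ.≤ eval P n) →
    ∀ (ε : ℝ) → 0ℝ <ℝ ε →
      Σ ℚ λ δ → 0ℚ ℚ.< δ × RequiresSpace f 1ℝ (fromℚ (ρ f) +ℝ ε) P δ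

{-# OPTIONS --safe #-}
module Submission where

-- NO instances are streams of T = O(n) independent uniform constraints, the
-- i-th variable being taken from the i-th of k blocks of variables; by a
-- Chernoff and a union bound their value is about ρ f.  YES instances plant a
-- uniform assignment σ: the stream has density ∏ L σ Cₜ, where L draws the
-- pattern seen by σ from a rational approximation of the given one-wise
-- independent distribution, so that σ satisfies every constraint.
--
-- The two are compared one constraint at a time through the second moment of
-- the likelihood ratio of the memory state.  A state z of probability at least
-- θ = 2^(-2ᵖ) conditions σ to a density at most 1/θ.  One-wise independence
-- makes the constraints C, C′ uncorrelated under L unless they share two
-- variables, which has probability O(1/n²); with hypercontractivity for
-- polynomials of degree k this shows that the next constraint, given z, has
-- χ²-distance at most 2·3^(kp)·2ᵏ/N² from uniform, N = n/k.  Over T = O(n)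
-- steps this is negligible as long as 16^(kp) ≤ n, hence for memory
-- s < 2^(p-1), that is about n^(1/4k).

open import Defs
open import Algebra.Bundles using (module CommutativeRing)
import Algebra.Properties.CommutativeSemiring.Exp as Exp
open import Data.Bool.Base using (Bool; true; false; if_then_else_)
open import Data.Empty using (⊥)
open import Data.Fin.Base using (Fin; zero; suc; _↑ˡ_; _↑ʳ_; splitAt)
import Data.Fin.Properties as Fin
import Data.Integer.Base as ℤ
import Data.Integer.Properties as ℤ
open import Data.List.Base as List using (List; []; _∷_; _++_)
open import Data.List.Membership.Propositional using (_∈_)
import Data.List.Membership.Propositional.Properties as ∈
open import Data.List.NonEmpty.Base as List⁺ using (List⁺)
import Data.List.Properties as List
open import Data.List.Relation.Unary.All as All using (All; []; _∷_)
import Data.List.Relation.Unary.All.Properties as All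
open import Data.List.Relation.Unary.Any using (here; there)
import Data.Nat.Base as ℕ
open import Data.Nat.Base using (ℕ; NonZero; zero; suc)
import Data.Nat.Coprimality as ℕ
import Data.Nat.DivMod as ℕ
import Data.Nat.Properties as ℕ
import Data.Nat.Solver as ℕ-Solver
open import Data.Product.Base using (∃; _×_; _,_; proj₁; proj₂)
open import Data.Rational.Base using (ℚ; 0ℚ; 1ℚ; ½; _+_; _*_; _-_; -_; _≤_; _<_; _⊔_; ∣_∣; _/_)
import Data.Rational.Base as ℚ
import Data.Rational.Properties as ℚ
import Data.Rational.Unnormalised.Base as ℚᵘ
import Data.Rational.Unnormalised.Properties as ℚᵘ
open import Data.Sign.Base as Sign using (Sign)
open import Data.Sum.Base using (_⊎_; inj₁; inj₂)
open import Data.Vec.Base as Vec using (Vec; []; _∷_)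
import Data.Vec.Properties as Vec
import Data.Vec.Relation.Unary.Unique.Propositional.Properties as Unique
open import Function.Base using (_∘_)
open import Relation.Binary.PropositionalEquality
open import Relation.Nullary using (Dec; yes; no; ¬_; contradiction)
open import Relation.Nullary.Decidable using (dec⇒maybe; from-yes)
open import Tactic.RingSolver using (solve-∀)
open import Tactic.RingSolver.Core.AlmostCommutativeRing using (AlmostCommutativeRing; fromCommutativeRing)

open Exp (CommutativeRing.commutativeSemiring ℚ.+-*-commutativeRing)
  using (_^_; ^-homo-*; ^-assocʳ; ^-distrib-*)

-- The second moment is forced by the length of the stream. A union bound over all assignments needs
-- T at least of order n, while the bound for the total variation distance of one constraint from
-- uniform, given the state, is of order √bias, at least 1/N. Added over T steps, such errors exceed
-- 1. Second moments multiply instead, and (1 + bias)^T stays near 1 since bias is 1/N² up to the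
-- factor 3^(kp) and constants. Light states spoil the density bound behind this, so they are
-- dropped as they appear. That does not raise the second moment, and the lost mass, at most θ per
-- state and step, is recorded apart.
--
-- The blocks make the variables of a constraint distinct and let the correlation of two constraints
-- factor.
--
-- The argument runs over ℚ with finite measures. For lack of roots, moments have order 2ᵖ by
-- repeated squaring, and θ has an exact 2ᵖ-th root. Reals enter with the algorithm, its law and the
-- given distribution; each time finitely many real inequalities are read off at one index of the
-- Cauchy sequences, up to a small error.

ℚ-ring : AlmostCommutativeRing _ _
ℚ-ring = fromCommutativeRing ℚ.+-*-commutativeRing (λ x → dec⇒maybe (0ℚ ℚ.≟ x))

private variable
  A B : Set

-- Ordered field arithmetic

-- The usual way to prove an inequality below: the nonnegative difference `r` is written down and
-- the identity is left to the ring solver.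
≤-by : ∀ {p q} r → 0ℚ ≤ r → q ≡ p + r → p ≤ q
≤-by {p} {q} r 0≤r q≡p+r = begin
  p       ≡⟨ ℚ.+-identityʳ p ⟨
  p + 0ℚ  ≤⟨ ℚ.+-monoʳ-≤ p 0≤r ⟩
  p + r   ≡⟨ q≡p+r ⟨
  q       ∎
  where open ℚ.≤-Reasoning

0≤q-p : ∀ {p q} → p ≤ q → 0ℚ ≤ q - p
0≤q-p {p} {q} p≤q = subst (_≤ q - p) (ℚ.+-inverseʳ p) (ℚ.+-monoˡ-≤ (- p) p≤q)

<⇒≱ : ∀ {p q} → p < q → ¬ q ≤ p
<⇒≱ p<q q≤p = ℚ.<-irrefl refl (ℚ.<-≤-trans p<q q≤p)

0≤1 : 0ℚ ≤ 1ℚ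
0≤1 = ℚ.nonNegative⁻¹ 1ℚ

+-nonneg : ∀ {p q} → 0ℚ ≤ p → 0ℚ ≤ q → 0ℚ ≤ p + q
+-nonneg = ℚ.+-mono-≤

*-monoˡ-≤ : ∀ {p q} r → 0ℚ ≤ r → p ≤ q → r * p ≤ r * q
*-monoˡ-≤ r 0≤r = ℚ.*-monoˡ-≤-nonNeg r {{ℚ.nonNegative 0≤r}}

*-monoʳ-≤ : ∀ {p q} r → 0ℚ ≤ r → p ≤ q → p * r ≤ q * r
*-monoʳ-≤ r 0≤r = ℚ.*-monoʳ-≤-nonNeg r {{ℚ.nonNegative 0≤r}}

*-mono-≤ : ∀ {p q r s} → 0ℚ ≤ p → 0ℚ ≤ s → p ≤ q → r ≤ s → p * r ≤ q * s
*-mono-≤ {p} {q} {r} {s} 0≤p 0≤s p≤q r≤s =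
  ℚ.≤-trans (*-monoˡ-≤ p 0≤p r≤s) (*-monoʳ-≤ s 0≤s p≤q)

*-nonneg : ∀ {p q} → 0ℚ ≤ p → 0ℚ ≤ q → 0ℚ ≤ p * q
*-nonneg {p} {q} 0≤p 0≤q = subst (_≤ p * q) (ℚ.*-zeroʳ p) (*-monoˡ-≤ p 0≤p 0≤q)

*-pos : ∀ {p q} → 0ℚ < p → 0ℚ < q → 0ℚ < p * q
*-pos {p} {q} 0<p 0<q =
  subst (_< p * q) (ℚ.*-zeroʳ p) (ℚ.*-monoʳ-<-pos p {{ℚ.positive 0<p}} 0<q)

p*p-nonneg : ∀ p → 0ℚ ≤ p * p
p*p-nonneg p with ℚ.≤-total 0ℚ p
... | inj₁ 0≤p = *-nonneg 0≤p 0≤p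
... | inj₂ p≤0 = subst (0ℚ ≤_) (neg² p) (*-nonneg 0≤-p 0≤-p)
  where
  neg² : ∀ p → (- p) * (- p) ≡ p * p
  neg² = solve-∀ ℚ-ring
  0≤-p = ℚ.neg-antimono-≤ p≤0

p*p≤q*q⇒p≤q : ∀ {p q} → 0ℚ ≤ q → p * p ≤ q * q → p ≤ q
p*p≤q*q⇒p≤q {p} {q} 0≤q p²≤q² with p ℚ.≤? q
... | yes p≤q = p≤q
... | no p≰q = contradiction p²≤q² (<⇒≱ (begin-strict
  q * q  ≤⟨ *-monoˡ-≤ q 0≤q (ℚ.<⇒≤ q<p) ⟩
  q * p  <⟨ ℚ.*-monoˡ-<-pos p {{ℚ.positive (ℚ.≤-<-trans 0≤q q<p)}} q<p ⟩
  p * p  ∎))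
  where
  open ℚ.≤-Reasoning
  q<p : q < p
  q<p = ℚ.≰⇒> p≰q

^-nonneg : ∀ {p} n → 0ℚ ≤ p → 0ℚ ≤ p ^ n
^-nonneg zero    0≤p = 0≤1
^-nonneg (suc n) 0≤p = *-nonneg 0≤p (^-nonneg n 0≤p)

^-mono-≤ : ∀ {p q} n → 0ℚ ≤ p → p ≤ q → p ^ n ≤ q ^ n
^-mono-≤ zero    0≤p p≤q = ℚ.≤-refl
^-mono-≤ (suc n) 0≤p p≤q =
  *-mono-≤ 0≤p (^-nonneg n (ℚ.≤-trans 0≤p p≤q)) p≤q (^-mono-≤ n 0≤p p≤q)

1^n≡1 : ∀ n → 1ℚ ^ n ≡ 1ℚ
1^n≡1 zero    = refl
1^n≡1 (suc n) = trans (ℚ.*-identityˡ (1ℚ ^ n)) (1^n≡1 n)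

1≤p⇒1≤p^n : ∀ {p} n → 1ℚ ≤ p → 1ℚ ≤ p ^ n
1≤p⇒1≤p^n {p} n 1≤p = subst (_≤ p ^ n) (1^n≡1 n) (^-mono-≤ n 0≤1 1≤p)

p≤∣p∣ : ∀ p → p ≤ ∣ p ∣
p≤∣p∣ p with ℚ.≤-total 0ℚ p
... | inj₁ 0≤p = ℚ.≤-reflexive (sym (ℚ.0≤p⇒∣p∣≡p 0≤p))
... | inj₂ p≤0 = ℚ.≤-trans p≤0 (ℚ.0≤∣p∣ p)

-- Finitely supported measures

-- Atoms may repeat or have weight 0, and the total need not be 1. Measures are only ever compared
-- through integrals, and counting measures are of the same kind as probabilities.
record Measure (A : Set) : Set where
  constructor measure
  field
    atoms     : List (ℚ × A)
    nonneg    : All ((0ℚ ≤_) ∘ proj₁) atoms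

open Measure

integrate : List (ℚ × A) → (A → ℚ) → ℚ
integrate []             f = 0ℚ
integrate ((w , a) ∷ xs) f = w * f a + integrate xs f

∫ : Measure A → (A → ℚ) → ℚ
∫ μ = integrate (atoms μ)

infix 5 ∫
syntax ∫ μ (λ a → e) = ∫[ a ∈ μ ] e

IsProbability : Measure A → Set
IsProbability μ = ∫[ _ ∈ μ ] 1ℚ ≡ 1ℚ

integrate-cong : ∀ (xs : List (ℚ × A)) {f g} → (∀ a → f a ≡ g a) → integrate xs f ≡ integrate xs g
integrate-cong []             f≡g = refl
integrate-cong ((w , a) ∷ xs) f≡g = cong₂ (λ p q → w * p + q) (f≡g a) (integrate-cong xs f≡g)

integrate-+ : ∀ (xs : List (ℚ × A)) f g →
  integrate xs (λ a → f a + g a) ≡ integrate xs f + integrate xs g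
integrate-+ []             f g = refl
integrate-+ ((w , a) ∷ xs) f g = trans
  (cong (w * (f a + g a) +_) (integrate-+ xs f g))
  (rearrange w (f a) (g a) (integrate xs f) (integrate xs g))
  where
  rearrange : ∀ w x y p q → w * (x + y) + (p + q) ≡ (w * x + p) + (w * y + q)
  rearrange = solve-∀ ℚ-ring

integrate-* : ∀ (xs : List (ℚ × A)) c f →
  integrate xs (λ a → c * f a) ≡ c * integrate xs f
integrate-* []             c f = sym (ℚ.*-zeroʳ c)
integrate-* ((w , a) ∷ xs) c f = trans
  (cong (w * (c * f a) +_) (integrate-* xs c f))
  (rearrange w c (f a) (integrate xs f))
  where
  rearrange : ∀ w c x p → w * (c * x) + c * p ≡ c * (w * x + p)
  rearrange = solve-∀ ℚ-ring

integrate-mono : ∀ {xs : List (ℚ × A)} {f g} → All ((0ℚ ≤_) ∘ proj₁) xs →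
  All (λ (_ , a) → f a ≤ g a) xs → integrate xs f ≤ integrate xs g
integrate-mono []         []         = ℚ.≤-refl
integrate-mono {xs = (w , a) ∷ xs} (0≤w ∷ 0≤) (f≤g ∷ f≤gs) =
  ℚ.+-mono-≤ (*-monoˡ-≤ w 0≤w f≤g) (integrate-mono 0≤ f≤gs)

module _ (μ : Measure A) where

  ∫-cong : ∀ {f g : A → ℚ} → (∀ a → f a ≡ g a) → ∫ μ f ≡ ∫ μ g
  ∫-cong = integrate-cong (atoms μ)

  ∫-+ : ∀ f g → (∫[ a ∈ μ ] f a + g a) ≡ ∫ μ f + ∫ μ g
  ∫-+ = integrate-+ (atoms μ)

  ∫-* : ∀ c f → (∫[ a ∈ μ ] c * f a) ≡ c * ∫ μ f
  ∫-* = integrate-* (atoms μ)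

  ∫-*ʳ : ∀ f c → (∫[ a ∈ μ ] f a * c) ≡ ∫ μ f * c
  ∫-*ʳ f c = trans (∫-cong (λ a → ℚ.*-comm (f a) c)) (trans (∫-* c f) (ℚ.*-comm c (∫ μ f)))

  ∫-- : ∀ f g → (∫[ a ∈ μ ] f a - g a) ≡ ∫ μ f - ∫ μ g
  ∫-- f g = begin
    (∫[ a ∈ μ ] f a - g a)                    ≡⟨ ∫-cong (λ a → sub (f a) (g a)) ⟩
    (∫[ a ∈ μ ] f a + (- 1ℚ) * g a)           ≡⟨ ∫-+ f (λ a → (- 1ℚ) * g a) ⟩
    ∫ μ f + (∫[ a ∈ μ ] (- 1ℚ) * g a)         ≡⟨ cong (∫ μ f +_) (∫-* (- 1ℚ) g) ⟩
    ∫ μ f + (- 1ℚ) * ∫ μ g                    ≡⟨ sub (∫ μ f) (∫ μ g) ⟨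
    ∫ μ f - ∫ μ g                             ∎
    where
    open ≡-Reasoning
    sub : ∀ p q → p - q ≡ p + (- 1ℚ) * q
    sub = solve-∀ ℚ-ring

  ∫-0 : (∫[ a ∈ μ ] 0ℚ) ≡ 0ℚ
  ∫-0 = trans (∫-cong (λ _ → sym (ℚ.*-zeroˡ 0ℚ))) (trans (∫-* 0ℚ (λ _ → 0ℚ)) (ℚ.*-zeroˡ (∫[ a ∈ μ ] 0ℚ)))

  ∫-const : IsProbability μ → ∀ c → (∫[ a ∈ μ ] c) ≡ c
  ∫-const μ₁ c = begin
    (∫[ a ∈ μ ] c)        ≡⟨ ∫-cong (λ _ → ℚ.*-identityʳ c) ⟨
    (∫[ a ∈ μ ] c * 1ℚ)   ≡⟨ ∫-* c (λ _ → 1ℚ) ⟩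
    c * (∫[ a ∈ μ ] 1ℚ)   ≡⟨ cong (c *_) μ₁ ⟩
    c * 1ℚ                ≡⟨ ℚ.*-identityʳ c ⟩
    c                     ∎
    where open ≡-Reasoning

  ∫-mono : ∀ {f g} → (∀ a → f a ≤ g a) → ∫ μ f ≤ ∫ μ g
  ∫-mono f≤g = integrate-mono (nonneg μ) (All.universal (λ (_ , a) → f≤g a) (atoms μ))

  ∫-nonneg : ∀ {f} → (∀ a → 0ℚ ≤ f a) → 0ℚ ≤ ∫ μ f
  ∫-nonneg {f} 0≤f = subst (_≤ ∫ μ f) ∫-0 (∫-mono 0≤f)

  ∫-swap : ∀ (ν : Measure B) (f : A → B → ℚ) →
    (∫[ a ∈ μ ] ∫[ b ∈ ν ] f a b) ≡ (∫[ b ∈ ν ] ∫[ a ∈ μ ] f a b)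
  ∫-swap ν f = swap (atoms ν)
    where
    open ≡-Reasoning
    swap : ∀ ys → (∫[ a ∈ μ ] integrate ys (f a)) ≡ integrate ys (λ b → ∫[ a ∈ μ ] f a b)
    swap []             = ∫-0
    swap ((w , b) ∷ ys) = begin
      (∫[ a ∈ μ ] w * f a b + integrate ys (f a))
        ≡⟨ ∫-+ (λ a → w * f a b) (λ a → integrate ys (f a)) ⟩
      (∫[ a ∈ μ ] w * f a b) + (∫[ a ∈ μ ] integrate ys (f a))
        ≡⟨ cong₂ _+_ (∫-* w (λ a → f a b)) (swap ys) ⟩
      w * (∫[ a ∈ μ ] f a b) + integrate ys (λ b → ∫[ a ∈ μ ] f a b) ∎

-- Induction on the atoms, without division. The cross term needs 2xyP ≤ x²G + y²F, which holds
-- after squaring: 4x²y²P² ≤ 4x²y²FG ≤ (x²G + y²F)².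
∫-cauchy-schwarz : ∀ (μ : Measure A) f g →
  (∫[ a ∈ μ ] f a * g a) * (∫[ a ∈ μ ] f a * g a) ≤ (∫[ a ∈ μ ] f a * f a) * (∫[ a ∈ μ ] g a * g a)
∫-cauchy-schwarz μ f g = go (nonneg μ)
  where
  open ℚ.≤-Reasoning
  step : ∀ {w x y P F G} → 0ℚ ≤ w → 0ℚ ≤ F → 0ℚ ≤ G → P * P ≤ F * G →
    (w * (x * y) + P) * (w * (x * y) + P) ≤ (w * (x * x) + F) * (w * (y * y) + G)
  step {w} {x} {y} {P} {F} {G} 0≤w 0≤F 0≤G P²≤FG =
    ≤-by (w * ((x * x * G + y * y * F) - (x * y * P + x * y * P)) + (F * G - P * P))
         (+-nonneg (*-nonneg 0≤w (0≤q-p cross)) (0≤q-p P²≤FG))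
         (expand w x y P F G)
    where
    expand : ∀ w x y P F G → (w * (x * x) + F) * (w * (y * y) + G) ≡
      (w * (x * y) + P) * (w * (x * y) + P) +
      (w * ((x * x * G + y * y * F) - (x * y * P + x * y * P)) + (F * G - P * P))
    expand = solve-∀ ℚ-ring
    sq : ∀ x y P → (x * y * P + x * y * P) * (x * y * P + x * y * P) ≡ (x * x) * (y * y) * (P * P) * (1ℚ + 1ℚ + 1ℚ + 1ℚ)
    sq = solve-∀ ℚ-ring
    diff : ∀ X Y F G → (X * G + Y * F) * (X * G + Y * F) ≡
      X * Y * (F * G) * (1ℚ + 1ℚ + 1ℚ + 1ℚ) + (X * G - Y * F) * (X * G - Y * F)
    diff = solve-∀ ℚ-ring
    cross : x * y * P + x * y * P ≤ x * x * G + y * y * F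
    cross = p*p≤q*q⇒p≤q
      (+-nonneg (*-nonneg (p*p-nonneg x) 0≤G) (*-nonneg (p*p-nonneg y) 0≤F)) (begin
      (x * y * P + x * y * P) * (x * y * P + x * y * P)
        ≡⟨ sq x y P ⟩
      (x * x) * (y * y) * (P * P) * (1ℚ + 1ℚ + 1ℚ + 1ℚ)
        ≤⟨ *-monoʳ-≤ (1ℚ + 1ℚ + 1ℚ + 1ℚ) (ℚ.nonNegative⁻¹ (1ℚ + 1ℚ + 1ℚ + 1ℚ))
             (*-monoˡ-≤ ((x * x) * (y * y)) (*-nonneg (p*p-nonneg x) (p*p-nonneg y)) P²≤FG) ⟩
      (x * x) * (y * y) * (F * G) * (1ℚ + 1ℚ + 1ℚ + 1ℚ)
        ≤⟨ ≤-by _ (p*p-nonneg (x * x * G - y * y * F)) (diff (x * x) (y * y) F G) ⟩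
      (x * x * G + y * y * F) * (x * x * G + y * y * F) ∎)
  sq≥0 : ∀ {xs : List (ℚ × _)} (h : _ → ℚ) → All ((0ℚ ≤_) ∘ proj₁) xs → 0ℚ ≤ integrate xs (λ a → h a * h a)
  sq≥0 {xs} h 0≤ = ∫-nonneg (measure xs 0≤) (λ a → p*p-nonneg (h a))
  go : ∀ {xs} → All ((0ℚ ≤_) ∘ proj₁) xs →
    integrate xs (λ a → f a * g a) * integrate xs (λ a → f a * g a) ≤
    integrate xs (λ a → f a * f a) * integrate xs (λ a → g a * g a)
  go []         = ℚ.≤-refl
  go {(w , a) ∷ xs} (0≤w ∷ 0≤) = step {w} {f a} {g a} 0≤w (sq≥0 f 0≤) (sq≥0 g 0≤) (go 0≤)

infixl 5 _>>=_

dirac : A → Measure A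
dirac a = measure ((1ℚ , a) ∷ []) (0≤1 ∷ [])

∫-dirac : ∀ (a : A) f → ∫ (dirac a) f ≡ f a
∫-dirac a f = trans (ℚ.+-identityʳ (1ℚ * f a)) (ℚ.*-identityˡ (f a))

scale : ∀ w → 0ℚ ≤ w → Measure A → Measure A
atoms  (scale w 0≤w μ) = List.map (λ (v , a) → w * v , a) (atoms μ)
nonneg (scale w 0≤w μ) = All.map⁺ (All.map (*-nonneg 0≤w) (nonneg μ))

∫-scale : ∀ w (0≤w : 0ℚ ≤ w) (μ : Measure A) f → ∫ (scale w 0≤w μ) f ≡ w * ∫ μ f
∫-scale w 0≤w μ f = go (atoms μ)
  where
  go : ∀ xs → integrate (List.map (λ (v , a) → w * v , a) xs) f ≡ w * integrate xs f
  go []             = sym (ℚ.*-zeroʳ w)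
  go ((v , a) ∷ xs) = trans (cong (w * v * f a +_) (go xs)) (rearrange w v (f a) (integrate xs f))
    where
    rearrange : ∀ w v x p → w * v * x + w * p ≡ w * (v * x + p)
    rearrange = solve-∀ ℚ-ring

_⊕_ : Measure A → Measure A → Measure A
atoms  (μ ⊕ ν) = atoms μ ++ atoms ν
nonneg (μ ⊕ ν) = All.++⁺ (nonneg μ) (nonneg ν)

∫-⊕ : ∀ (μ ν : Measure A) f → ∫ (μ ⊕ ν) f ≡ ∫ μ f + ∫ ν f
∫-⊕ μ ν f = go (atoms μ)
  where
  go : ∀ xs → integrate (xs ++ atoms ν) f ≡ integrate xs f + ∫ ν f
  go []             = sym (ℚ.+-identityˡ (∫ ν f))
  go ((w , a) ∷ xs) = trans (cong (w * f a +_) (go xs)) (sym (ℚ.+-assoc (w * f a) (integrate xs f) (∫ ν f)))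

_>>=_ : Measure A → (A → Measure B) → Measure B
measure []             []         >>= κ = measure [] []
measure ((w , a) ∷ xs) (0≤w ∷ 0≤) >>= κ = scale w 0≤w (κ a) ⊕ (measure xs 0≤ >>= κ)

∫->>= : ∀ (μ : Measure A) (κ : A → Measure B) f → ∫ (μ >>= κ) f ≡ (∫[ a ∈ μ ] ∫ (κ a) f)
∫->>= (measure []             [])         κ f = refl
∫->>= (measure ((w , a) ∷ xs) (0≤w ∷ 0≤)) κ f = trans
  (∫-⊕ (scale w 0≤w (κ a)) (measure xs 0≤ >>= κ) f)
  (cong₂ _+_ (∫-scale w 0≤w (κ a) f) (∫->>= (measure xs 0≤) κ f))

pow : Measure A → ∀ n → Measure (Vec A n)
pow μ zero    = dirac []
pow μ (suc n) = μ >>= λ a → pow μ n >>= λ v → dirac (a ∷ v)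

∫-pow : ∀ (μ : Measure A) n f → ∫ (pow μ (suc n)) f ≡ (∫[ a ∈ μ ] ∫[ v ∈ pow μ n ] f (a ∷ v))
∫-pow μ n f = trans (∫->>= μ _ f) (∫-cong μ λ a →
  trans (∫->>= (pow μ n) _ f) (∫-cong (pow μ n) λ v → ∫-dirac (a ∷ v) f))

∏ : ∀ n → (Fin n → ℚ) → ℚ
∏ zero    f = 1ℚ
∏ (suc n) f = f zero * ∏ n (f ∘ suc)

∏-cong : ∀ n {f g} → (∀ i → f i ≡ g i) → ∏ n f ≡ ∏ n g
∏-cong zero    f≡g = refl
∏-cong (suc n) f≡g = cong₂ _*_ (f≡g zero) (∏-cong n (f≡g ∘ suc))

∏-* : ∀ n f g → ∏ n f * ∏ n g ≡ ∏ n (λ i → f i * g i)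
∏-* zero    f g = refl
∏-* (suc n) f g = trans (interchange (f zero) (∏ n (f ∘ suc)) (g zero) (∏ n (g ∘ suc)))
  (cong ((f zero * g zero) *_) (∏-* n (f ∘ suc) (g ∘ suc)))
  where
  interchange : ∀ a b c d → (a * b) * (c * d) ≡ (a * c) * (b * d)
  interchange = solve-∀ ℚ-ring

∏-nonneg : ∀ n {f} → (∀ i → 0ℚ ≤ f i) → 0ℚ ≤ ∏ n f
∏-nonneg zero    0≤f = 0≤1
∏-nonneg (suc n) 0≤f = *-nonneg (0≤f zero) (∏-nonneg n (0≤f ∘ suc))

∏-1 : ∀ n → ∏ n (λ _ → 1ℚ) ≡ 1ℚ
∏-1 zero    = refl
∏-1 (suc n) = trans (ℚ.*-identityˡ (∏ n (λ _ → 1ℚ))) (∏-1 n)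

∏-zero : ∀ n {f} {P : Fin n → Set} → (∀ i → f i ≡ 0ℚ ⊎ P i) → ∏ n f ≡ 0ℚ ⊎ (∀ i → P i)
∏-zero zero    h = inj₂ λ ()
∏-zero (suc n) {f} h with h zero | ∏-zero n (h ∘ suc)
... | inj₁ f₀≡0 | _        = inj₁ (trans (cong (_* ∏ n (f ∘ suc)) f₀≡0) (ℚ.*-zeroˡ (∏ n (f ∘ suc))))
... | inj₂ _    | inj₁ ∏≡0 = inj₁ (trans (cong (f zero *_) ∏≡0) (ℚ.*-zeroʳ (f zero)))
... | inj₂ p₀   | inj₂ ps  = inj₂ λ { zero → p₀ ; (suc i) → ps i }

∫-∏ : ∀ (μ : Measure A) n (φ : Fin n → A → ℚ) →
  (∫[ v ∈ pow μ n ] ∏ n (λ i → φ i (Vec.lookup v i))) ≡ ∏ n (λ i → ∫ μ (φ i))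
∫-∏ {A = A} μ zero φ = ∫-dirac {A = Vec A zero} [] (λ v → 1ℚ)
∫-∏ μ (suc n) φ = begin
  (∫[ v ∈ pow μ (suc n) ] ∏ (suc n) (λ i → φ i (Vec.lookup v i)))
    ≡⟨ ∫-pow μ n _ ⟩
  (∫[ a ∈ μ ] ∫[ v ∈ pow μ n ] φ zero a * ∏ n (λ i → φ (suc i) (Vec.lookup v i)))
    ≡⟨ ∫-cong μ (λ a → ∫-* (pow μ n) (φ zero a) (λ v → ∏ n (λ i → φ (suc i) (Vec.lookup v i)))) ⟩
  (∫[ a ∈ μ ] φ zero a * (∫[ v ∈ pow μ n ] ∏ n (λ i → φ (suc i) (Vec.lookup v i))))
    ≡⟨ ∫-*ʳ μ (φ zero) _ ⟩
  ∫ μ (φ zero) * (∫[ v ∈ pow μ n ] ∏ n (λ i → φ (suc i) (Vec.lookup v i)))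
    ≡⟨ cong (∫ μ (φ zero) *_) (∫-∏ μ n (φ ∘ suc)) ⟩
  ∏ (suc n) (λ i → ∫ μ (φ i)) ∎
  where open ≡-Reasoning

∫-1-pow : ∀ (μ : Measure A) n → (∫[ _ ∈ pow μ n ] 1ℚ) ≡ (∫[ _ ∈ μ ] 1ℚ) ^ n
∫-1-pow μ zero    = refl
∫-1-pow μ (suc n) = begin
  (∫[ _ ∈ pow μ (suc n) ] 1ℚ)                       ≡⟨ ∫-pow μ n (λ _ → 1ℚ) ⟩
  (∫[ _ ∈ μ ] ∫[ _ ∈ pow μ n ] 1ℚ)                  ≡⟨ ∫-cong μ (λ _ → ∫-1-pow μ n) ⟩
  (∫[ _ ∈ μ ] (∫[ _ ∈ μ ] 1ℚ) ^ n)                  ≡⟨ ∫-cong μ (λ _ → ℚ.*-identityˡ _) ⟨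
  (∫[ _ ∈ μ ] 1ℚ * (∫[ _ ∈ μ ] 1ℚ) ^ n)             ≡⟨ ∫-*ʳ μ (λ _ → 1ℚ) _ ⟩
  (∫[ _ ∈ μ ] 1ℚ) ^ suc n                           ∎
  where open ≡-Reasoning

pow-isProbability : ∀ (μ : Measure A) → IsProbability μ → ∀ n → IsProbability (pow μ n)
pow-isProbability μ μ₁ n = trans (∫-1-pow μ n) (trans (cong (_^ n) μ₁) (1^n≡1 n))

2ℚ 3ℚ 9ℚ : ℚ
2ℚ = 1ℚ + 1ℚ
3ℚ = 2ℚ + 1ℚ
9ℚ = 3ℚ * 3ℚ

-- Functions on the cube and hypercontractivity

sgn : Sign → ℚ
sgn Sign.- = - 1ℚ
sgn Sign.+ = 1ℚ

∣sgn∣ : ∀ s → ∣ sgn s ∣ ≡ 1ℚ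
∣sgn∣ Sign.- = refl
∣sgn∣ Sign.+ = refl

signs± : Measure Sign
signs± = measure ((½ , Sign.-) ∷ (½ , Sign.+) ∷ []) (ℚ.nonNegative⁻¹ ½ ∷ ℚ.nonNegative⁻¹ ½ ∷ [])

cube : ∀ n → Measure (Vec Sign n)
cube = pow signs±

signs±-isProbability : IsProbability signs±
signs±-isProbability = refl

cube-isProbability : ∀ n → IsProbability (cube n)
cube-isProbability = pow-isProbability signs± signs±-isProbability

∫-signs± : ∀ f → ∫ signs± f ≡ ½ * f Sign.- + ½ * f Sign.+
∫-signs± f = cong (½ * f Sign.- +_) (ℚ.+-identityʳ (½ * f Sign.+))

∫-cube : ∀ n f → ∫ (cube (suc n)) f ≡
  (∫[ x ∈ cube n ] ½ * f (Sign.- ∷ x) + ½ * f (Sign.+ ∷ x))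
∫-cube n f = begin
  ∫ (cube (suc n)) f
    ≡⟨ ∫-pow signs± n f ⟩
  (∫[ s ∈ signs± ] ∫[ x ∈ cube n ] f (s ∷ x))
    ≡⟨ ∫-signs± (λ s → ∫[ x ∈ cube n ] f (s ∷ x)) ⟩
  ½ * (∫[ x ∈ cube n ] f (Sign.- ∷ x)) + ½ * (∫[ x ∈ cube n ] f (Sign.+ ∷ x))
    ≡⟨ cong₂ _+_ (∫-* (cube n) ½ _) (∫-* (cube n) ½ _) ⟨
  (∫[ x ∈ cube n ] ½ * f (Sign.- ∷ x)) + (∫[ x ∈ cube n ] ½ * f (Sign.+ ∷ x))
    ≡⟨ ∫-+ (cube n) _ _ ⟨
  (∫[ x ∈ cube n ] ½ * f (Sign.- ∷ x) + ½ * f (Sign.+ ∷ x)) ∎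
  where open ≡-Reasoning

-- Multilinear polynomials, expanded in the first coordinate: its coefficient `h` has one degree
-- less. This is the shape of the induction in `hypercontractive`.
data Degree≤ : ∀ {n} → ℕ → (Vec Sign n → ℚ) → Set where
  constant : ∀ {n d} {f : Vec Sign n → ℚ} c → (∀ x → f x ≡ c) → Degree≤ d f
  affine   : ∀ {n d} {f : Vec Sign (suc n) → ℚ} {g h} →
             Degree≤ (suc d) g → Degree≤ d h →
             (∀ s x → f (s ∷ x) ≡ g x + sgn s * h x) → Degree≤ (suc d) f

degree-cong : ∀ {n d} {f g : Vec Sign n → ℚ} → (∀ x → g x ≡ f x) → Degree≤ d f → Degree≤ d g
degree-cong g≡f (constant c f≡)  = constant c (λ x → trans (g≡f x) (f≡ x))
degree-cong g≡f (affine dg dh f≡) = affine dg dh (λ s x → trans (g≡f (s ∷ x)) (f≡ s x))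

degree-cast : ∀ {n d e} {f : Vec Sign n → ℚ} → d ≡ e → Degree≤ d f → Degree≤ e f
degree-cast refl df = df

degree-suc : ∀ {n d} {f : Vec Sign n → ℚ} → Degree≤ d f → Degree≤ (suc d) f
degree-suc (constant c f≡)   = constant c f≡
degree-suc (affine dg dh f≡) = affine (degree-suc dg) (degree-suc dh) f≡

degree-+ˡ : ∀ {n d} e {f : Vec Sign n → ℚ} → Degree≤ d f → Degree≤ (e ℕ.+ d) f
degree-+ˡ zero    df = df
degree-+ˡ (suc e) df = degree-suc (degree-+ˡ e df)

degree-+ : ∀ {n d} {f g : Vec Sign n → ℚ} →
  Degree≤ d f → Degree≤ d g → Degree≤ d (λ x → f x + g x)
degree-+ (constant b f≡) (constant c g≡) = constant (b + c) (λ x → cong₂ _+_ (f≡ x) (g≡ x))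
degree-+ {f = f} (constant b f≡) (affine {g = g} {h} dg dh g≡) =
  affine (degree-+ (constant b (λ _ → refl)) dg) dh
    (λ s x → trans (cong₂ _+_ (f≡ (s ∷ x)) (g≡ s x)) (sym (ℚ.+-assoc b (g x) (sgn s * h x))))
degree-+ (affine {g = g} {h} dg dh f≡) (constant c g≡) =
  affine (degree-+ dg (constant c (λ _ → refl))) dh
    (λ s x → trans (cong₂ _+_ (f≡ s x) (g≡ (s ∷ x))) (rearrange (g x) (sgn s * h x) c))
  where
  rearrange : ∀ p q c → p + q + c ≡ p + c + q
  rearrange = solve-∀ ℚ-ring
degree-+ (affine {g = g} {h} dg dh f≡) (affine {g = g′} {h′} dg′ dh′ f′≡) =
  affine (degree-+ dg dg′) (degree-+ dh dh′)
    (λ s x → trans (cong₂ _+_ (f≡ s x) (f′≡ s x)) (rearrange (g x) (h x) (g′ x) (h′ x) (sgn s)))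
  where
  rearrange : ∀ g h g′ h′ s → (g + s * h) + (g′ + s * h′) ≡ (g + g′) + s * (h + h′)
  rearrange = solve-∀ ℚ-ring

degree-scale : ∀ {n d} c {f : Vec Sign n → ℚ} → Degree≤ d f → Degree≤ d (λ x → c * f x)
degree-scale c (constant b f≡) = constant (c * b) (λ x → cong (c *_) (f≡ x))
degree-scale c (affine {g = g} {h} dg dh f≡) =
  affine (degree-scale c dg) (degree-scale c dh)
    (λ s x → trans (cong (c *_) (f≡ s x)) (rearrange c (g x) (h x) (sgn s)))
  where
  rearrange : ∀ c g h s → c * (g + s * h) ≡ c * g + s * (c * h)
  rearrange = solve-∀ ℚ-ring

sgn*sgn : ∀ s → sgn s * sgn s ≡ 1ℚ
sgn*sgn Sign.- = refl
sgn*sgn Sign.+ = refl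

-- Products stay multilinear because a sign squares to 1: the product of the two slopes joins the
-- part without the first coordinate.
degree-* : ∀ {n d e} {f g : Vec Sign n → ℚ} →
  Degree≤ d f → Degree≤ e g → Degree≤ (d ℕ.+ e) (λ x → f x * g x)
degree-* {d = d} {g = g} (constant b f≡) dg =
  degree-+ˡ d (degree-cong (λ x → cong (_* g x) (f≡ x)) (degree-scale b dg))
degree-* {d = d} {e = e} {f = f} df@(affine _ _ _) (constant c g≡) =
  degree-cast (ℕ.+-comm e d)
    (degree-+ˡ e (degree-cong (λ x → trans (cong (f x *_) (g≡ x)) (ℚ.*-comm (f x) c)) (degree-scale c df)))
degree-* (affine {d = d} {g = g} {h} dg dh f≡) (affine {d = e} {g = g′} {h′} dg′ dh′ f′≡) =
  affine
    (degree-+ (degree-* dg dg′)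
              (degree-suc (degree-cast (sym (ℕ.+-suc d e)) (degree-suc (degree-* dh dh′)))))
    (degree-+ (degree-cast (sym (ℕ.+-suc d e)) (degree-* dg dh′))
              (degree-* dh dg′))
    (λ s x → begin
      _ ≡⟨ cong₂ _*_ (f≡ s x) (f′≡ s x) ⟩
      (g x + sgn s * h x) * (g′ x + sgn s * h′ x)
        ≡⟨ expand (g x) (h x) (g′ x) (h′ x) (sgn s) ⟩
      (g x * g′ x + (sgn s * sgn s) * (h x * h′ x)) + sgn s * (g x * h′ x + h x * g′ x)
        ≡⟨ cong (λ t → (g x * g′ x + t * (h x * h′ x)) + sgn s * (g x * h′ x + h x * g′ x)) (sgn*sgn s) ⟩
      (g x * g′ x + 1ℚ * (h x * h′ x)) + sgn s * (g x * h′ x + h x * g′ x)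
        ≡⟨ cong (λ t → (g x * g′ x + t) + sgn s * (g x * h′ x + h x * g′ x)) (ℚ.*-identityˡ (h x * h′ x)) ⟩
      (g x * g′ x + h x * h′ x) + sgn s * (g x * h′ x + h x * g′ x) ∎)
  where
  open ≡-Reasoning
  expand : ∀ g h g′ h′ s → (g + s * h) * (g′ + s * h′) ≡
    (g * g′ + (s * s) * (h * h′)) + s * (g * h′ + h * g′)
  expand = solve-∀ ℚ-ring

degree-lookup : ∀ {n} (i : Fin n) → Degree≤ 1 (λ x → sgn (Vec.lookup x i))
degree-lookup zero = affine (constant 0ℚ (λ _ → refl)) (constant 1ℚ (λ _ → refl)) λ s _ →
  sym (trans (ℚ.+-identityˡ (sgn s * 1ℚ)) (ℚ.*-identityʳ (sgn s)))
degree-lookup (suc i) = affine (degree-lookup i) (constant 0ℚ (λ _ → refl)) λ s x →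
  sym (trans (cong (sgn (Vec.lookup x i) +_) (ℚ.*-zeroʳ (sgn s))) (ℚ.+-identityʳ (sgn (Vec.lookup x i))))

degree-∫ : ∀ {n d} (ν : Measure B) {f : B → Vec Sign n → ℚ} →
  (∀ b → Degree≤ d (f b)) → Degree≤ d (λ x → ∫[ b ∈ ν ] f b x)
degree-∫ ν {f} df = go (atoms ν)
  where
  go : ∀ ys → Degree≤ _ (λ x → integrate ys (λ b → f b x))
  go []             = constant 0ℚ (λ _ → refl)
  go ((w , b) ∷ ys) = degree-+ (degree-scale w (df b)) (go ys)

module _ {n} (f : Vec Sign (suc n) → ℚ) (g h : Vec Sign n → ℚ) (f≡ : ∀ s x → f (s ∷ x) ≡ g x + sgn s * h x) where

  ∫-affine² : (∫[ x ∈ cube (suc n) ] f x * f x) ≡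
    (∫[ x ∈ cube n ] g x * g x) + (∫[ x ∈ cube n ] h x * h x)
  ∫-affine² = begin
    (∫[ x ∈ cube (suc n) ] f x * f x)
      ≡⟨ ∫-cube n _ ⟩
    (∫[ x ∈ cube n ] ½ * (f (Sign.- ∷ x) * f (Sign.- ∷ x)) + ½ * (f (Sign.+ ∷ x) * f (Sign.+ ∷ x)))
      ≡⟨ ∫-cong (cube n) (λ x → trans
           (cong₂ (λ p q → ½ * (p * p) + ½ * (q * q)) (f≡ Sign.- x) (f≡ Sign.+ x))
           (average (g x) (h x))) ⟩
    (∫[ x ∈ cube n ] g x * g x + h x * h x)
      ≡⟨ ∫-+ (cube n) _ _ ⟩
    (∫[ x ∈ cube n ] g x * g x) + (∫[ x ∈ cube n ] h x * h x) ∎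
    where
    open ≡-Reasoning
    average : ∀ g h → ½ * ((g + (- 1ℚ) * h) * (g + (- 1ℚ) * h)) + ½ * ((g + 1ℚ * h) * (g + 1ℚ * h)) ≡ g * g + h * h
    average = solve-∀ ℚ-ring

  ∫-affine⁴ : (∫[ x ∈ cube (suc n) ] (f x * f x) * (f x * f x)) ≡
    (∫[ x ∈ cube n ] (g x * g x) * (g x * g x)) + (∫[ x ∈ cube n ] (h x * h x) * (h x * h x)) +
    (2ℚ * 3ℚ) * (∫[ x ∈ cube n ] (g x * g x) * (h x * h x))
  ∫-affine⁴ = begin
    (∫[ x ∈ cube (suc n) ] (f x * f x) * (f x * f x))
      ≡⟨ ∫-cube n _ ⟩
    _ ≡⟨ ∫-cong (cube n) (λ x → trans
           (cong₂ (λ p q → ½ * ((p * p) * (p * p)) + ½ * ((q * q) * (q * q))) (f≡ Sign.- x) (f≡ Sign.+ x))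
           (average (g x) (h x))) ⟩
    (∫[ x ∈ cube n ] ((g x * g x) * (g x * g x) + (h x * h x) * (h x * h x)) + (2ℚ * 3ℚ) * ((g x * g x) * (h x * h x)))
      ≡⟨ ∫-+ (cube n) _ _ ⟩
    (∫[ x ∈ cube n ] (g x * g x) * (g x * g x) + (h x * h x) * (h x * h x)) +
    (∫[ x ∈ cube n ] (2ℚ * 3ℚ) * ((g x * g x) * (h x * h x)))
      ≡⟨ cong₂ _+_ (∫-+ (cube n) _ _) (∫-* (cube n) (2ℚ * 3ℚ) _) ⟩
    _ ∎
    where
    open ≡-Reasoning
    average : ∀ g h →
      ½ * (((g + (- 1ℚ) * h) * (g + (- 1ℚ) * h)) * ((g + (- 1ℚ) * h) * (g + (- 1ℚ) * h))) +
      ½ * (((g + 1ℚ * h) * (g + 1ℚ * h)) * ((g + 1ℚ * h) * (g + 1ℚ * h))) ≡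
      ((g * g) * (g * g) + (h * h) * (h * h)) + ((1ℚ + 1ℚ) * ((1ℚ + 1ℚ) + 1ℚ)) * ((g * g) * (h * h))
    average = solve-∀ ℚ-ring

0≤9^ : ∀ d → 0ℚ ≤ 9ℚ ^ d
0≤9^ d = ^-nonneg d (ℚ.nonNegative⁻¹ 9ℚ)

-- Bonami's lemma, by induction on the first coordinate. Odd powers of a sign average out, so the
-- fourth moment is that of `g` plus that of `h` plus 6 times the mixed term. By Cauchy-Schwarz the
-- mixed term is at most the geometric mean of the bounds for `g` and `h`, with constant √(9c · c) =
-- 3c. Then 6 · 3c = 18c is exactly the cross coefficient of 9c (G + H)², and 8c H² is left over.
hypercontractive : ∀ {n d} {f : Vec Sign n → ℚ} → Degree≤ d f →
  (∫[ x ∈ cube n ] (f x * f x) * (f x * f x)) ≤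
  9ℚ ^ d * ((∫[ x ∈ cube n ] f x * f x) * (∫[ x ∈ cube n ] f x * f x))
hypercontractive {n} {d} {f} (constant c f≡) = begin
  (∫[ x ∈ cube n ] (f x * f x) * (f x * f x))
    ≡⟨ ∫-cong (cube n) (λ x → cong (λ t → (t * t) * (t * t)) (f≡ x)) ⟩
  (∫[ x ∈ cube n ] (c * c) * (c * c))
    ≡⟨ ∫-const (cube n) (cube-isProbability n) _ ⟩
  (c * c) * (c * c)
    ≡⟨ ℚ.*-identityˡ _ ⟨
  1ℚ * ((c * c) * (c * c))
    ≤⟨ *-monoʳ-≤ _ (p*p-nonneg (c * c)) (1≤p⇒1≤p^n d (ℚ.≤ᵇ⇒≤ _)) ⟩
  9ℚ ^ d * ((c * c) * (c * c))
    ≡⟨ cong (λ t → 9ℚ ^ d * (t * t)) (trans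
         (∫-cong (cube n) (λ x → cong (λ t → t * t) (f≡ x)))
         (∫-const (cube n) (cube-isProbability n) _)) ⟨
  9ℚ ^ d * ((∫[ x ∈ cube n ] f x * f x) * (∫[ x ∈ cube n ] f x * f x)) ∎
  where open ℚ.≤-Reasoning
hypercontractive {suc n} {suc d} {f} (affine {g = g} {h} dg dh f≡) = begin
  (∫[ x ∈ cube (suc n) ] (f x * f x) * (f x * f x))
    ≡⟨ ∫-affine⁴ f g h f≡ ⟩
  G⁴ + H⁴ + (2ℚ * 3ℚ) * X
    ≤⟨ ℚ.+-mono-≤ (ℚ.+-mono-≤ (hypercontractive dg) (hypercontractive dh))
         (*-monoˡ-≤ (2ℚ * 3ℚ) (ℚ.nonNegative⁻¹ (2ℚ * 3ℚ)) X≤) ⟩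
  (9ℚ * c) * (G * G) + c * (H * H) + (2ℚ * 3ℚ) * (3ℚ * c * (G * H))
    ≤⟨ ≤-by ((2ℚ * 2ℚ * 2ℚ) * (c * (H * H)))
         (*-nonneg (ℚ.nonNegative⁻¹ (2ℚ * 2ℚ * 2ℚ)) (*-nonneg (0≤9^ d) (p*p-nonneg H))) (square c G H) ⟩
  (9ℚ * c) * ((G + H) * (G + H))
    ≡⟨ cong (λ t → (9ℚ * c) * (t * t)) (∫-affine² f g h f≡) ⟨
  9ℚ ^ suc d * ((∫[ x ∈ cube (suc n) ] f x * f x) * (∫[ x ∈ cube (suc n) ] f x * f x)) ∎
  where
  open ℚ.≤-Reasoning
  c = 9ℚ ^ d
  G  = ∫[ x ∈ cube n ] g x * g x
  H  = ∫[ x ∈ cube n ] h x * h x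
  G⁴ = ∫[ x ∈ cube n ] (g x * g x) * (g x * g x)
  H⁴ = ∫[ x ∈ cube n ] (h x * h x) * (h x * h x)
  X  = ∫[ x ∈ cube n ] (g x * g x) * (h x * h x)
  0≤G = ∫-nonneg (cube n) (λ x → p*p-nonneg (g x))
  0≤H = ∫-nonneg (cube n) (λ x → p*p-nonneg (h x))
  0≤H⁴ = ∫-nonneg (cube n) (λ x → p*p-nonneg (h x * h x))
  square : ∀ c G H → ((((1ℚ + 1ℚ) + 1ℚ) * ((1ℚ + 1ℚ) + 1ℚ)) * c) * ((G + H) * (G + H)) ≡
    (((((1ℚ + 1ℚ) + 1ℚ) * ((1ℚ + 1ℚ) + 1ℚ)) * c) * (G * G) + c * (H * H) + ((1ℚ + 1ℚ) * ((1ℚ + 1ℚ) + 1ℚ)) * (((1ℚ + 1ℚ) + 1ℚ) * c * (G * H)))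
    + ((1ℚ + 1ℚ) * (1ℚ + 1ℚ) * (1ℚ + 1ℚ)) * (c * (H * H))
  square = solve-∀ ℚ-ring
  regroup : ∀ c G H → ((((1ℚ + 1ℚ) + 1ℚ) * ((1ℚ + 1ℚ) + 1ℚ)) * c * (G * G)) * (c * (H * H)) ≡
    (((1ℚ + 1ℚ) + 1ℚ) * c * (G * H)) * (((1ℚ + 1ℚ) + 1ℚ) * c * (G * H))
  regroup = solve-∀ ℚ-ring
  X≤ : X ≤ 3ℚ * c * (G * H)
  X≤ = p*p≤q*q⇒p≤q
    (*-nonneg (*-nonneg (ℚ.nonNegative⁻¹ 3ℚ) (0≤9^ d)) (*-nonneg 0≤G 0≤H)) (begin
    X * X
      ≤⟨ ∫-cauchy-schwarz (cube n) (λ x → g x * g x) (λ x → h x * h x) ⟩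
    G⁴ * H⁴
      ≤⟨ *-mono-≤ (∫-nonneg (cube n) (λ x → p*p-nonneg (g x * g x)))
           (*-nonneg (0≤9^ d) (p*p-nonneg H)) (hypercontractive dg) (hypercontractive dh) ⟩
    (9ℚ * c * (G * G)) * (c * (H * H))
      ≡⟨ regroup c G H ⟩
    (3ℚ * c * (G * H)) * (3ℚ * c * (G * H)) ∎)

-- Moments of order 2ᵖ and the level inequality

squares : ℕ → ℚ → ℚ
squares zero    x = x
squares (suc p) x = squares p x * squares p x

squares-* : ∀ p x y → squares p (x * y) ≡ squares p x * squares p y
squares-* zero    x y = refl
squares-* (suc p) x y = trans (cong (λ t → t * t) (squares-* p x y)) (interchange (squares p x) (squares p y))
  where
  interchange : ∀ a b → (a * b) * (a * b) ≡ (a * a) * (b * b)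
  interchange = solve-∀ ℚ-ring

squares-nonneg : ∀ p {x} → 0ℚ ≤ x → 0ℚ ≤ squares p x
squares-nonneg zero        0≤x = 0≤x
squares-nonneg (suc p) {x} 0≤x = p*p-nonneg (squares p x)

-- As `squares p x` is x^(2ᵖ), this stands in for taking a 2ᵖ-th root, one square root at a time.
squares-cancel-≤ : ∀ p {x y} → 0ℚ ≤ y → squares p x ≤ squares p y → x ≤ y
squares-cancel-≤ zero        0≤y x≤y = x≤y
squares-cancel-≤ (suc p) 0≤y x≤y = squares-cancel-≤ p 0≤y (p*p≤q*q⇒p≤q (squares-nonneg p 0≤y) x≤y)

module _ {n} (f : Vec Sign n → ℚ) where

  degree-squares : ∀ {d} → Degree≤ d f → ∀ p →
    ∃ λ e → Degree≤ e (λ x → squares p (f x)) × 9ℚ ^ e ≡ squares p (9ℚ ^ d)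
  degree-squares {d} df zero    = d , df , refl
  degree-squares {d} df (suc p) with degree-squares df p
  ... | e , de , 9ᵉ≡ = e ℕ.+ e , degree-* de de , trans (^-homo-* 9ℚ e e) (cong (λ t → t * t) 9ᵉ≡)

  -- The fourth-moment inequality is applied to f, f², f⁴, and so on. Squaring doubles the degree,
  -- so the p-th application costs (9^d)^(2ᵖ), which is one more factor 3^d inside the power
  -- 2^(p+1).
  moments : ∀ {d} → Degree≤ d f → ∀ p →
    (∫[ x ∈ cube n ] squares (suc p) (f x)) ≤ squares p ((3ℚ ^ d) ^ p * (∫[ x ∈ cube n ] f x * f x))
  moments {d} df zero    = ℚ.≤-reflexive (sym (ℚ.*-identityˡ _))
  moments {d} df (suc p) with degree-squares df p
  ... | e , de , 9ᵉ≡ = begin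
    (∫[ x ∈ cube n ] squares (suc (suc p)) (f x))
      ≤⟨ hypercontractive de ⟩
    9ℚ ^ e * (N * N)
      ≤⟨ *-monoˡ-≤ (9ℚ ^ e) (0≤9^ e) (*-mono-≤ 0≤N (ℚ.≤-trans 0≤N (moments df p)) (moments df p) (moments df p)) ⟩
    9ℚ ^ e * (squares p (T ^ p * V) * squares p (T ^ p * V))
      ≡⟨ cong₂ _*_ (trans 9ᵉ≡ (cong (squares p) (^-distrib-* 3ℚ 3ℚ d))) (sym (squares-* p (T ^ p * V) (T ^ p * V))) ⟩
    squares p (T * T) * squares p ((T ^ p * V) * (T ^ p * V))
      ≡⟨ squares-* p (T * T) _ ⟨
    squares p ((T * T) * ((T ^ p * V) * (T ^ p * V)))
      ≡⟨ cong (squares p) (regroup T (T ^ p) V) ⟩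
    squares p ((T ^ suc p * V) * (T ^ suc p * V))
      ≡⟨ squares-* p _ _ ⟩
    squares (suc p) (T ^ suc p * V) ∎
    where
    open ℚ.≤-Reasoning
    T = 3ℚ ^ d
    V = ∫[ x ∈ cube n ] f x * f x
    N = ∫[ x ∈ cube n ] squares (suc p) (f x)
    0≤N = ∫-nonneg (cube n) (λ x → p*p-nonneg (squares p (f x)))
    regroup : ∀ T t V → (T * T) * ((t * V) * (t * V)) ≡ ((T * t) * V) * ((T * t) * V)
    regroup = solve-∀ ℚ-ring

  -- A variance under the density `h` is nonnegative; this is applied to f and then to its
  -- successive squares.
  jensen : ∀ (h : Vec Sign n → ℚ) → (∀ x → 0ℚ ≤ h x) → ∫ (cube n) h ≡ 1ℚ → ∀ p →
    squares (suc p) (∫[ x ∈ cube n ] h x * f x) ≤ (∫[ x ∈ cube n ] h x * squares (suc p) (f x))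
  jensen h 0≤h h₁ p = go (suc p)
    where
    open ℚ.≤-Reasoning
    one : ∀ F → (∫[ x ∈ cube n ] h x * F x) * (∫[ x ∈ cube n ] h x * F x) ≤ (∫[ x ∈ cube n ] h x * (F x * F x))
    one F = begin
      M * M
        ≤⟨ ≤-by _ (∫-nonneg (cube n) (λ x → *-nonneg (0≤h x) (p*p-nonneg (F x - M)))) (sym variance) ⟩
      (∫[ x ∈ cube n ] h x * (F x * F x)) ∎
      where
      M = ∫[ x ∈ cube n ] h x * F x
      expand : ∀ h F M → h * ((F - M) * (F - M)) ≡ (h * (F * F) - (M + M) * (h * F)) + (M * M) * h
      expand = solve-∀ ℚ-ring
      collect : ∀ M M₂ → M * M + ((M₂ - (M + M) * M) + (M * M) * 1ℚ) ≡ M₂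
      collect = solve-∀ ℚ-ring
      variance : M * M + (∫[ x ∈ cube n ] h x * ((F x - M) * (F x - M))) ≡ (∫[ x ∈ cube n ] h x * (F x * F x))
      variance = begin-equality
        M * M + (∫[ x ∈ cube n ] h x * ((F x - M) * (F x - M)))
          ≡⟨ cong (M * M +_) (∫-cong (cube n) (λ x → expand (h x) (F x) M)) ⟩
        M * M + (∫[ x ∈ cube n ] (h x * (F x * F x) - (M + M) * (h x * F x)) + (M * M) * h x)
          ≡⟨ cong (M * M +_) (trans (∫-+ (cube n) _ _) (cong₂ _+_
               (trans (∫-- (cube n) _ _) (cong (λ t → M₂ - t) (∫-* (cube n) (M + M) _)))
               (trans (∫-* (cube n) (M * M) h) (cong ((M * M) *_) h₁)))) ⟩
        M * M + ((M₂ - (M + M) * M) + (M * M) * 1ℚ)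
          ≡⟨ collect M M₂ ⟩
        M₂ ∎
        where M₂ = ∫[ x ∈ cube n ] h x * (F x * F x)
    go : ∀ p → squares p (∫[ x ∈ cube n ] h x * f x) ≤ (∫[ x ∈ cube n ] h x * squares p (f x))
    go zero    = ℚ.≤-refl
    go (suc zero) = one f
    go (suc (suc p)) = begin
      M₂ * M₂
        ≤⟨ *-mono-≤ 0≤M₂ (ℚ.≤-trans 0≤M₂ (go (suc p))) (go (suc p)) (go (suc p)) ⟩
      (∫[ x ∈ cube n ] h x * squares (suc p) (f x)) * (∫[ x ∈ cube n ] h x * squares (suc p) (f x))
        ≤⟨ one (λ x → squares (suc p) (f x)) ⟩
      (∫[ x ∈ cube n ] h x * squares (suc (suc p)) (f x)) ∎
      where
      M₂ = squares (suc p) (∫[ x ∈ cube n ] h x * f x)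
      0≤M₂ : 0ℚ ≤ M₂
      0≤M₂ = p*p-nonneg (squares p (∫[ x ∈ cube n ] h x * f x))

  -- In the moment of order 2^(p+1) the density h costs only a factor √2.
  level-inequality-normalised : ∀ {d} → Degree≤ d f → ∀ p (h : Vec Sign n → ℚ) →
    (∀ x → 0ℚ ≤ h x) → (∀ x → h x ≤ squares p 2ℚ) → ∫ (cube n) h ≡ 1ℚ →
    (∫[ x ∈ cube n ] h x * f x) * (∫[ x ∈ cube n ] h x * f x) ≤
    2ℚ * ((3ℚ ^ d) ^ p * (∫[ x ∈ cube n ] f x * f x))
  level-inequality-normalised {d} df p h 0≤h h≤ h₁ = squares-cancel-≤ p
    (*-nonneg (ℚ.nonNegative⁻¹ 2ℚ) (*-nonneg (^-nonneg p (^-nonneg d (ℚ.nonNegative⁻¹ 3ℚ)))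
      (∫-nonneg (cube n) (λ x → p*p-nonneg (f x)))))
    (begin
    squares p (M * M)
      ≡⟨ squares-* p M M ⟩
    squares (suc p) M
      ≤⟨ jensen h 0≤h h₁ p ⟩
    (∫[ x ∈ cube n ] h x * squares (suc p) (f x))
      ≤⟨ ∫-mono (cube n) (λ x → *-monoʳ-≤ (squares (suc p) (f x)) (p*p-nonneg (squares p (f x))) (h≤ x)) ⟩
    (∫[ x ∈ cube n ] squares p 2ℚ * squares (suc p) (f x))
      ≡⟨ ∫-* (cube n) (squares p 2ℚ) _ ⟩
    squares p 2ℚ * (∫[ x ∈ cube n ] squares (suc p) (f x))
      ≤⟨ *-monoˡ-≤ (squares p 2ℚ) (squares-nonneg p (ℚ.nonNegative⁻¹ 2ℚ)) (moments df p) ⟩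
    squares p 2ℚ * squares p ((3ℚ ^ d) ^ p * (∫[ x ∈ cube n ] f x * f x))
      ≡⟨ squares-* p 2ℚ _ ⟨
    squares p (2ℚ * ((3ℚ ^ d) ^ p * (∫[ x ∈ cube n ] f x * f x))) ∎)
    where
    open ℚ.≤-Reasoning
    M = ∫[ x ∈ cube n ] h x * f x

p≤0⇒p≡0 : ∀ {p} → 0ℚ ≤ p → p ≤ 0ℚ → p ≡ 0ℚ
p≤0⇒p≡0 0≤p p≤0 = ℚ.≤-antisym p≤0 0≤p

*-cancelʳ-≤ : ∀ {p q} → 0ℚ ≤ p → 0ℚ ≤ q → p * p ≤ q * p → p ≤ q
*-cancelʳ-≤ {p} {q} 0≤p 0≤q p²≤qp with p ℚ.≤? 0ℚ
... | yes p≤0 = ℚ.≤-trans p≤0 0≤q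
... | no p≰0 = ℚ.*-cancelʳ-≤-pos p {{ℚ.positive (ℚ.≰⇒> p≰0)}} p²≤qp

reciprocal : ∀ {p} → 0ℚ < p → ∃ λ r → 0ℚ ≤ r × r * p ≡ 1ℚ
reciprocal {p} 0<p = ℚ.1/ p , ℚ.<⇒≤ (ℚ.positive⁻¹ (ℚ.1/ p) {{ℚ.1/pos⇒pos p}}) , ℚ.*-inverseˡ p
  where
  instance
    _ = ℚ.positive 0<p
    _ = ℚ.pos⇒nonZero p

0≤∧≢0⇒> : ∀ {p} → 0ℚ ≤ p → p ≢ 0ℚ → 0ℚ < p
0≤∧≢0⇒> 0≤p p≢0 = ℚ.≰⇒> (λ p≤0 → p≢0 (p≤0⇒p≡0 0≤p p≤0))

-- Division of `v` by `p` that also covers p = 0, where the hypothesis forces v = 0. It produces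
-- conditional expectations given a state whose probability `p` may vanish.
factor : ∀ {p v y} → 0ℚ ≤ p → 0ℚ ≤ y → v * v ≤ p * p * y → ∃ λ u → v ≡ p * u × u * u ≤ y
factor {p} {v} {y} 0≤p 0≤y v²≤p²y with p ℚ.≟ 0ℚ
... | yes refl = 0ℚ
    , ℚ.≤-antisym (p*p≤q*q⇒p≤q ℚ.≤-refl v²≤0) (subst (0ℚ ≤_) (neg-neg v) (ℚ.neg-antimono-≤ (p*p≤q*q⇒p≤q ℚ.≤-refl (subst (_≤ 0ℚ) (neg² v) v²≤0))))
    , 0≤y
  where
  neg² : ∀ p → p * p ≡ (- p) * (- p)
  neg² = solve-∀ ℚ-ring
  neg-neg : ∀ p → - (- p) ≡ p
  neg-neg = solve-∀ ℚ-ring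
  v²≤0 : v * v ≤ 0ℚ
  v²≤0 = subst (v * v ≤_) (ℚ.*-zeroˡ y) v²≤p²y
... | no p≢0 with reciprocal (0≤∧≢0⇒> 0≤p p≢0)
...   | r , 0≤r , rp≡1 = r * v , v≡ , (begin
  (r * v) * (r * v)        ≡⟨ regroup r v ⟩
  (r * r) * (v * v)        ≤⟨ *-monoˡ-≤ (r * r) (p*p-nonneg r) v²≤p²y ⟩
  (r * r) * (p * p * y)    ≡⟨ regroup′ r p y ⟩
  (r * p) * (r * p) * y    ≡⟨ cong (λ t → t * t * y) rp≡1 ⟩
  1ℚ * y                   ≡⟨ ℚ.*-identityˡ y ⟩
  y                        ∎)
  where
  open ℚ.≤-Reasoning
  regroup : ∀ r v → (r * v) * (r * v) ≡ (r * r) * (v * v)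
  regroup = solve-∀ ℚ-ring
  regroup′ : ∀ r p y → (r * r) * (p * p * y) ≡ (r * p) * (r * p) * y
  regroup′ = solve-∀ ℚ-ring
  commute : ∀ p r v → r * p * v ≡ p * (r * v)
  commute = solve-∀ ℚ-ring
  v≡ : v ≡ p * (r * v)
  v≡ = trans (sym (ℚ.*-identityˡ v)) (trans (cong (_* v) (sym rp≡1)) (commute p r v))

-- The homogeneous form, in which `h` has any total mass P. If P = 0 the density bound makes `h`
-- vanish; otherwise `h` is divided by P.
level-inequality : ∀ {n d} {f : Vec Sign n → ℚ} → Degree≤ d f → ∀ p (h : Vec Sign n → ℚ) →
  (∀ x → 0ℚ ≤ h x) → (∀ x → h x ≤ squares p 2ℚ * ∫ (cube n) h) →
  (∫[ x ∈ cube n ] h x * f x) * (∫[ x ∈ cube n ] h x * f x) ≤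
  (2ℚ * (3ℚ ^ d) ^ p) * ((∫ (cube n) h * ∫ (cube n) h) * (∫[ x ∈ cube n ] f x * f x))
level-inequality {n} {d} {f} df p h 0≤h h≤ with ∫ (cube n) h ℚ.≟ 0ℚ
... | yes P≡0 = ℚ.≤-reflexive (trans
  (cong (λ t → t * t) (trans (∫-cong (cube n) (λ x → trans (cong (_* f x) (h≡0 x)) (ℚ.*-zeroˡ (f x)))) (∫-0 (cube n))))
  (sym (trans (cong (λ t → (2ℚ * (3ℚ ^ d) ^ p) * ((t * t) * (∫[ x ∈ cube n ] f x * f x))) P≡0)
     (zero³ (2ℚ * (3ℚ ^ d) ^ p) (∫[ x ∈ cube n ] f x * f x)))))
  where
  zero³ : ∀ a b → a * ((0ℚ * 0ℚ) * b) ≡ 0ℚ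
  zero³ = solve-∀ ℚ-ring
  h≡0 : ∀ x → h x ≡ 0ℚ
  h≡0 x = p≤0⇒p≡0 (0≤h x) (subst (h x ≤_) (trans (cong (squares p 2ℚ *_) P≡0) (ℚ.*-zeroʳ (squares p 2ℚ))) (h≤ x))
... | no P≢0 with reciprocal (0≤∧≢0⇒> (∫-nonneg (cube n) 0≤h) P≢0)
...   | r , 0≤r , rP≡1 = begin
  M * M                            ≡⟨ cong (λ t → t * t) M≡ ⟩
  (P * N) * (P * N)                ≡⟨ regroup P N ⟩
  (P * P) * (N * N)                ≤⟨ *-monoˡ-≤ (P * P) (p*p-nonneg P) N²≤ ⟩
  (P * P) * (2ℚ * (K * F))         ≡⟨ regroup′ (P * P) 2ℚ K F ⟩
  (2ℚ * K) * ((P * P) * F)         ∎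
  where
  open ℚ.≤-Reasoning
  P = ∫ (cube n) h
  K = (3ℚ ^ d) ^ p
  F = ∫[ x ∈ cube n ] f x * f x
  M = ∫[ x ∈ cube n ] h x * f x
  N = ∫[ x ∈ cube n ] (r * h x) * f x
  regroup : ∀ P N → (P * N) * (P * N) ≡ (P * P) * (N * N)
  regroup = solve-∀ ℚ-ring
  regroup′ : ∀ P t K F → P * (t * (K * F)) ≡ (t * K) * (P * F)
  regroup′ = solve-∀ ℚ-ring
  M≡ : M ≡ P * N
  M≡ = sym (begin-equality
    P * N          ≡⟨ cong (P *_) (trans (∫-cong (cube n) (λ x → ℚ.*-assoc r (h x) (f x))) (∫-* (cube n) r _)) ⟩
    P * (r * M)    ≡⟨ ℚ.*-assoc P r M ⟨
    P * r * M      ≡⟨ cong (_* M) (trans (ℚ.*-comm P r) rP≡1) ⟩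
    1ℚ * M         ≡⟨ ℚ.*-identityˡ M ⟩
    M              ∎)
  N²≤ : N * N ≤ 2ℚ * (K * F)
  N²≤ = level-inequality-normalised f df p (λ x → r * h x)
    (λ x → *-nonneg 0≤r (0≤h x))
    (λ x → begin
      r * h x                   ≤⟨ *-monoˡ-≤ r 0≤r (h≤ x) ⟩
      r * (squares p 2ℚ * P)    ≡⟨ commute r (squares p 2ℚ) P ⟩
      squares p 2ℚ * (r * P)    ≡⟨ cong (squares p 2ℚ *_) rP≡1 ⟩
      squares p 2ℚ * 1ℚ         ≡⟨ ℚ.*-identityʳ _ ⟩
      squares p 2ℚ              ∎)
    (trans (∫-* (cube n) r h) rP≡1)
    where
    commute : ∀ r s P → r * (s * P) ≡ s * (r * P)
    commute = solve-∀ ℚ-ring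

ι : ℕ → ℚ
ι zero    = 0ℚ
ι (suc n) = 1ℚ + ι n

-- Streams of independent samples against planted streams

likelihood : {H C : Set} → (H → C → ℚ) → H → ∀ {t} → Vec C t → ℚ
likelihood L σ []       = 1ℚ
likelihood L σ (c ∷ cs) = L σ c * likelihood L σ cs

module Evolution
  {C Z : Set} {n : ℕ} (μ : Measure C) (μ₁ : IsProbability μ)
  (L : Vec Sign n → C → ℚ) (0≤L : ∀ σ c → 0ℚ ≤ L σ c) (∫L : ∀ σ → ∫ μ (L σ) ≡ 1ℚ)
  (d : ℕ) (L-degree : ∀ c → Degree≤ d (λ σ → L σ c))
  -- κ bounds the squared norm of the operator g ↦ ∫ g (L - 1), which sends functions of a
  -- constraint to polynomials of degree d in the assignment.
  (κ : ℚ) (0≤κ : 0ℚ ≤ κ)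
  (kernel : ∀ (g : C → ℚ) → (∫[ σ ∈ cube n ] (∫[ c ∈ μ ] g c * (L σ c - 1ℚ)) * (∫[ c ∈ μ ] g c * (L σ c - 1ℚ)))
                  ≤ κ * (∫[ c ∈ μ ] g c * g c))
  -- ζ counts the states and δ is the indicator of equality, given only by its reproducing property
  -- `∫δ`.
  (ζ : Measure Z) (δ : Z → Z → ℚ) (0≤δ : ∀ z y → 0ℚ ≤ δ z y) (δ≤1 : ∀ z y → δ z y ≤ 1ℚ)
  (∫δ : ∀ z (u : Z → ℚ) → (∫[ y ∈ ζ ] δ z y * u y) ≡ u z)
  (S : Z → C → Z) (z₀ : Z) (p : ℕ)
  where

  open ℚ.≤-Reasoning

  private
    Ω = cube n
    Λ = squares p 2ℚ
    θ = squares p ½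
    -- The mass lost in one step: at most θ for each state. `bias` is the χ²-distance allowed to the
    -- next constraint given a state.
    η = (∫[ _ ∈ ζ ] 1ℚ) * θ
    bias = 2ℚ * (3ℚ ^ d) ^ p * κ

    0≤bias : 0ℚ ≤ bias
    0≤bias = *-nonneg (*-nonneg (ℚ.nonNegative⁻¹ 2ℚ) (^-nonneg p (^-nonneg d (ℚ.nonNegative⁻¹ 3ℚ)))) 0≤κ

    0≤1+bias : 0ℚ ≤ 1ℚ + bias
    0≤1+bias = +-nonneg 0≤1 0≤bias

    0≤Λ : 0ℚ ≤ Λ
    0≤Λ = squares-nonneg p (ℚ.nonNegative⁻¹ 2ℚ)

    0≤θ : 0ℚ ≤ θ
    0≤θ = squares-nonneg p (ℚ.nonNegative⁻¹ ½)

    Λθ≡1 : Λ * θ ≡ 1ℚ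
    Λθ≡1 = trans (sym (squares-* p 2ℚ ½)) (go p)
      where
      go : ∀ p → squares p 1ℚ ≡ 1ℚ
      go zero    = refl
      go (suc p) = cong (λ t → t * t) (go p)

  final : ∀ {t} → Z → Vec C t → Z
  final z cs = List.foldl S z (Vec.toList cs)

  random : ∀ t → (Z → ℚ) → Z → ℚ
  random t u z = ∫[ cs ∈ pow μ t ] u (final z cs)

  planted : ∀ t → Vec Sign n → (Z → ℚ) → Z → ℚ
  planted t σ u z = ∫[ cs ∈ pow μ t ] likelihood L σ cs * u (final z cs)

  private
    next : (Z → ℚ) → Z → ℚ
    next u z = ∫[ c ∈ μ ] u (S z c)

    nextᴸ : Vec Sign n → (Z → ℚ) → Z → ℚ
    nextᴸ σ u z = ∫[ c ∈ μ ] L σ c * u (S z c)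

    random-zero : ∀ u z → random zero u z ≡ u z
    random-zero u z = ∫-dirac {A = Vec C zero} [] (λ cs → u (final z cs))

    random-first : ∀ t u z → random (suc t) u z ≡ (∫[ c ∈ μ ] random t u (S z c))
    random-first t u z = ∫-pow μ t (λ cs → u (final z cs))

    -- `pow` splits off the first constraint, whereas the induction on time appends one at the end.
    -- Here and in `planted-last` the last step is moved into the test function.
    random-last : ∀ t u z → random (suc t) u z ≡ random t (next u) z
    random-last zero    u z = trans (random-first zero u z)
      (trans (∫-cong μ (λ c → random-zero u (S z c))) (sym (random-zero (next u) z)))
    random-last (suc t) u z = trans (random-first (suc t) u z)
      (trans (∫-cong μ (λ c → random-last t u (S z c))) (sym (random-first t (next u) z)))

    planted-zero : ∀ σ u z → planted zero σ u z ≡ u z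
    planted-zero σ u z = trans (∫-dirac {A = Vec C zero} [] (λ cs → likelihood L σ cs * u (final z cs))) (ℚ.*-identityˡ (u z))

    planted-first : ∀ t σ u z → planted (suc t) σ u z ≡ (∫[ c ∈ μ ] L σ c * planted t σ u (S z c))
    planted-first t σ u z = trans (∫-pow μ t (λ cs → likelihood L σ cs * u (final z cs)))
      (∫-cong μ (λ c → trans (∫-cong (pow μ t) (λ cs → ℚ.*-assoc (L σ c) _ _)) (∫-* (pow μ t) (L σ c) _)))

    planted-last : ∀ t σ u z → planted (suc t) σ u z ≡ planted t σ (nextᴸ σ u) z
    planted-last zero    σ u z = trans (planted-first zero σ u z)
      (trans (∫-cong μ (λ c → cong (L σ c *_) (planted-zero σ u (S z c)))) (sym (planted-zero σ (nextᴸ σ u) z)))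
    planted-last (suc t) σ u z = trans (planted-first (suc t) σ u z)
      (trans (∫-cong μ (λ c → cong (L σ c *_) (planted-last t σ u (S z c)))) (sym (planted-first t σ (nextᴸ σ u) z)))

    -- w σ z is the probability of reaching z when σ is planted, along runs that
    -- avoid all states of total weight below θ; only then is the density bounded.
    record Approximates (t : ℕ) (w : Vec Sign n → Z → ℚ) : Set where
      field
        nonnegative : ∀ σ z → 0ℚ ≤ w σ z
        mass≤1      : ∀ σ → ∫ ζ (w σ) ≤ 1ℚ
        density     : ∀ σ z → w σ z ≤ Λ * (∫[ τ ∈ Ω ] w τ z)
        -- The second moment of the likelihood ratio in dual form, against all test functions. The
        -- ratio itself would require dividing by the probability of a state under the random
        -- stream.
        χ²          : ∀ (u : Z → ℚ) → (∫[ z ∈ ζ ] (∫[ σ ∈ Ω ] w σ z) * u z) * (∫[ z ∈ ζ ] (∫[ σ ∈ Ω ] w σ z) * u z)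
                            ≤ (1ℚ + bias) ^ t * random t (λ z → u z * u z) z₀
        -- The test function may depend on σ, because the induction step applies this to
        -- `nextᴸ σ (u σ)`.
        loss        : ∀ (u : Vec Sign n → Z → ℚ) → (∀ σ z → 0ℚ ≤ u σ z) → (∀ σ z → u σ z ≤ 1ℚ) →
                      (∫[ σ ∈ Ω ] planted t σ (u σ) z₀) ≤
                      (∫[ σ ∈ Ω ] ∫[ z ∈ ζ ] w σ z * u σ z) + ι t * η

    open Approximates

    δ-approximates : Approximates zero (λ _ → δ z₀)
    nonnegative δ-approximates σ z = 0≤δ z₀ z
    mass≤1      δ-approximates σ   = ℚ.≤-reflexive
      (trans (∫-cong ζ (λ z → sym (ℚ.*-identityʳ (δ z₀ z)))) (∫δ z₀ (λ _ → 1ℚ)))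
    density     δ-approximates σ z = begin
      δ z₀ z                         ≡⟨ ℚ.*-identityˡ _ ⟨
      1ℚ * δ z₀ z                    ≤⟨ *-monoʳ-≤ (δ z₀ z) (0≤δ z₀ z) 1≤Λ ⟩
      Λ * δ z₀ z                     ≡⟨ cong (Λ *_) (∫-const Ω (cube-isProbability n) (δ z₀ z)) ⟨
      Λ * (∫[ τ ∈ Ω ] δ z₀ z)        ∎
      where
      go : ∀ p → 1ℚ ≤ squares p 2ℚ
      go zero    = ℚ.≤ᵇ⇒≤ _
      go (suc p) = *-mono-≤ 0≤1 (squares-nonneg p (ℚ.nonNegative⁻¹ 2ℚ)) (go p) (go p)
      1≤Λ : 1ℚ ≤ Λ
      1≤Λ = go p
    χ²          δ-approximates u   = ℚ.≤-reflexive (begin-equality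
      _ ≡⟨ cong (λ t → t * t) (trans
             (∫-cong ζ (λ z → cong (_* u z) (∫-const Ω (cube-isProbability n) (δ z₀ z)))) (∫δ z₀ u)) ⟩
      u z₀ * u z₀                                ≡⟨ random-zero (λ z → u z * u z) z₀ ⟨
      random zero (λ z → u z * u z) z₀           ≡⟨ ℚ.*-identityˡ _ ⟨
      1ℚ * random zero (λ z → u z * u z) z₀      ∎)
    loss        δ-approximates u _ _ = ℚ.≤-reflexive (begin-equality
      (∫[ σ ∈ Ω ] planted zero σ (u σ) z₀)
        ≡⟨ ∫-cong Ω (λ σ → trans (planted-zero σ (u σ) z₀) (sym (∫δ z₀ (u σ)))) ⟩
      (∫[ σ ∈ Ω ] ∫[ z ∈ ζ ] δ z₀ z * u σ z)
        ≡⟨ trans (cong ((∫[ σ ∈ Ω ] ∫[ z ∈ ζ ] δ z₀ z * u σ z) +_) (ℚ.*-zeroˡ η)) (ℚ.+-identityʳ (∫[ σ ∈ Ω ] ∫[ z ∈ ζ ] δ z₀ z * u σ z)) ⟨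
      (∫[ σ ∈ Ω ] ∫[ z ∈ ζ ] δ z₀ z * u σ z) + 0ℚ * η ∎)

    module Step {t : ℕ} {w : Vec Sign n → Z → ℚ} (W : Approximates t w) where

      w′ : Vec Sign n → Z → ℚ
      w′ σ z = ∫[ y ∈ ζ ] w σ y * nextᴸ σ (λ y′ → δ y′ z) y

      m : Z → ℚ
      m z = ∫[ σ ∈ Ω ] w′ σ z

      keep : Z → ℚ
      keep z with θ ℚ.≤? m z
      ... | yes _ = 1ℚ
      ... | no  _ = 0ℚ

      keep-cases : ∀ z → (keep z ≡ 1ℚ × θ ≤ m z) ⊎ (keep z ≡ 0ℚ × m z ≤ θ)
      keep-cases z with θ ℚ.≤? m z
      ... | yes θ≤m = inj₁ (refl , θ≤m)
      ... | no  θ≰m = inj₂ (refl , ℚ.<⇒≤ (ℚ.≰⇒> θ≰m))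

      0≤keep : ∀ z → 0ℚ ≤ keep z
      0≤keep z with θ ℚ.≤? m z
      ... | yes _ = 0≤1
      ... | no  _ = ℚ.≤-refl

      keep≤1 : ∀ z → keep z ≤ 1ℚ
      keep≤1 z with θ ℚ.≤? m z
      ... | yes _ = ℚ.≤-refl
      ... | no  _ = 0≤1

      w⁺ : Vec Sign n → Z → ℚ
      w⁺ σ z = keep z * w′ σ z

      0≤w′ : ∀ σ z → 0ℚ ≤ w′ σ z
      0≤w′ σ z = ∫-nonneg ζ (λ y → *-nonneg (nonnegative W σ y)
        (∫-nonneg μ (λ c → *-nonneg (0≤L σ c) (0≤δ (S y c) z))))

      m⁺ : ∀ z → (∫[ σ ∈ Ω ] w⁺ σ z) ≡ keep z * m z
      m⁺ z = ∫-* Ω (keep z) (λ σ → w′ σ z)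

      push : ∀ σ u → (∫[ z ∈ ζ ] w′ σ z * u z) ≡ (∫[ y ∈ ζ ] w σ y * nextᴸ σ u y)
      push σ u = begin-equality
        (∫[ z ∈ ζ ] w′ σ z * u z)
          ≡⟨ ∫-cong ζ (λ z → ∫-*ʳ ζ _ (u z)) ⟨
        (∫[ z ∈ ζ ] ∫[ y ∈ ζ ] (w σ y * nextᴸ σ (λ y′ → δ y′ z) y) * u z)
          ≡⟨ ∫-swap ζ ζ _ ⟩
        (∫[ y ∈ ζ ] ∫[ z ∈ ζ ] (w σ y * nextᴸ σ (λ y′ → δ y′ z) y) * u z)
          ≡⟨ ∫-cong ζ (λ y → trans (∫-cong ζ (λ z → ℚ.*-assoc (w σ y) _ (u z))) (∫-* ζ (w σ y) _)) ⟩
        (∫[ y ∈ ζ ] w σ y * (∫[ z ∈ ζ ] nextᴸ σ (λ y′ → δ y′ z) y * u z))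
          ≡⟨ ∫-cong ζ (λ y → cong (w σ y *_) (sample y)) ⟩
        (∫[ y ∈ ζ ] w σ y * nextᴸ σ u y) ∎
        where
        sample : ∀ y → (∫[ z ∈ ζ ] nextᴸ σ (λ y′ → δ y′ z) y * u z) ≡ nextᴸ σ u y
        sample y = begin-equality
          (∫[ z ∈ ζ ] nextᴸ σ (λ y′ → δ y′ z) y * u z)
            ≡⟨ ∫-cong ζ (λ z → ∫-*ʳ μ _ (u z)) ⟨
          (∫[ z ∈ ζ ] ∫[ c ∈ μ ] (L σ c * δ (S y c) z) * u z)
            ≡⟨ ∫-swap ζ μ _ ⟩
          (∫[ c ∈ μ ] ∫[ z ∈ ζ ] (L σ c * δ (S y c) z) * u z)
            ≡⟨ ∫-cong μ (λ c → trans (∫-cong ζ (λ z → ℚ.*-assoc (L σ c) _ (u z))) (∫-* ζ (L σ c) _)) ⟩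
          (∫[ c ∈ μ ] L σ c * (∫[ z ∈ ζ ] δ (S y c) z * u z))
            ≡⟨ ∫-cong μ (λ c → cong (L σ c *_) (∫δ (S y c) u)) ⟩
          nextᴸ σ u y ∎

      mass′≤1 : ∀ σ → ∫ ζ (w′ σ) ≤ 1ℚ
      mass′≤1 σ = begin
        ∫ ζ (w′ σ)                                ≡⟨ ∫-cong ζ (λ z → ℚ.*-identityʳ (w′ σ z)) ⟨
        (∫[ z ∈ ζ ] w′ σ z * 1ℚ)                  ≡⟨ push σ (λ _ → 1ℚ) ⟩
        (∫[ y ∈ ζ ] w σ y * nextᴸ σ (λ _ → 1ℚ) y) ≡⟨ ∫-cong ζ (λ y → trans (cong (w σ y *_)
                                                        (trans (∫-cong μ (λ c → ℚ.*-identityʳ (L σ c))) (∫L σ)))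
                                                        (ℚ.*-identityʳ (w σ y))) ⟩
        ∫ ζ (w σ)                                 ≤⟨ mass≤1 W σ ⟩
        1ℚ                                        ∎

      w′≤1 : ∀ σ z → w′ σ z ≤ 1ℚ
      w′≤1 σ z = begin
        w′ σ z                              ≡⟨ ∫δ z (w′ σ) ⟨
        (∫[ y ∈ ζ ] δ z y * w′ σ y)         ≤⟨ ∫-mono ζ (λ y → *-monoʳ-≤ (w′ σ y) (0≤w′ σ y) (δ≤1 z y)) ⟩
        (∫[ y ∈ ζ ] 1ℚ * w′ σ y)            ≡⟨ ∫-cong ζ (λ y → ℚ.*-identityˡ (w′ σ y)) ⟩
        ∫ ζ (w′ σ)                          ≤⟨ mass′≤1 σ ⟩
        1ℚ                                  ∎

      w⁺≤w′ : ∀ σ z → w⁺ σ z ≤ w′ σ z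
      w⁺≤w′ σ z = subst (w⁺ σ z ≤_) (ℚ.*-identityˡ (w′ σ z)) (*-monoʳ-≤ (w′ σ z) (0≤w′ σ z) (keep≤1 z))

      -- For a kept state the weight is at most 1 = Λ θ ≤ Λ m; for a dropped one both sides are 0.
      density⁺ : ∀ σ z → w⁺ σ z ≤ Λ * (∫[ τ ∈ Ω ] w⁺ τ z)
      density⁺ σ z with keep-cases z
      ... | inj₁ (k≡1 , θ≤m) = begin
        w⁺ σ z                        ≤⟨ ℚ.≤-trans (w⁺≤w′ σ z) (w′≤1 σ z) ⟩
        1ℚ                            ≡⟨ Λθ≡1 ⟨
        Λ * θ                         ≤⟨ *-monoˡ-≤ Λ 0≤Λ θ≤m ⟩
        Λ * m z                       ≡⟨ cong (Λ *_) (trans (m⁺ z) (trans (cong (_* m z) k≡1) (ℚ.*-identityˡ (m z)))) ⟨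
        Λ * (∫[ τ ∈ Ω ] w⁺ τ z)       ∎
      ... | inj₂ (k≡0 , _)   = begin
        w⁺ σ z                        ≡⟨ trans (cong (_* w′ σ z) k≡0) (ℚ.*-zeroˡ (w′ σ z)) ⟩
        0ℚ                            ≤⟨ *-nonneg 0≤Λ (∫-nonneg Ω (λ τ → *-nonneg (0≤keep z) (0≤w′ τ z))) ⟩
        Λ * (∫[ τ ∈ Ω ] w⁺ τ z)       ∎

      module _ (y : Z) where

        P : ℚ
        P = ∫[ σ ∈ Ω ] w σ y

        0≤P : 0ℚ ≤ P
        0≤P = ∫-nonneg Ω (λ σ → nonnegative W σ y)

        -- The deviation from uniform, unnormalised: given the state `y`, the next constraint has
        -- density (P + g) / P with respect to μ.
        g : C → ℚ
        g c = ∫[ σ ∈ Ω ] w σ y * (L σ c - 1ℚ)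

        Q : Vec Sign n → ℚ
        Q σ = ∫[ c ∈ μ ] g c * (L σ c - 1ℚ)

        ∫g²≡∫wQ : (∫[ c ∈ μ ] g c * g c) ≡ (∫[ σ ∈ Ω ] w σ y * Q σ)
        ∫g²≡∫wQ = begin-equality
          (∫[ c ∈ μ ] g c * g c)
            ≡⟨ ∫-cong μ (λ c → ∫-* Ω (g c) _) ⟨
          (∫[ c ∈ μ ] ∫[ σ ∈ Ω ] g c * (w σ y * (L σ c - 1ℚ)))
            ≡⟨ ∫-swap μ Ω _ ⟩
          (∫[ σ ∈ Ω ] ∫[ c ∈ μ ] g c * (w σ y * (L σ c - 1ℚ)))
            ≡⟨ ∫-cong Ω (λ σ → trans (∫-cong μ (λ c → commute (g c) (w σ y) (L σ c - 1ℚ))) (∫-* μ (w σ y) _)) ⟩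
          (∫[ σ ∈ Ω ] w σ y * Q σ) ∎
          where
          commute : ∀ a b c → a * (b * c) ≡ b * (a * c)
          commute = solve-∀ ℚ-ring

        -- A duality argument. X = ∫ g² equals the integral of w against Q, a polynomial of degree d
        -- in σ. The level inequality bounds X² by K P² ∫ Q², and `kernel` bounds ∫ Q² by κ X, so
        -- one factor X cancels.
        ∫g²≤ : (∫[ c ∈ μ ] g c * g c) ≤ bias * (P * P)
        ∫g²≤ = *-cancelʳ-≤ (∫-nonneg μ (λ c → p*p-nonneg (g c))) (*-nonneg 0≤bias (p*p-nonneg P)) (begin
          X * X
            ≡⟨ cong (λ t → t * t) ∫g²≡∫wQ ⟩
          (∫[ σ ∈ Ω ] w σ y * Q σ) * (∫[ σ ∈ Ω ] w σ y * Q σ)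
            ≤⟨ level-inequality Q-degree p (λ σ → w σ y) (λ σ → nonnegative W σ y) (λ σ → density W σ y) ⟩
          K * ((P * P) * (∫[ σ ∈ Ω ] Q σ * Q σ))
            ≤⟨ *-monoˡ-≤ K (*-nonneg (ℚ.nonNegative⁻¹ 2ℚ) (^-nonneg p (^-nonneg d (ℚ.nonNegative⁻¹ 3ℚ))))
                 (*-monoˡ-≤ (P * P) (p*p-nonneg P) (kernel g)) ⟩
          K * ((P * P) * (κ * X))
            ≡⟨ regroup K (P * P) κ X ⟩
          bias * (P * P) * X ∎)
          where
          K = 2ℚ * (3ℚ ^ d) ^ p
          X = ∫[ c ∈ μ ] g c * g c
          regroup : ∀ K P κ X → K * (P * (κ * X)) ≡ K * κ * P * X
          regroup = solve-∀ ℚ-ring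
          Q-degree : Degree≤ d Q
          Q-degree = degree-∫ μ (λ c → degree-scale (g c) (degree-+ (L-degree c) (constant (- 1ℚ) (λ _ → refl))))

        ∫g≡0 : ∫ μ g ≡ 0ℚ
        ∫g≡0 = begin-equality
          ∫ μ g
            ≡⟨ ∫-swap μ Ω _ ⟩
          (∫[ σ ∈ Ω ] ∫[ c ∈ μ ] w σ y * (L σ c - 1ℚ))
            ≡⟨ ∫-cong Ω (λ σ → trans (∫-* μ (w σ y) _) (trans (cong (w σ y *_) (centred σ)) (ℚ.*-zeroʳ (w σ y)))) ⟩
          (∫[ σ ∈ Ω ] 0ℚ)
            ≡⟨ ∫-0 Ω ⟩
          0ℚ ∎
          where
          centred : ∀ σ → (∫[ c ∈ μ ] L σ c - 1ℚ) ≡ 0ℚ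
          centred σ = trans (∫-- μ (L σ) (λ _ → 1ℚ)) (cong₂ _-_ (∫L σ) μ₁)

        ℓ : C → ℚ
        ℓ c = ∫[ σ ∈ Ω ] w σ y * L σ c

        ℓ≡P+g : ∀ c → ℓ c ≡ P + g c
        ℓ≡P+g c = trans (∫-cong Ω (λ σ → split (w σ y) (L σ c))) (∫-+ Ω _ _)
          where
          split : ∀ a b → a * b ≡ a + a * (b - 1ℚ)
          split = solve-∀ ℚ-ring

        ∫ℓ²≤ : (∫[ c ∈ μ ] ℓ c * ℓ c) ≤ (1ℚ + bias) * (P * P)
        ∫ℓ²≤ = begin
          (∫[ c ∈ μ ] ℓ c * ℓ c)
            ≡⟨ ∫-cong μ (λ c → trans (cong (λ t → t * t) (ℓ≡P+g c)) (expand P (g c))) ⟩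
          (∫[ c ∈ μ ] (P * P + (P + P) * g c) + g c * g c)
            ≡⟨ trans (∫-+ μ _ _) (cong (_+ (∫[ c ∈ μ ] g c * g c)) (trans (∫-+ μ _ _)
                 (cong₂ _+_ (∫-const μ μ₁ (P * P)) (trans (∫-* μ (P + P) g) (trans (cong ((P + P) *_) ∫g≡0) (ℚ.*-zeroʳ (P + P))))))) ⟩
          (P * P + 0ℚ) + (∫[ c ∈ μ ] g c * g c)
            ≤⟨ ℚ.+-monoʳ-≤ (P * P + 0ℚ) ∫g²≤ ⟩
          (P * P + 0ℚ) + bias * (P * P)
            ≡⟨ collect (P * P) bias ⟩
          (1ℚ + bias) * (P * P) ∎
          where
          expand : ∀ P g → (P + g) * (P + g) ≡ (P * P + (P + P) * g) + g * g
          expand = solve-∀ ℚ-ring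
          collect : ∀ P b → (P + 0ℚ) + b * P ≡ (1ℚ + b) * P
          collect = solve-∀ ℚ-ring

        V : (Z → ℚ) → ℚ
        V v = ∫[ σ ∈ Ω ] w σ y * nextᴸ σ v y

        V≡ : ∀ v → V v ≡ (∫[ c ∈ μ ] ℓ c * v (S y c))
        V≡ v = begin-equality
          V v
            ≡⟨ ∫-cong Ω (λ σ → ∫-* μ (w σ y) _) ⟨
          (∫[ σ ∈ Ω ] ∫[ c ∈ μ ] w σ y * (L σ c * v (S y c)))
            ≡⟨ ∫-swap Ω μ _ ⟩
          (∫[ c ∈ μ ] ∫[ σ ∈ Ω ] w σ y * (L σ c * v (S y c)))
            ≡⟨ ∫-cong μ (λ c → trans (∫-cong Ω (λ σ → sym (ℚ.*-assoc (w σ y) (L σ c) (v (S y c))))) (∫-*ʳ Ω _ (v (S y c)))) ⟩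
          (∫[ c ∈ μ ] ℓ c * v (S y c)) ∎

        -- `U` is the conditional expectation of `v` after the next planted constraint, given `y`.
        -- Its square is compared with the average of v² after a uniform constraint, so that `U` can
        -- serve as test function one step earlier.
        V-factor : ∀ v → ∃ λ U → V v ≡ P * U × U * U ≤ (1ℚ + bias) * next (λ z → v z * v z) y
        V-factor v = factor 0≤P (*-nonneg 0≤1+bias (∫-nonneg μ (λ c → p*p-nonneg (v (S y c))))) (begin
          V v * V v
            ≡⟨ cong (λ t → t * t) (V≡ v) ⟩
          (∫[ c ∈ μ ] ℓ c * v (S y c)) * (∫[ c ∈ μ ] ℓ c * v (S y c))
            ≤⟨ ∫-cauchy-schwarz μ ℓ (λ c → v (S y c)) ⟩
          (∫[ c ∈ μ ] ℓ c * ℓ c) * next (λ z → v z * v z) y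
            ≤⟨ *-monoʳ-≤ _ (∫-nonneg μ (λ c → p*p-nonneg (v (S y c)))) ∫ℓ²≤ ⟩
          (1ℚ + bias) * (P * P) * next (λ z → v z * v z) y
            ≡⟨ regroup (1ℚ + bias) (P * P) _ ⟩
          P * P * ((1ℚ + bias) * next (λ z → v z * v z) y) ∎)
          where
          regroup : ∀ b P N → b * P * N ≡ P * (b * N)
          regroup = solve-∀ ℚ-ring

      -- The test function is pulled back through the last step: truncated by `keep`, which only
      -- lowers its square, then replaced by the conditional expectation `U`. The bound at time t
      -- applied to `U` gains one factor 1 + bias.
      χ²⁺ : ∀ (u : Z → ℚ) → (∫[ z ∈ ζ ] (∫[ σ ∈ Ω ] w⁺ σ z) * u z) * (∫[ z ∈ ζ ] (∫[ σ ∈ Ω ] w⁺ σ z) * u z)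
                  ≤ (1ℚ + bias) ^ suc t * random (suc t) (λ z → u z * u z) z₀
      χ²⁺ u = begin
        (∫[ z ∈ ζ ] (∫[ σ ∈ Ω ] w⁺ σ z) * u z) * (∫[ z ∈ ζ ] (∫[ σ ∈ Ω ] w⁺ σ z) * u z)
          ≡⟨ cong (λ t → t * t) total ⟩
        (∫[ y ∈ ζ ] P y * U y) * (∫[ y ∈ ζ ] P y * U y)
          ≤⟨ χ² W U ⟩
        β ^ t * random t (λ z → U z * U z) z₀
          ≤⟨ *-monoˡ-≤ (β ^ t) (^-nonneg t 0≤1+bias) (∫-mono (pow μ t) (λ cs → bound (final z₀ cs))) ⟩
        β ^ t * random t (λ z → β * next (λ z → u z * u z) z) z₀
          ≡⟨ cong (β ^ t *_) (∫-* (pow μ t) β _) ⟩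
        β ^ t * (β * random t (next (λ z → u z * u z)) z₀)
          ≡⟨ cong (λ r → β ^ t * (β * r)) (random-last t (λ z → u z * u z) z₀) ⟨
        β ^ t * (β * random (suc t) (λ z → u z * u z) z₀)
          ≡⟨ regroup (β ^ t) β _ ⟩
        β ^ suc t * random (suc t) (λ z → u z * u z) z₀ ∎
        where
        β = 1ℚ + bias
        regroup : ∀ a b r → a * (b * r) ≡ b * a * r
        regroup = solve-∀ ℚ-ring
        kept : Z → ℚ
        kept z = keep z * u z
        U : Z → ℚ
        U y = proj₁ (V-factor y kept)
        kept²≤u² : ∀ z → kept z * kept z ≤ u z * u z
        kept²≤u² z = begin
          kept z * kept z                          ≡⟨ regroup′ (keep z) (u z) ⟩
          (keep z * keep z) * (u z * u z)    ≤⟨ *-monoʳ-≤ (u z * u z) (p*p-nonneg (u z))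
                                                 (*-mono-≤ (0≤keep z) 0≤1 (keep≤1 z) (keep≤1 z)) ⟩
          1ℚ * (u z * u z)                   ≡⟨ ℚ.*-identityˡ _ ⟩
          u z * u z                          ∎
          where
          regroup′ : ∀ k u → (k * u) * (k * u) ≡ (k * k) * (u * u)
          regroup′ = solve-∀ ℚ-ring
        bound : ∀ z → U z * U z ≤ β * next (λ z → u z * u z) z
        bound z = ℚ.≤-trans (proj₂ (proj₂ (V-factor z kept)))
          (*-monoˡ-≤ β 0≤1+bias (∫-mono μ (λ c → kept²≤u² (S z c))))
        commute : ∀ k m u → k * m * u ≡ m * (k * u)
        commute = solve-∀ ℚ-ring
        total : (∫[ z ∈ ζ ] (∫[ σ ∈ Ω ] w⁺ σ z) * u z) ≡ (∫[ y ∈ ζ ] P y * U y)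
        total = begin-equality
          (∫[ z ∈ ζ ] (∫[ σ ∈ Ω ] w⁺ σ z) * u z)
            ≡⟨ ∫-cong ζ (λ z → trans (cong (_* u z) (m⁺ z)) (commute (keep z) (m z) (u z))) ⟩
          (∫[ z ∈ ζ ] m z * kept z)
            ≡⟨ ∫-cong ζ (λ z → ∫-*ʳ Ω _ (kept z)) ⟨
          (∫[ z ∈ ζ ] ∫[ σ ∈ Ω ] w′ σ z * kept z)
            ≡⟨ ∫-swap ζ Ω _ ⟩
          (∫[ σ ∈ Ω ] ∫[ z ∈ ζ ] w′ σ z * kept z)
            ≡⟨ ∫-cong Ω (λ σ → push σ kept) ⟩
          (∫[ σ ∈ Ω ] ∫[ y ∈ ζ ] w σ y * nextᴸ σ kept y)
            ≡⟨ ∫-swap Ω ζ _ ⟩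
          (∫[ y ∈ ζ ] V y kept)
            ≡⟨ ∫-cong ζ (λ y → proj₁ (proj₂ (V-factor y kept))) ⟩
          (∫[ y ∈ ζ ] P y * U y) ∎

      -- As u ≤ 1, dropping a state costs at most its weight, and a state is dropped only when its
      -- average weight m is at most θ.
      loss⁺ : ∀ (u : Vec Sign n → Z → ℚ) → (∀ σ z → 0ℚ ≤ u σ z) → (∀ σ z → u σ z ≤ 1ℚ) →
        (∫[ σ ∈ Ω ] planted (suc t) σ (u σ) z₀) ≤
        (∫[ σ ∈ Ω ] ∫[ z ∈ ζ ] w⁺ σ z * u σ z) + ι (suc t) * η
      loss⁺ u 0≤u u≤1 = begin
        (∫[ σ ∈ Ω ] planted (suc t) σ (u σ) z₀)
          ≡⟨ ∫-cong Ω (λ σ → planted-last t σ (u σ) z₀) ⟩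
        (∫[ σ ∈ Ω ] planted t σ (nextᴸ σ (u σ)) z₀)
          ≤⟨ loss W (λ σ → nextᴸ σ (u σ))
               (λ σ z → ∫-nonneg μ (λ c → *-nonneg (0≤L σ c) (0≤u σ (S z c))))
               (λ σ z → subst (nextᴸ σ (u σ) z ≤_) (∫L σ) (∫-mono μ (λ c →
                  subst (L σ c * u σ (S z c) ≤_) (ℚ.*-identityʳ (L σ c)) (*-monoˡ-≤ (L σ c) (0≤L σ c) (u≤1 σ (S z c)))))) ⟩
        (∫[ σ ∈ Ω ] ∫[ y ∈ ζ ] w σ y * nextᴸ σ (u σ) y) + ι t * η
          ≡⟨ cong (_+ ι t * η) (∫-cong Ω (λ σ → push σ (u σ))) ⟨
        (∫[ σ ∈ Ω ] ∫[ z ∈ ζ ] w′ σ z * u σ z) + ι t * η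
          ≤⟨ ℚ.+-monoˡ-≤ (ι t * η) (∫-mono Ω (λ σ → ∫-mono ζ (λ z → dropped σ z))) ⟩
        (∫[ σ ∈ Ω ] ∫[ z ∈ ζ ] w⁺ σ z * u σ z + (1ℚ - keep z) * w′ σ z) + ι t * η
          ≡⟨ cong (_+ ι t * η) (trans (∫-cong Ω (λ σ → ∫-+ ζ _ _)) (∫-+ Ω _ _)) ⟩
        ((∫[ σ ∈ Ω ] ∫[ z ∈ ζ ] w⁺ σ z * u σ z) + (∫[ σ ∈ Ω ] ∫[ z ∈ ζ ] (1ℚ - keep z) * w′ σ z)) + ι t * η
          ≤⟨ ℚ.+-monoˡ-≤ (ι t * η) (ℚ.+-monoʳ-≤ (∫[ σ ∈ Ω ] ∫[ z ∈ ζ ] w⁺ σ z * u σ z) light) ⟩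
        ((∫[ σ ∈ Ω ] ∫[ z ∈ ζ ] w⁺ σ z * u σ z) + η) + ι t * η
          ≡⟨ collect (∫[ σ ∈ Ω ] ∫[ z ∈ ζ ] w⁺ σ z * u σ z) η (ι t) ⟩
        (∫[ σ ∈ Ω ] ∫[ z ∈ ζ ] w⁺ σ z * u σ z) + ι (suc t) * η ∎
        where
        collect : ∀ a e i → (a + e) + i * e ≡ a + (1ℚ + i) * e
        collect = solve-∀ ℚ-ring
        dropped : ∀ σ z → w′ σ z * u σ z ≤ w⁺ σ z * u σ z + (1ℚ - keep z) * w′ σ z
        dropped σ z = ≤-by ((1ℚ - keep z) * (w′ σ z * (1ℚ - u σ z)))
          (*-nonneg (0≤q-p (keep≤1 z)) (*-nonneg (0≤w′ σ z) (0≤q-p (u≤1 σ z))))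
          (split (keep z) (w′ σ z) (u σ z))
          where
          split : ∀ k w u → k * w * u + (1ℚ - k) * w ≡ w * u + (1ℚ - k) * (w * (1ℚ - u))
          split = solve-∀ ℚ-ring
        light : (∫[ σ ∈ Ω ] ∫[ z ∈ ζ ] (1ℚ - keep z) * w′ σ z) ≤ η
        light = begin
          (∫[ σ ∈ Ω ] ∫[ z ∈ ζ ] (1ℚ - keep z) * w′ σ z)
            ≡⟨ ∫-swap Ω ζ _ ⟩
          (∫[ z ∈ ζ ] ∫[ σ ∈ Ω ] (1ℚ - keep z) * w′ σ z)
            ≡⟨ ∫-cong ζ (λ z → ∫-* Ω (1ℚ - keep z) _) ⟩
          (∫[ z ∈ ζ ] (1ℚ - keep z) * m z)
            ≤⟨ ∫-mono ζ each ⟩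
          (∫[ z ∈ ζ ] 1ℚ * θ)
            ≡⟨ ∫-*ʳ ζ (λ _ → 1ℚ) θ ⟩
          η ∎
          where
          each : ∀ z → (1ℚ - keep z) * m z ≤ 1ℚ * θ
          each z with keep-cases z
          ... | inj₁ (k≡1 , _)   = subst₂ _≤_
            (sym (trans (cong (λ k → (1ℚ - k) * m z) k≡1) (ℚ.*-zeroˡ (m z)))) (sym (ℚ.*-identityˡ θ)) 0≤θ
          ... | inj₂ (k≡0 , m≤θ) = subst (λ k → (1ℚ - k) * m z ≤ 1ℚ * θ) (sym k≡0) (*-monoˡ-≤ 1ℚ 0≤1 m≤θ)

      step : Approximates (suc t) w⁺
      nonnegative step σ z = *-nonneg (0≤keep z) (0≤w′ σ z)
      mass≤1      step σ   = ℚ.≤-trans (∫-mono ζ (w⁺≤w′ σ)) (mass′≤1 σ)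
      density     step     = density⁺
      χ²          step     = χ²⁺
      loss        step     = loss⁺

    approximation : ∀ t → ∃ (Approximates t)
    approximation zero    = _ , δ-approximates
    approximation (suc t) = _ , Step.step (proj₂ (approximation t))

  -- The second moment bound is tested on u = 1 + (v - q)/4, where q is the mean of v on random
  -- streams. There v - q has mean 0 and modulus at most 1, so u² averages at most 1 + 1/16. An
  -- advantage above 1/4 would make the planted mean of u at least 1 + 1/16 - 1/100 - 1/400 = 1.05,
  -- the last two terms paying for the lost mass, and 1.05² exceeds 1.01 · (1 + 1/16).
  indistinguishable : ∀ t → (1ℚ + bias) ^ t ≤ 1ℚ + ℤ.+ 1 / 100 → ι t * η ≤ ℤ.+ 1 / 100 →
    ∀ v → (∀ z → 0ℚ ≤ v z) → (∀ z → v z ≤ 1ℚ) →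
    (∫[ σ ∈ Ω ] planted t σ v z₀) ≤ random t v z₀ + ℤ.+ 1 / 4
  indistinguishable t β≤ η≤ v 0≤v v≤1 with approximation t
  ... | w , W = ℚ.≮⇒≥ λ far → <⇒≱ (from-yes ((1ℚ + ℤ.+ 1 / 100) * (1ℚ + ℤ.+ 1 / 16) ℚ.<? (ℤ.+ 105 / 100) * (ℤ.+ 105 / 100))) (begin
      (ℤ.+ 105 / 100) * (ℤ.+ 105 / 100)
        ≤⟨ *-mono-≤ (ℚ.nonNegative⁻¹ (ℤ.+ 105 / 100)) (ℚ.≤-trans (ℚ.nonNegative⁻¹ (ℤ.+ 105 / 100)) (lower far)) (lower far) (lower far) ⟩
      (∫[ z ∈ ζ ] P z * u z) * (∫[ z ∈ ζ ] P z * u z)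
        ≤⟨ χ² W u ⟩
      (1ℚ + bias) ^ t * random t (λ z → u z * u z) z₀
        ≤⟨ *-mono-≤ (^-nonneg t 0≤1+bias) (ℚ.nonNegative⁻¹ (1ℚ + ℤ.+ 1 / 16)) β≤ upper ⟩
      (1ℚ + ℤ.+ 1 / 100) * (1ℚ + ℤ.+ 1 / 16) ∎)
    where
    P : Z → ℚ
    P z = ∫[ σ ∈ Ω ] w σ z
    q = random t v z₀
    u : Z → ℚ
    u z = 1ℚ + (ℤ.+ 1 / 4) * (v z - q)
    ν = pow μ t
    ν₁ = pow-isProbability μ μ₁ t
    0≤q : 0ℚ ≤ q
    0≤q = ∫-nonneg ν (λ cs → 0≤v (final z₀ cs))
    q≤1 : q ≤ 1ℚ
    q≤1 = subst (q ≤_) ν₁ (∫-mono ν (λ cs → v≤1 (final z₀ cs)))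
    square≤1 : ∀ x → 0ℚ ≤ x → x ≤ 1ℚ → (x - q) * (x - q) ≤ 1ℚ
    square≤1 x 0≤x x≤1 = ≤-by ((1ℚ - (x - q)) * (1ℚ + (x - q)))
      (*-nonneg (subst (0ℚ ≤_) (left x q) (+-nonneg (0≤q-p x≤1) 0≤q)) (subst (0ℚ ≤_) (right x q) (+-nonneg (0≤q-p q≤1) 0≤x)))
      (identity (x - q))
      where
      left : ∀ x q → (1ℚ - x) + q ≡ 1ℚ - (x - q)
      left = solve-∀ ℚ-ring
      right : ∀ x q → (1ℚ - q) + x ≡ 1ℚ + (x - q)
      right = solve-∀ ℚ-ring
      identity : ∀ y → 1ℚ ≡ y * y + (1ℚ - y) * (1ℚ + y)
      identity = solve-∀ ℚ-ring
    upper : random t (λ z → u z * u z) z₀ ≤ 1ℚ + ℤ.+ 1 / 16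
    upper = begin
      random t (λ z → u z * u z) z₀
        ≤⟨ ∫-mono ν (λ cs → pointwise (v (final z₀ cs)) (0≤v _) (v≤1 _)) ⟩
      (∫[ cs ∈ ν ] (1ℚ + ℤ.+ 1 / 16) + (ℤ.+ 1 / 2) * (v (final z₀ cs) - q))
        ≡⟨ trans (∫-+ ν _ _) (cong₂ _+_ (∫-const ν ν₁ _) (trans (∫-* ν (ℤ.+ 1 / 2) _)
             (cong ((ℤ.+ 1 / 2) *_) (trans (∫-- ν _ _) (trans (cong (λ x → q - x) (∫-const ν ν₁ q)) (ℚ.+-inverseʳ q)))))) ⟩
      (1ℚ + ℤ.+ 1 / 16) + (ℤ.+ 1 / 2) * 0ℚ ∎
      where
      pointwise : ∀ x → 0ℚ ≤ x → x ≤ 1ℚ →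
        (1ℚ + (ℤ.+ 1 / 4) * (x - q)) * (1ℚ + (ℤ.+ 1 / 4) * (x - q)) ≤ (1ℚ + ℤ.+ 1 / 16) + (ℤ.+ 1 / 2) * (x - q)
      pointwise x 0≤x x≤1 = ≤-by ((ℤ.+ 1 / 16) * (1ℚ - (x - q) * (x - q)))
        (*-nonneg (ℚ.nonNegative⁻¹ (ℤ.+ 1 / 16)) (0≤q-p (square≤1 x 0≤x x≤1))) (identity (x - q))
        where
        identity : ∀ y → (1ℚ + ℤ.+ 1 / 16) + (ℤ.+ 1 / 2) * y ≡
          (1ℚ + (ℤ.+ 1 / 4) * y) * (1ℚ + (ℤ.+ 1 / 4) * y) + (ℤ.+ 1 / 16) * (1ℚ - y * y)
        identity = solve-∀ ℚ-ring
    a = ∫ ζ P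
    b = ∫[ z ∈ ζ ] P z * v z
    a≤1 : a ≤ 1ℚ
    a≤1 = begin
      a                               ≡⟨ ∫-swap ζ Ω _ ⟩
      (∫[ σ ∈ Ω ] ∫ ζ (w σ))          ≤⟨ ∫-mono Ω (mass≤1 W) ⟩
      (∫[ σ ∈ Ω ] 1ℚ)                 ≡⟨ cube-isProbability n ⟩
      1ℚ                              ∎
    marginal : ∀ x → (∫[ σ ∈ Ω ] ∫[ z ∈ ζ ] w σ z * x z) ≡ (∫[ z ∈ ζ ] P z * x z)
    marginal x = trans (∫-swap Ω ζ _) (∫-cong ζ (λ z → ∫-*ʳ Ω _ (x z)))
    planted-1 : ∀ t σ z → planted t σ (λ _ → 1ℚ) z ≡ 1ℚ
    planted-1 zero    σ z = planted-zero σ _ z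
    planted-1 (suc t) σ z = trans (planted-first t σ _ z)
      (trans (∫-cong μ (λ c → trans (cong (L σ c *_) (planted-1 t σ (S z c))) (ℚ.*-identityʳ (L σ c)))) (∫L σ))
    1≤a : 1ℚ ≤ a + ℤ.+ 1 / 100
    1≤a = begin
      1ℚ
        ≡⟨ trans (∫-cong Ω (λ σ → planted-1 t σ z₀)) (cube-isProbability n) ⟨
      (∫[ σ ∈ Ω ] planted t σ (λ _ → 1ℚ) z₀)
        ≤⟨ loss W (λ _ _ → 1ℚ) (λ _ _ → 0≤1) (λ _ _ → ℚ.≤-refl) ⟩
      (∫[ σ ∈ Ω ] ∫[ z ∈ ζ ] w σ z * 1ℚ) + ι t * η
        ≡⟨ cong (_+ ι t * η) (trans (marginal (λ _ → 1ℚ)) (∫-cong ζ (λ z → ℚ.*-identityʳ (P z)))) ⟩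
      a + ι t * η
        ≤⟨ ℚ.+-monoʳ-≤ a η≤ ⟩
      a + ℤ.+ 1 / 100 ∎
    planted≤b : (∫[ σ ∈ Ω ] planted t σ v z₀) ≤ b + ℤ.+ 1 / 100
    planted≤b = begin
      (∫[ σ ∈ Ω ] planted t σ v z₀)
        ≤⟨ loss W (λ _ → v) (λ _ → 0≤v) (λ _ → v≤1) ⟩
      (∫[ σ ∈ Ω ] ∫[ z ∈ ζ ] w σ z * v z) + ι t * η
        ≤⟨ ℚ.+-mono-≤ (ℚ.≤-reflexive (marginal v)) η≤ ⟩
      b + ℤ.+ 1 / 100 ∎
    lower : q + ℤ.+ 1 / 4 < (∫[ σ ∈ Ω ] planted t σ v z₀) → ℤ.+ 105 / 100 ≤ (∫[ z ∈ ζ ] P z * u z)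
    lower far = begin
      ℤ.+ 105 / 100
        ≤⟨ ≤-by ((a + ℤ.+ 1 / 100 - 1ℚ) + (ℤ.+ 1 / 4) * ((b + ℤ.+ 1 / 100) - (q + ℤ.+ 1 / 4) + q * (1ℚ - a)))
             (+-nonneg (0≤q-p 1≤a) (*-nonneg (ℚ.nonNegative⁻¹ (ℤ.+ 1 / 4))
               (+-nonneg (0≤q-p (ℚ.≤-trans (ℚ.<⇒≤ far) planted≤b)) (*-nonneg 0≤q (0≤q-p a≤1)))))
             (identity a b q) ⟩
      a + (ℤ.+ 1 / 4) * (b - q * a)
        ≡⟨ cong (λ y → a + (ℤ.+ 1 / 4) * y) (trans (∫-- ζ _ _) (cong (λ x → b - x) (∫-* ζ q P))) ⟨
      a + (ℤ.+ 1 / 4) * (∫[ z ∈ ζ ] P z * v z - q * P z)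
        ≡⟨ trans (∫-+ ζ _ _) (cong (a +_) (∫-* ζ (ℤ.+ 1 / 4) _)) ⟨
      (∫[ z ∈ ζ ] P z + (ℤ.+ 1 / 4) * (P z * v z - q * P z))
        ≡⟨ ∫-cong ζ (λ z → expand (P z) (v z) q) ⟩
      (∫[ z ∈ ζ ] P z * u z) ∎
      where
      identity : ∀ a b q → a + (ℤ.+ 1 / 4) * (b - q * a) ≡ (ℤ.+ 105 / 100) +
        ((a + ℤ.+ 1 / 100 - 1ℚ) + (ℤ.+ 1 / 4) * ((b + ℤ.+ 1 / 100) - (q + ℤ.+ 1 / 4) + q * (1ℚ - a)))
      identity = solve-∀ ℚ-ring
      expand : ∀ P v q → P + (ℤ.+ 1 / 4) * (P * v - q * P) ≡ P * (1ℚ + (ℤ.+ 1 / 4) * (v - q))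
      expand = solve-∀ ℚ-ring

-- Counting and uniform measures

counting : ∀ n → Measure (Fin n)
counting zero    = measure [] []
counting (suc n) = dirac zero ⊕ (counting n >>= dirac ∘ suc)

∫-counting : ∀ n f → ∫ (counting (suc n)) f ≡ f zero + ∫ (counting n) (f ∘ suc)
∫-counting n f = trans (∫-⊕ (dirac zero) (counting n >>= dirac ∘ suc) f)
  (cong₂ _+_ (∫-dirac zero f) (trans (∫->>= (counting n) (dirac ∘ suc) f)
    (∫-cong (counting n) (λ i → ∫-dirac (suc i) f))))

total-counting : ∀ n → (∫[ _ ∈ counting n ] 1ℚ) ≡ ι n
total-counting zero    = refl
total-counting (suc n) = trans (∫-counting n (λ _ → 1ℚ)) (cong (1ℚ +_) (total-counting n))

kronecker : ∀ {n} → Fin n → Fin n → ℚ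
kronecker zero    zero    = 1ℚ
kronecker zero    (suc j) = 0ℚ
kronecker (suc i) zero    = 0ℚ
kronecker (suc i) (suc j) = kronecker i j

kronecker-sym : ∀ {n} (i j : Fin n) → kronecker i j ≡ kronecker j i
kronecker-sym zero    zero    = refl
kronecker-sym zero    (suc j) = refl
kronecker-sym (suc i) zero    = refl
kronecker-sym (suc i) (suc j) = kronecker-sym i j

0≤kronecker : ∀ {n} (i j : Fin n) → 0ℚ ≤ kronecker i j
0≤kronecker zero    zero    = 0≤1
0≤kronecker zero    (suc j) = ℚ.≤-refl
0≤kronecker (suc i) zero    = ℚ.≤-refl
0≤kronecker (suc i) (suc j) = 0≤kronecker i j

∫-kronecker : ∀ {n} (i : Fin n) → ∫ (counting n) (kronecker i) ≡ 1ℚ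
∫-kronecker {suc n} zero    = trans (∫-counting n (kronecker zero)) (trans (cong (1ℚ +_) (∫-0 (counting n))) (ℚ.+-identityʳ 1ℚ))
∫-kronecker {suc n} (suc i) = trans (∫-counting n (kronecker (suc i))) (trans (ℚ.+-identityˡ _) (∫-kronecker i))

∣∫∣≤ : ∀ (μ : Measure A) f {g} → (∀ a → ∣ f a ∣ ≤ g a) → ∣ ∫ μ f ∣ ≤ ∫ μ g
∣∫∣≤ μ f {g} ∣f∣≤g = ℚ.≤-trans (go (nonneg μ)) (∫-mono μ ∣f∣≤g)
  where
  open ℚ.≤-Reasoning
  go : ∀ {xs} → All ((0ℚ ≤_) ∘ proj₁) xs → ∣ integrate xs f ∣ ≤ integrate xs (λ a → ∣ f a ∣)
  go []                           = ℚ.≤-refl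
  go {(w , a) ∷ xs} (0≤w ∷ 0≤ws) = begin
    ∣ w * f a + integrate xs f ∣
      ≤⟨ ℚ.∣p+q∣≤∣p∣+∣q∣ (w * f a) (integrate xs f) ⟩
    ∣ w * f a ∣ + ∣ integrate xs f ∣
      ≤⟨ ℚ.+-mono-≤ (ℚ.≤-reflexive (trans (ℚ.∣p*q∣≡∣p∣*∣q∣ w (f a)) (cong (_* ∣ f a ∣) (ℚ.0≤p⇒∣p∣≡p 0≤w)))) (go 0≤ws) ⟩
    w * ∣ f a ∣ + integrate xs (λ a → ∣ f a ∣) ∎

∫-pow-++ : ∀ (μ : Measure A) m n f →
  ∫ (pow μ (m ℕ.+ n)) f ≡ (∫[ u ∈ pow μ m ] ∫[ v ∈ pow μ n ] f (u Vec.++ v))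
∫-pow-++ μ zero    n f = sym (∫-dirac {A = Vec _ zero} [] (λ u → ∫[ v ∈ pow μ n ] f (u Vec.++ v)))
∫-pow-++ μ (suc m) n f = trans (∫-pow μ (m ℕ.+ n) f)
  (trans (∫-cong μ (λ a → ∫-pow-++ μ m n (λ v → f (a ∷ v)))) (sym (∫-pow μ m _)))

-- Correlations of coordinates

∫-lookup : ∀ {n} (i : Fin n) → (∫[ x ∈ cube n ] sgn (Vec.lookup x i)) ≡ 0ℚ
∫-lookup {suc n} zero    = trans (∫-cube n _) (∫-0 (cube n))
∫-lookup {suc n} (suc i) = trans (∫-cube n _) (trans (∫-cong (cube n) (λ x → average (sgn (Vec.lookup x i)))) (∫-lookup i))
  where
  average : ∀ s → ½ * s + ½ * s ≡ s
  average = solve-∀ ℚ-ring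

∫-lookup² : ∀ {n} (i j : Fin n) →
  (∫[ x ∈ cube n ] sgn (Vec.lookup x i) * sgn (Vec.lookup x j)) ≡ kronecker i j
∫-lookup² {suc n} zero    zero    = trans (∫-cong (cube (suc n)) {g = λ _ → 1ℚ} (λ x → sgn*sgn (Vec.lookup x zero))) (cube-isProbability (suc n))
∫-lookup² {suc n} zero    (suc j) = trans (∫-cube n _) (trans (∫-cong (cube n) (λ x → cancel (sgn (Vec.lookup x j)))) (∫-0 (cube n)))
  where
  cancel : ∀ s → ½ * ((- 1ℚ) * s) + ½ * (1ℚ * s) ≡ 0ℚ
  cancel = solve-∀ ℚ-ring
∫-lookup² {suc n} (suc i) zero    = trans (∫-cube n _) (trans (∫-cong (cube n) (λ x → cancel (sgn (Vec.lookup x i)))) (∫-0 (cube n)))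
  where
  cancel : ∀ s → ½ * (s * (- 1ℚ)) + ½ * (s * 1ℚ) ≡ 0ℚ
  cancel = solve-∀ ℚ-ring
∫-lookup² {suc n} (suc i) (suc j) = trans (∫-cube n _)
  (trans (∫-cong (cube n) (λ x → average (sgn (Vec.lookup x i) * sgn (Vec.lookup x j)))) (∫-lookup² i j))
  where
  average : ∀ s → ½ * s + ½ * s ≡ s
  average = solve-∀ ℚ-ring

∫-factors : ∀ {n} (u v : Fin n) y y′ →
  (∫[ x ∈ cube n ] (1ℚ + y * sgn (Vec.lookup x u)) * (1ℚ + y′ * sgn (Vec.lookup x v))) ≡
  1ℚ + y * y′ * kronecker u v
∫-factors {n} u v y y′ = begin
  (∫[ x ∈ cube n ] (1ℚ + y * sgn (Vec.lookup x u)) * (1ℚ + y′ * sgn (Vec.lookup x v)))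
    ≡⟨ ∫-cong (cube n) (λ x → expand y y′ (sgn (Vec.lookup x u)) (sgn (Vec.lookup x v))) ⟩
  (∫[ x ∈ cube n ] ((1ℚ + y * sgn (Vec.lookup x u)) + y′ * sgn (Vec.lookup x v)) +
                   (y * y′) * (sgn (Vec.lookup x u) * sgn (Vec.lookup x v)))
    ≡⟨ trans (∫-+ (cube n) _ _) (cong₂ _+_
         (trans (∫-+ (cube n) _ _) (cong₂ _+_
           (trans (∫-+ (cube n) _ _) (cong₂ _+_ (cube-isProbability n)
             (trans (∫-* (cube n) y _) (trans (cong (y *_) (∫-lookup u)) (ℚ.*-zeroʳ y)))))
           (trans (∫-* (cube n) y′ _) (trans (cong (y′ *_) (∫-lookup v)) (ℚ.*-zeroʳ y′)))))
         (trans (∫-* (cube n) (y * y′) _) (cong (y * y′ *_) (∫-lookup² u v)))) ⟩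
  ((1ℚ + 0ℚ) + 0ℚ) + y * y′ * kronecker u v ∎
  where
  open ≡-Reasoning
  expand : ∀ y y′ s t → (1ℚ + y * s) * (1ℚ + y′ * t) ≡ ((1ℚ + y * s) + y′ * t) + (y * y′) * (s * t)
  expand = solve-∀ ℚ-ring

degree-∏ : ∀ {n} k {f : Fin k → Vec Sign n → ℚ} → (∀ i → Degree≤ 1 (f i)) → Degree≤ k (λ x → ∏ k (λ i → f i x))
degree-∏ zero    df = constant 1ℚ (λ _ → refl)
degree-∏ (suc k) df = degree-* (df zero) (degree-∏ k (df ∘ suc))

-- Expansion of ∏ (1 + zᵢ) to second order

module _ where
  open ℚ.≤-Reasoning

  -- All coefficients in the expansion into monomials are nonnegative, so each monomial is dominated
  -- by the same monomial in `e`.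
  ∣∏-1∣≤ : ∀ k {z e : Fin k → ℚ} → (∀ i → ∣ z i ∣ ≤ e i) →
    ∣ ∏ k (λ i → 1ℚ + z i) - 1ℚ ∣ ≤ ∏ k (λ i → 1ℚ + e i) - 1ℚ
  ∣∏-1∣≤ zero    z≤e = ℚ.≤-refl
  ∣∏-1∣≤ (suc k) {z} {e} z≤e = begin
    ∣ (1ℚ + z₀) * Z - 1ℚ ∣
      ≡⟨ cong ∣_∣ (split z₀ Z) ⟩
    ∣ (Z - 1ℚ) + z₀ * ((Z - 1ℚ) + 1ℚ) ∣
      ≤⟨ ℚ.∣p+q∣≤∣p∣+∣q∣ (Z - 1ℚ) (z₀ * ((Z - 1ℚ) + 1ℚ)) ⟩
    ∣ Z - 1ℚ ∣ + ∣ z₀ * ((Z - 1ℚ) + 1ℚ) ∣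
      ≡⟨ cong (∣ Z - 1ℚ ∣ +_) (ℚ.∣p*q∣≡∣p∣*∣q∣ z₀ ((Z - 1ℚ) + 1ℚ)) ⟩
    ∣ Z - 1ℚ ∣ + ∣ z₀ ∣ * ∣ (Z - 1ℚ) + 1ℚ ∣
      ≤⟨ ℚ.+-mono-≤ IH (*-mono-≤ (ℚ.0≤∣p∣ z₀) (+-nonneg (ℚ.≤-trans (ℚ.0≤∣p∣ (Z - 1ℚ)) IH) 0≤1) (z≤e zero)
           (ℚ.≤-trans (ℚ.∣p+q∣≤∣p∣+∣q∣ (Z - 1ℚ) 1ℚ) (ℚ.+-monoˡ-≤ 1ℚ IH))) ⟩
    (E - 1ℚ) + e zero * ((E - 1ℚ) + 1ℚ)
      ≡⟨ split (e zero) E ⟨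
    (1ℚ + e zero) * E - 1ℚ ∎
    where
    z₀ = z zero
    Z = ∏ k (λ i → 1ℚ + z (suc i))
    E = ∏ k (λ i → 1ℚ + e (suc i))
    IH = ∣∏-1∣≤ k (z≤e ∘ suc)
    split : ∀ z Z → (1ℚ + z) * Z - 1ℚ ≡ (Z - 1ℚ) + z * ((Z - 1ℚ) + 1ℚ)
    split = solve-∀ ℚ-ring

  -- The sum of the monomials of degree at least 2 in the expansion of the product.
  remainder : ∀ k → (Fin k → ℚ) → ℚ
  remainder k z = ∏ k (λ i → 1ℚ + z i) - 1ℚ - ∫ (counting k) z

  ∣remainder∣≤ : ∀ k {z e : Fin k → ℚ} → (∀ i → ∣ z i ∣ ≤ e i) → ∣ remainder k z ∣ ≤ remainder k e
  ∣remainder∣≤ zero    z≤e = ℚ.≤-refl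
  ∣remainder∣≤ (suc k) {z} {e} z≤e = begin
    ∣ (1ℚ + z zero) * Z - 1ℚ - ∫ (counting (suc k)) z ∣
      ≡⟨ cong ∣_∣ (trans (cong (λ s → (1ℚ + z zero) * Z - 1ℚ - s) (∫-counting k z)) (split (z zero) Z (∫ (counting k) (z ∘ suc)))) ⟩
    ∣ remainder k (z ∘ suc) + z zero * (Z - 1ℚ) ∣
      ≤⟨ ℚ.∣p+q∣≤∣p∣+∣q∣ (remainder k (z ∘ suc)) (z zero * (Z - 1ℚ)) ⟩
    ∣ remainder k (z ∘ suc) ∣ + ∣ z zero * (Z - 1ℚ) ∣
      ≡⟨ cong (∣ remainder k (z ∘ suc) ∣ +_) (ℚ.∣p*q∣≡∣p∣*∣q∣ (z zero) (Z - 1ℚ)) ⟩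
    ∣ remainder k (z ∘ suc) ∣ + ∣ z zero ∣ * ∣ Z - 1ℚ ∣
      ≤⟨ ℚ.+-mono-≤ (∣remainder∣≤ k (z≤e ∘ suc))
           (*-mono-≤ (ℚ.0≤∣p∣ (z zero)) (ℚ.≤-trans (ℚ.0≤∣p∣ (Z - 1ℚ)) IH) (z≤e zero) IH) ⟩
    remainder k (e ∘ suc) + e zero * (E - 1ℚ)
      ≡⟨ trans (cong (λ s → (1ℚ + e zero) * E - 1ℚ - s) (∫-counting k e)) (split (e zero) E (∫ (counting k) (e ∘ suc))) ⟨
    remainder (suc k) e ∎
    where
    Z = ∏ k (λ i → 1ℚ + z (suc i))
    E = ∏ k (λ i → 1ℚ + e (suc i))
    IH = ∣∏-1∣≤ k (z≤e ∘ suc)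
    split : ∀ z Z s → (1ℚ + z) * Z - 1ℚ - (z + s) ≡ (Z - 1ℚ - s) + z * (Z - 1ℚ)
    split = solve-∀ ℚ-ring

  module _ {x : ℚ} (0≤x : 0ℚ ≤ x) (x≤1 : x ≤ 1ℚ) where

    -- There are 2ᵏ - 1 nonconstant monomials, each at most x because x ≤ 1.
    ∏-1≤ : ∀ k → ∏ k (λ _ → 1ℚ + x) - 1ℚ ≤ (2ℚ ^ k - 1ℚ) * x
    ∏-1≤ zero    = ℚ.≤-reflexive (sym (ℚ.*-zeroˡ x))
    ∏-1≤ (suc k) = begin
      (1ℚ + x) * X - 1ℚ                              ≡⟨ split x X ⟩
      (1ℚ + x) * (X - 1ℚ) + x                        ≤⟨ ℚ.+-monoˡ-≤ x (*-mono-≤ (+-nonneg 0≤1 0≤x) 0≤bound (ℚ.+-monoʳ-≤ 1ℚ x≤1) (∏-1≤ k)) ⟩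
      (1ℚ + 1ℚ) * ((2ℚ ^ k - 1ℚ) * x) + x           ≡⟨ collect (2ℚ ^ k) x ⟩
      (2ℚ ^ suc k - 1ℚ) * x                          ∎
      where
      X = ∏ k (λ _ → 1ℚ + x)
      0≤bound : 0ℚ ≤ (2ℚ ^ k - 1ℚ) * x
      0≤bound = *-nonneg (0≤q-p (1≤p⇒1≤p^n k (ℚ.≤ᵇ⇒≤ _))) 0≤x
      split : ∀ x X → (1ℚ + x) * X - 1ℚ ≡ (1ℚ + x) * (X - 1ℚ) + x
      split = solve-∀ ℚ-ring
      collect : ∀ t x → (1ℚ + 1ℚ) * ((t - 1ℚ) * x) + x ≡ ((1ℚ + 1ℚ) * t - 1ℚ) * x
      collect = solve-∀ ℚ-ring

    -- The 2ᵏ - 1 - k monomials of degree at least 2 are at most x² each, and the second summand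
    -- adds k x².
    second-order : ∀ k → remainder k (λ _ → x) + x * (∫[ _ ∈ counting k ] x) ≤ (2ℚ ^ k - 1ℚ) * (x * x)
    second-order zero    = ℚ.≤-reflexive (zeros x)
      where
      zeros : ∀ x → (1ℚ - 1ℚ - 0ℚ) + x * 0ℚ ≡ (1ℚ - 1ℚ) * (x * x)
      zeros = solve-∀ ℚ-ring
    second-order (suc k) = begin
      ((1ℚ + x) * X - 1ℚ - ∫ (counting (suc k)) (λ _ → x)) + x * (∫ (counting (suc k)) (λ _ → x))
        ≡⟨ trans (cong (λ s → ((1ℚ + x) * X - 1ℚ - s) + x * s) (∫-counting k (λ _ → x))) (split x X _) ⟩
      (remainder k (λ _ → x) + x * (∫[ _ ∈ counting k ] x)) + x * (X - 1ℚ) + x * x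
        ≤⟨ ℚ.+-monoˡ-≤ (x * x) (ℚ.+-mono-≤ (second-order k) (*-monoˡ-≤ x 0≤x (∏-1≤ k))) ⟩
      (2ℚ ^ k - 1ℚ) * (x * x) + x * ((2ℚ ^ k - 1ℚ) * x) + x * x
        ≡⟨ collect (2ℚ ^ k) x ⟩
      (2ℚ ^ suc k - 1ℚ) * (x * x) ∎
      where
      X = ∏ k (λ _ → 1ℚ + x)
      split : ∀ x X s → ((1ℚ + x) * X - 1ℚ - (x + s)) + x * (x + s) ≡ (X - 1ℚ - s + x * s) + x * (X - 1ℚ) + x * x
      split = solve-∀ ℚ-ring
      collect : ∀ t x → (t - 1ℚ) * (x * x) + x * ((t - 1ℚ) * x) + x * x ≡ ((1ℚ + 1ℚ) * t - 1ℚ) * (x * x)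
      collect = solve-∀ ℚ-ring

-- Block constraints: the i-th variable is taken from the i-th block of N variables.

module Blocks (N r : ℕ) where

  -- The last `r` variables belong to no block and occur in no constraint; they absorb the remainder
  -- of n modulo k.
  size : ℕ → ℕ
  size zero    = r
  size (suc k) = N ℕ.+ size k

  index : ∀ {k} → Fin k → Fin N → Fin (size k)
  index {suc k} zero    j = j ↑ˡ size k
  index {suc k} (suc i) j = N ↑ʳ index i j

  index-injective : ∀ {k} (i i′ : Fin k) j j′ → index i j ≡ index i′ j′ → i ≡ i′
  index-injective {suc k} zero    zero     j j′ eq = refl
  index-injective {suc k} zero    (suc i′) j j′ eq = contradiction (trans (sym (Fin.splitAt-↑ˡ N j (size k))) (trans (cong (splitAt N) eq) (Fin.splitAt-↑ʳ N (size k) (index i′ j′)))) λ ()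
  index-injective {suc k} (suc i) zero     j j′ eq = contradiction (trans (sym (Fin.splitAt-↑ˡ N j′ (size k))) (trans (cong (splitAt N) (sym eq)) (Fin.splitAt-↑ʳ N (size k) (index i j)))) λ ()
  index-injective {suc k} (suc i) (suc i′) j j′ eq = cong suc (index-injective i i′ j j′ (Fin.↑ʳ-injective N _ _ eq))

  -- Distinct blocks are independent. Two positions per block are allowed, one for each of the two
  -- constraints being correlated.
  ∫-blocks : ∀ k (F : Fin k → Sign → Sign → ℚ) (u v : Fin k → Fin N) →
    (∫[ σ ∈ cube (size k) ] ∏ k (λ i → F i (Vec.lookup σ (index i (u i))) (Vec.lookup σ (index i (v i))))) ≡
    ∏ k (λ i → ∫[ τ ∈ cube N ] F i (Vec.lookup τ (u i)) (Vec.lookup τ (v i)))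
  ∫-blocks zero    F u v = cube-isProbability r
  ∫-blocks (suc k) F u v = begin
    _ ≡⟨ ∫-pow-++ signs± N (size k) _ ⟩
    (∫[ τ ∈ cube N ] ∫[ σ ∈ cube (size k) ]
      ∏ (suc k) (λ i → F i (Vec.lookup (τ Vec.++ σ) (index i (u i))) (Vec.lookup (τ Vec.++ σ) (index i (v i)))))
      ≡⟨ ∫-cong (cube N) (λ τ → ∫-cong (cube (size k)) (λ σ → cong₂ _*_
           (cong₂ (F zero) (Vec.lookup-++ˡ τ σ (u zero)) (Vec.lookup-++ˡ τ σ (v zero)))
           (∏-cong k (λ i → cong₂ (F (suc i)) (Vec.lookup-++ʳ τ σ (index i (u (suc i)))) (Vec.lookup-++ʳ τ σ (index i (v (suc i)))))))) ⟩
    (∫[ τ ∈ cube N ] ∫[ σ ∈ cube (size k) ]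
      F zero (Vec.lookup τ (u zero)) (Vec.lookup τ (v zero)) *
      ∏ k (λ i → F (suc i) (Vec.lookup σ (index i (u (suc i)))) (Vec.lookup σ (index i (v (suc i))))))
      ≡⟨ trans (∫-cong (cube N) (λ τ → ∫-* (cube (size k)) (F₀ τ) Fs)) (∫-*ʳ (cube N) F₀ _) ⟩
    (∫[ τ ∈ cube N ] F zero (Vec.lookup τ (u zero)) (Vec.lookup τ (v zero))) *
    (∫[ σ ∈ cube (size k) ] ∏ k (λ i → F (suc i) (Vec.lookup σ (index i (u (suc i)))) (Vec.lookup σ (index i (v (suc i))))))
      ≡⟨ cong (∫ (cube N) F₀ *_) (∫-blocks k (F ∘ suc) (u ∘ suc) (v ∘ suc)) ⟩
    _ ∎
    where
    open ≡-Reasoning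
    F₀ : Vec Sign N → ℚ
    F₀ τ = F zero (Vec.lookup τ (u zero)) (Vec.lookup τ (v zero))
    Fs : Vec Sign (size k) → ℚ
    Fs σ = ∏ k (λ i → F (suc i) (Vec.lookup σ (index i (u (suc i)))) (Vec.lookup σ (index i (v (suc i)))))

-- The planted distribution on block constraints

module Planted
  {k N : ℕ} (r : ℕ) (D : Measure (Vec Sign k)) (D₁ : IsProbability D)
  (x : ℚ) (0≤x : 0ℚ ≤ x) (x≤1 : x ≤ 1ℚ) (Nx≡1 : ι N * x ≡ 1ℚ)
  -- Only near one-wise independence: squared means of size x = 1/N leave first-order correlations
  -- which, averaged over the second constraint, are of order 1/N² like those of second order.
  (mean : ∀ i → (∫[ a ∈ D ] sgn (Vec.lookup a i)) * (∫[ a ∈ D ] sgn (Vec.lookup a i)) ≤ x)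
  where

  open Blocks N r public

  Ω : Measure (Vec Sign (size k))
  Ω = cube (size k)

  uniform : Measure (Fin N)
  uniform = scale x 0≤x (counting N)

  ∫-uniform : ∀ f → ∫ uniform f ≡ x * ∫ (counting N) f
  ∫-uniform = ∫-scale x 0≤x (counting N)

  uniform-isProbability : IsProbability uniform
  uniform-isProbability = trans (∫-uniform (λ _ → 1ℚ))
    (trans (cong (x *_) (total-counting N)) (trans (ℚ.*-comm x (ι N)) Nx≡1))

  ∫-uniform-kronecker : ∀ j → ∫ uniform (kronecker j) ≡ x
  ∫-uniform-kronecker j = trans (∫-uniform (kronecker j)) (trans (cong (x *_) (∫-kronecker j)) (ℚ.*-identityʳ x))

  Sample : Set
  Sample = Vec (Fin N) k × Vec Sign k

  positions : Measure (Vec (Fin N) k)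
  positions = pow uniform k

  positions-isProbability : IsProbability positions
  positions-isProbability = pow-isProbability uniform uniform-isProbability k

  μ : Measure Sample
  μ = positions >>= λ js → cube k >>= λ b → dirac (js , b)

  ∫-μ : ∀ f → ∫ μ f ≡ (∫[ js ∈ positions ] ∫[ b ∈ cube k ] f (js , b))
  ∫-μ f = trans (∫->>= positions _ f) (∫-cong positions λ js →
    trans (∫->>= (cube k) _ f) (∫-cong (cube k) λ b → ∫-dirac (js , b) f))

  ∫-μ-positions : ∀ f → (∫[ c ∈ μ ] f (proj₁ c)) ≡ ∫ positions f
  ∫-μ-positions f = trans (∫-μ _) (∫-cong positions λ js → ∫-const (cube k) (cube-isProbability k) (f js))

  μ-isProbability : IsProbability μ
  μ-isProbability = trans (∫-μ-positions (λ _ → 1ℚ)) positions-isProbability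

  factor-at : Vec Sign (size k) → Sample → Vec Sign k → Fin k → ℚ
  factor-at σ (js , b) a i =
    1ℚ + sgn (Vec.lookup a i) * sgn (Vec.lookup b i) * sgn (Vec.lookup σ (index i (Vec.lookup js i)))

  -- The relative density of the constraint (js , b) when b is the pointwise
  -- product of a sample of D and the values of σ at the variables.
  L : Vec Sign (size k) → Sample → ℚ
  L σ c = ∫[ a ∈ D ] ∏ k (factor-at σ c a)

  0≤1+sgn³ : ∀ s t u → 0ℚ ≤ 1ℚ + sgn s * sgn t * sgn u
  0≤1+sgn³ Sign.- Sign.- Sign.- = ℚ.≤ᵇ⇒≤ _
  0≤1+sgn³ Sign.- Sign.- Sign.+ = ℚ.≤ᵇ⇒≤ _
  0≤1+sgn³ Sign.- Sign.+ Sign.- = ℚ.≤ᵇ⇒≤ _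
  0≤1+sgn³ Sign.- Sign.+ Sign.+ = ℚ.≤ᵇ⇒≤ _
  0≤1+sgn³ Sign.+ Sign.- Sign.- = ℚ.≤ᵇ⇒≤ _
  0≤1+sgn³ Sign.+ Sign.- Sign.+ = ℚ.≤ᵇ⇒≤ _
  0≤1+sgn³ Sign.+ Sign.+ Sign.- = ℚ.≤ᵇ⇒≤ _
  0≤1+sgn³ Sign.+ Sign.+ Sign.+ = ℚ.≤ᵇ⇒≤ _

  0≤L : ∀ σ c → 0ℚ ≤ L σ c
  0≤L σ (js , b) = ∫-nonneg D (λ a → ∏-nonneg k (λ i →
    0≤1+sgn³ (Vec.lookup a i) (Vec.lookup b i) (Vec.lookup σ (index i (Vec.lookup js i)))))

  ∫L : ∀ σ → ∫ μ (L σ) ≡ 1ℚ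
  ∫L σ = begin
    ∫ μ (L σ)
      ≡⟨ ∫-μ (L σ) ⟩
    (∫[ js ∈ positions ] ∫[ b ∈ cube k ] ∫[ a ∈ D ] ∏ k (factor-at σ (js , b) a))
      ≡⟨ ∫-cong positions (λ js → ∫-swap (cube k) D (λ b a → ∏ k (factor-at σ (js , b) a))) ⟩
    (∫[ js ∈ positions ] ∫[ a ∈ D ] ∫[ b ∈ cube k ] ∏ k (factor-at σ (js , b) a))
      ≡⟨ ∫-cong positions (λ js → ∫-cong D (λ a → average js a)) ⟩
    (∫[ js ∈ positions ] ∫[ a ∈ D ] 1ℚ)
      ≡⟨ trans (∫-cong positions (λ _ → D₁)) positions-isProbability ⟩
    1ℚ ∎
    where
    open ≡-Reasoning
    cancel : ∀ s t → ½ * (1ℚ + s * (- 1ℚ) * t) + (½ * (1ℚ + s * 1ℚ * t) + 0ℚ) ≡ 1ℚ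
    cancel = solve-∀ ℚ-ring
    average : ∀ js a → (∫[ b ∈ cube k ] ∏ k (factor-at σ (js , b) a)) ≡ 1ℚ
    average js a = trans
      (∫-∏ signs± k (λ i s → 1ℚ + sgn (Vec.lookup a i) * sgn s * sgn (Vec.lookup σ (index i (Vec.lookup js i)))))
      (trans (∏-cong k (λ i → cancel (sgn (Vec.lookup a i)) (sgn (Vec.lookup σ (index i (Vec.lookup js i)))))) (∏-1 k))

  L-degree : ∀ c → Degree≤ k (λ σ → L σ c)
  L-degree (js , b) = degree-∫ D (λ a → degree-∏ k (λ i →
    degree-+ (constant 1ℚ (λ _ → refl))
      (degree-scale (sgn (Vec.lookup a i) * sgn (Vec.lookup b i)) (degree-lookup (index i (Vec.lookup js i))))))

  pattern-at : Vec Sign (size k) → Sample → Vec Sign k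
  pattern-at σ (js , b) = Vec.tabulate (λ i → Vec.lookup b i Sign.* Vec.lookup σ (index i (Vec.lookup js i)))

  1+sgn³≡0 : ∀ s t u → 1ℚ + sgn s * sgn t * sgn u ≡ 0ℚ ⊎ s ≡ t Sign.* u
  1+sgn³≡0 Sign.- Sign.- Sign.- = inj₁ refl
  1+sgn³≡0 Sign.- Sign.- Sign.+ = inj₂ refl
  1+sgn³≡0 Sign.- Sign.+ Sign.- = inj₂ refl
  1+sgn³≡0 Sign.- Sign.+ Sign.+ = inj₁ refl
  1+sgn³≡0 Sign.+ Sign.- Sign.- = inj₂ refl
  1+sgn³≡0 Sign.+ Sign.- Sign.+ = inj₁ refl
  1+sgn³≡0 Sign.+ Sign.+ Sign.- = inj₁ refl
  1+sgn³≡0 Sign.+ Sign.+ Sign.+ = inj₂ refl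

  -- A factor of the product vanishes as soon as `a` disagrees with the pattern in that coordinate,
  -- so only the pattern itself could contribute, and it lies outside the support of `D`.
  L-support : ∀ (f : Vec Sign k → Bool) →
    (∀ u → (∀ a → f a ≡ true → u a ≡ 0ℚ) → ∫ D u ≡ 0ℚ) →
    ∀ σ c → f (pattern-at σ c) ≡ false → L σ c ≡ 0ℚ
  L-support f supp σ c@(js , b) f≡false = supp _ λ a fa≡true → vanish a fa≡true
    (∏-zero k (λ i → 1+sgn³≡0 (Vec.lookup a i) (Vec.lookup b i) (Vec.lookup σ (index i (Vec.lookup js i)))))
    where
    vanish : ∀ a → f a ≡ true → ∏ k (factor-at σ c a) ≡ 0ℚ ⊎
      (∀ i → Vec.lookup a i ≡ Vec.lookup b i Sign.* Vec.lookup σ (index i (Vec.lookup js i))) →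
      ∏ k (factor-at σ c a) ≡ 0ℚ
    vanish a fa≡true (inj₁ ∏≡0) = ∏≡0
    vanish a fa≡true (inj₂ a≡)  = contradiction
      (trans (sym fa≡true) (trans (cong f (trans (sym (Vec.tabulate∘lookup a)) (Vec.tabulate-cong a≡))) f≡false)) λ ()

  module _ where
    open ℚ.≤-Reasoning

    e : Sample → Sample → Fin k → ℚ
    e (js , _) (js′ , _) i = kronecker (Vec.lookup js i) (Vec.lookup js′ i)

    y : Sample → Vec Sign k → Fin k → ℚ
    y (_ , b) a i = sgn (Vec.lookup a i) * sgn (Vec.lookup b i)

    z : Sample → Sample → Vec Sign k → Vec Sign k → Fin k → ℚ
    z c c′ a a′ i = y c a i * y c′ a′ i * e c c′ i

    K : Sample → Sample → ℚ
    K c c′ = ∫[ σ ∈ Ω ] (L σ c - 1ℚ) * (L σ c′ - 1ℚ)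

    -- The two copies of L bring two independent samples a, a′ of `D`. Signs at different variables
    -- are uncorrelated, so the i-th block averages to 1 + zᵢ, where zᵢ vanishes unless both
    -- constraints use the same i-th variable.
    ∫LL : ∀ c c′ → (∫[ σ ∈ Ω ] L σ c * L σ c′) ≡ (∫[ a ∈ D ] ∫[ a′ ∈ D ] ∏ k (λ i → 1ℚ + z c c′ a a′ i))
    ∫LL c c′ = begin-equality
      (∫[ σ ∈ Ω ] L σ c * L σ c′)
        ≡⟨ ∫-cong Ω (λ σ → ∫-*ʳ D _ (L σ c′)) ⟨
      (∫[ σ ∈ Ω ] ∫[ a ∈ D ] ∏ k (factor-at σ c a) * L σ c′)
        ≡⟨ ∫-cong Ω (λ σ → ∫-cong D (λ a → trans (sym (∫-* D (∏ k (factor-at σ c a)) _))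
             (∫-cong D (λ a′ → ∏-* k (factor-at σ c a) (factor-at σ c′ a′))))) ⟩
      (∫[ σ ∈ Ω ] ∫[ a ∈ D ] ∫[ a′ ∈ D ] ∏ k (λ i → factor-at σ c a i * factor-at σ c′ a′ i))
        ≡⟨ trans (∫-swap Ω D _) (∫-cong D (λ a → ∫-swap Ω D _)) ⟩
      (∫[ a ∈ D ] ∫[ a′ ∈ D ] ∫[ σ ∈ Ω ] ∏ k (λ i → factor-at σ c a i * factor-at σ c′ a′ i))
        ≡⟨ ∫-cong D (λ a → ∫-cong D (λ a′ → trans
             (∫-blocks k (λ i s t → (1ℚ + y c a i * sgn s) * (1ℚ + y c′ a′ i * sgn t)) (Vec.lookup (proj₁ c)) (Vec.lookup (proj₁ c′)))
             (∏-cong k (λ i → ∫-factors (Vec.lookup (proj₁ c) i) (Vec.lookup (proj₁ c′) i) (y c a i) (y c′ a′ i))))) ⟩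
      (∫[ a ∈ D ] ∫[ a′ ∈ D ] ∏ k (λ i → 1ℚ + z c c′ a a′ i)) ∎

    ∫L≡1 : ∀ c → (∫[ σ ∈ Ω ] L σ c) ≡ 1ℚ
    ∫L≡1 c = begin-equality
      (∫[ σ ∈ Ω ] L σ c)
        ≡⟨ ∫-swap Ω D _ ⟩
      (∫[ a ∈ D ] ∫[ σ ∈ Ω ] ∏ k (factor-at σ c a))
        ≡⟨ ∫-cong D (λ a → trans
             (∫-blocks k (λ i s t → 1ℚ + y c a i * sgn s) (Vec.lookup (proj₁ c)) (Vec.lookup (proj₁ c)))
             (trans (∏-cong k (λ i → centred (y c a i) (Vec.lookup (proj₁ c) i))) (∏-1 k))) ⟩
      (∫[ a ∈ D ] 1ℚ)
        ≡⟨ D₁ ⟩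
      1ℚ ∎
      where
      centred : ∀ y j → (∫[ τ ∈ cube N ] 1ℚ + y * sgn (Vec.lookup τ j)) ≡ 1ℚ
      centred y j = trans (∫-+ (cube N) (λ _ → 1ℚ) _)
        (cong₂ _+_ (cube-isProbability N) (trans (∫-* (cube N) y _) (trans (cong (y *_) (∫-lookup j)) (ℚ.*-zeroʳ y))))

    ∫∫ : (Vec Sign k → Vec Sign k → ℚ) → ℚ
    ∫∫ f = ∫[ a ∈ D ] ∫[ a′ ∈ D ] f a a′

    ∫∫-const : ∀ c → ∫∫ (λ _ _ → c) ≡ c
    ∫∫-const c = trans (∫-cong D (λ _ → ∫-const D D₁ c)) (∫-const D D₁ c)

    K≡ : ∀ c c′ → K c c′ ≡ ∫∫ (λ a a′ → remainder k (z c c′ a a′)) + ∫∫ (λ a a′ → ∫ (counting k) (z c c′ a a′))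
    K≡ c c′ = begin-equality
      K c c′
        ≡⟨ ∫-cong Ω (λ σ → expand (L σ c) (L σ c′)) ⟩
      (∫[ σ ∈ Ω ] ((L σ c * L σ c′ - L σ c) - L σ c′) + 1ℚ)
        ≡⟨ trans (∫-+ Ω _ _) (cong₂ _+_ (trans (∫-- Ω _ _) (cong₂ _-_ (trans (∫-- Ω _ _)
             (cong₂ _-_ (∫LL c c′) (∫L≡1 c))) (∫L≡1 c′))) (cube-isProbability (size k))) ⟩
      ((∫∫ (λ a a′ → ∏ k (λ i → 1ℚ + z c c′ a a′ i)) - 1ℚ) - 1ℚ) + 1ℚ
        ≡⟨ collect (∫∫ (λ a a′ → ∏ k (λ i → 1ℚ + z c c′ a a′ i))) ⟩
      ∫∫ (λ a a′ → ∏ k (λ i → 1ℚ + z c c′ a a′ i)) - 1ℚ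
        ≡⟨ cong (λ t → ∫∫ (λ a a′ → ∏ k (λ i → 1ℚ + z c c′ a a′ i)) - t) (∫∫-const 1ℚ) ⟨
      ∫∫ (λ a a′ → ∏ k (λ i → 1ℚ + z c c′ a a′ i)) - ∫∫ (λ _ _ → 1ℚ)
        ≡⟨ trans (∫-cong D (λ a → ∫-- D _ _)) (∫-- D _ _) ⟨
      ∫∫ (λ a a′ → ∏ k (λ i → 1ℚ + z c c′ a a′ i) - 1ℚ)
        ≡⟨ ∫-cong D (λ a → ∫-cong D (λ a′ → split (∏ k (λ i → 1ℚ + z c c′ a a′ i)) (∫ (counting k) (z c c′ a a′)))) ⟩
      ∫∫ (λ a a′ → remainder k (z c c′ a a′) + ∫ (counting k) (z c c′ a a′))
        ≡⟨ trans (∫-cong D (λ a → ∫-+ D _ _)) (∫-+ D _ _) ⟩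
      ∫∫ (λ a a′ → remainder k (z c c′ a a′)) + ∫∫ (λ a a′ → ∫ (counting k) (z c c′ a a′)) ∎
      where
      expand : ∀ l l′ → (l - 1ℚ) * (l′ - 1ℚ) ≡ ((l * l′ - l) - l′) + 1ℚ
      expand = solve-∀ ℚ-ring
      collect : ∀ t → ((t - 1ℚ) - 1ℚ) + 1ℚ ≡ t - 1ℚ
      collect = solve-∀ ℚ-ring
      split : ∀ p s → p - 1ℚ ≡ (p - 1ℚ - s) + s
      split = solve-∀ ℚ-ring

    -- The majorant of |K|. With s shared variables the remainder is 2ˢ - 1 - s, which vanishes for
    -- s ≤ 1. A single shared variable counts only through the product of two means of `D`, hence
    -- the factor x in the first-order part.
    M : Sample → Sample → ℚ
    M c c′ = remainder k (e c c′) + x * ∫ (counting k) (e c c′)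

    ∣y∣ : ∀ c a i → ∣ y c a i ∣ ≡ 1ℚ
    ∣y∣ (_ , b) a i = trans (ℚ.∣p*q∣≡∣p∣*∣q∣ (sgn (Vec.lookup a i)) (sgn (Vec.lookup b i)))
      (cong₂ _*_ (∣sgn∣ (Vec.lookup a i)) (∣sgn∣ (Vec.lookup b i)))

    0≤e : ∀ c c′ i → 0ℚ ≤ e c c′ i
    0≤e (js , _) (js′ , _) i = 0≤kronecker (Vec.lookup js i) (Vec.lookup js′ i)

    ∣z∣ : ∀ c c′ a a′ i → ∣ z c c′ a a′ i ∣ ≡ e c c′ i
    ∣z∣ c c′ a a′ i = begin-equality
      ∣ y c a i * y c′ a′ i * e c c′ i ∣
        ≡⟨ trans (ℚ.∣p*q∣≡∣p∣*∣q∣ (y c a i * y c′ a′ i) (e c c′ i))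
             (cong (_* ∣ e c c′ i ∣) (ℚ.∣p*q∣≡∣p∣*∣q∣ (y c a i) (y c′ a′ i))) ⟩
      ∣ y c a i ∣ * ∣ y c′ a′ i ∣ * ∣ e c c′ i ∣
        ≡⟨ cong₂ _*_ (cong₂ _*_ (∣y∣ c a i) (∣y∣ c′ a′ i)) (ℚ.0≤p⇒∣p∣≡p (0≤e c c′ i)) ⟩
      1ℚ * 1ℚ * e c c′ i
        ≡⟨ ℚ.*-identityˡ (e c c′ i) ⟩
      e c c′ i ∎

    mean-at : Fin k → ℚ
    mean-at i = ∫[ a ∈ D ] sgn (Vec.lookup a i)

    -- Averaging over the independent a and a′ turns each first-order term into the square of a mean
    -- of `D`.
    ∣first-order∣≤ : ∀ c c′ → ∣ ∫∫ (λ a a′ → ∫ (counting k) (z c c′ a a′)) ∣ ≤ x * ∫ (counting k) (e c c′)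
    ∣first-order∣≤ c c′ = begin
      ∣ ∫∫ (λ a a′ → ∫ (counting k) (z c c′ a a′)) ∣
        ≡⟨ cong ∣_∣ (trans (∫-cong D (λ a → ∫-swap D (counting k) _)) (∫-swap D (counting k) _)) ⟩
      ∣ (∫[ i ∈ counting k ] ∫∫ (λ a a′ → z c c′ a a′ i)) ∣
        ≤⟨ ∣∫∣≤ (counting k) _ each ⟩
      (∫[ i ∈ counting k ] x * e c c′ i)
        ≡⟨ ∫-* (counting k) x (e c c′) ⟩
      x * ∫ (counting k) (e c c′) ∎
      where
      each : ∀ i → ∣ ∫∫ (λ a a′ → z c c′ a a′ i) ∣ ≤ x * e c c′ i
      each i = begin
        ∣ ∫∫ (λ a a′ → z c c′ a a′ i) ∣
          ≡⟨ cong ∣_∣ factorise ⟩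
        ∣ (s * t * e c c′ i) * (m * m) ∣
          ≡⟨ trans (ℚ.∣p*q∣≡∣p∣*∣q∣ (s * t * e c c′ i) (m * m)) (cong₂ _*_
               (trans (ℚ.∣p*q∣≡∣p∣*∣q∣ (s * t) (e c c′ i)) (cong₂ _*_
                 (trans (ℚ.∣p*q∣≡∣p∣*∣q∣ s t) (cong₂ _*_ (∣sgn∣ (Vec.lookup (proj₂ c) i)) (∣sgn∣ (Vec.lookup (proj₂ c′) i))))
                 (ℚ.0≤p⇒∣p∣≡p (0≤e c c′ i))))
               (ℚ.0≤p⇒∣p∣≡p (p*p-nonneg m))) ⟩
        (1ℚ * 1ℚ * e c c′ i) * (m * m)
          ≤⟨ *-monoˡ-≤ (1ℚ * 1ℚ * e c c′ i) (subst (0ℚ ≤_) (sym (ℚ.*-identityˡ (e c c′ i))) (0≤e c c′ i)) (mean i) ⟩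
        (1ℚ * 1ℚ * e c c′ i) * x
          ≡⟨ trans (cong (_* x) (ℚ.*-identityˡ (e c c′ i))) (ℚ.*-comm (e c c′ i) x) ⟩
        x * e c c′ i ∎
        where
        s = sgn (Vec.lookup (proj₂ c) i)
        t = sgn (Vec.lookup (proj₂ c′) i)
        m = mean-at i
        regroup : ∀ a s a′ t e → (a * s) * (a′ * t) * e ≡ (s * t * e) * a * a′
        regroup = solve-∀ ℚ-ring
        factorise : ∫∫ (λ a a′ → z c c′ a a′ i) ≡ (s * t * e c c′ i) * (m * m)
        factorise = begin-equality
          ∫∫ (λ a a′ → z c c′ a a′ i)
            ≡⟨ ∫-cong D (λ a → trans
                 (∫-cong D (λ a′ → regroup (sgn (Vec.lookup a i)) s (sgn (Vec.lookup a′ i)) t (e c c′ i)))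
                 (∫-* D ((s * t * e c c′ i) * sgn (Vec.lookup a i)) _)) ⟩
          (∫[ a ∈ D ] (s * t * e c c′ i) * sgn (Vec.lookup a i) * m)
            ≡⟨ trans (∫-*ʳ D _ m) (cong (_* m) (∫-* D (s * t * e c c′ i) _)) ⟩
          (s * t * e c c′ i) * m * m
            ≡⟨ ℚ.*-assoc (s * t * e c c′ i) m m ⟩
          (s * t * e c c′ i) * (m * m) ∎

    ∣K∣≤M : ∀ c c′ → ∣ K c c′ ∣ ≤ M c c′
    ∣K∣≤M c c′ = begin
      ∣ K c c′ ∣
        ≡⟨ cong ∣_∣ (K≡ c c′) ⟩
      ∣ ∫∫ (λ a a′ → remainder k (z c c′ a a′)) + ∫∫ (λ a a′ → ∫ (counting k) (z c c′ a a′)) ∣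
        ≤⟨ ℚ.∣p+q∣≤∣p∣+∣q∣ (∫∫ (λ a a′ → remainder k (z c c′ a a′))) (∫∫ (λ a a′ → ∫ (counting k) (z c c′ a a′))) ⟩
      ∣ ∫∫ (λ a a′ → remainder k (z c c′ a a′)) ∣ + ∣ ∫∫ (λ a a′ → ∫ (counting k) (z c c′ a a′)) ∣
        ≤⟨ ℚ.+-mono-≤ (∣∫∣≤ D _ (λ a → ∣∫∣≤ D _ (λ a′ →
             ∣remainder∣≤ k (λ i → ℚ.≤-reflexive (∣z∣ c c′ a a′ i))))) (∣first-order∣≤ c c′) ⟩
      ∫∫ (λ _ _ → remainder k (e c c′)) + x * ∫ (counting k) (e c c′)
        ≡⟨ cong (_+ x * ∫ (counting k) (e c c′)) (∫∫-const (remainder k (e c c′))) ⟩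
      M c c′ ∎

    M-sym : ∀ c c′ → M c c′ ≡ M c′ c
    M-sym c c′ = cong₂ _+_
      (cong₂ _-_ (cong (λ t → t - 1ℚ) (∏-cong k (λ i → cong (1ℚ +_) (e-sym i)))) (∫-cong (counting k) e-sym))
      (cong (x *_) (∫-cong (counting k) e-sym))
      where
      e-sym : ∀ i → e c c′ i ≡ e c′ c i
      e-sym i = kronecker-sym (Vec.lookup (proj₁ c) i) (Vec.lookup (proj₁ c′) i)

    ∫-positions-lookup : ∀ k (i : Fin k) (f : Fin N → ℚ) →
      (∫[ js ∈ pow uniform k ] f (Vec.lookup js i)) ≡ ∫ uniform f
    ∫-positions-lookup (suc k) zero    f = trans (∫-pow uniform k _)
      (∫-cong uniform (λ j → ∫-const (pow uniform k) (pow-isProbability uniform uniform-isProbability k) (f j)))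
    ∫-positions-lookup (suc k) (suc i) f = trans (∫-pow uniform k _)
      (trans (∫-cong uniform (λ _ → ∫-positions-lookup k i f)) (∫-const uniform uniform-isProbability (∫ uniform f)))

    κ : ℚ
    κ = 2ℚ ^ k * (x * x)

    0≤κ : 0ℚ ≤ κ
    0≤κ = *-nonneg (^-nonneg k (ℚ.nonNegative⁻¹ 2ℚ)) (p*p-nonneg x)

    -- For fixed `c` the coincidences `e c c′ i` are independent in i with mean x, so the product
    -- and the sum average as if each were the constant x.
    ∫M≤ : ∀ c → (∫[ c′ ∈ μ ] M c c′) ≤ κ
    ∫M≤ c@(js , b) = begin
      (∫[ c′ ∈ μ ] M c c′)
        ≡⟨ ∫-μ-positions (λ js′ → M c (js′ , b)) ⟩
      (∫[ js′ ∈ positions ] M c (js′ , b))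
        ≡⟨ trans (∫-+ positions _ _) (cong₂ _+_
             (trans (∫-- positions _ _) (cong₂ _-_ (trans (∫-- positions _ _) (cong₂ _-_ ∫∏ positions-isProbability)) ∫Σ))
             (trans (∫-* positions x _) (cong (x *_) ∫Σ))) ⟩
      remainder k (λ _ → x) + x * (∫[ _ ∈ counting k ] x)
        ≤⟨ second-order 0≤x x≤1 k ⟩
      (2ℚ ^ k - 1ℚ) * (x * x)
        ≤⟨ ≤-by (x * x) (p*p-nonneg x) (split (2ℚ ^ k) (x * x)) ⟩
      κ ∎
      where
      split : ∀ t x → t * x ≡ (t - 1ℚ) * x + x
      split = solve-∀ ℚ-ring
      δ′ : Fin k → Fin N → ℚ
      δ′ i = kronecker (Vec.lookup js i)
      ∫∏ : (∫[ js′ ∈ positions ] ∏ k (λ i → 1ℚ + δ′ i (Vec.lookup js′ i))) ≡ ∏ k (λ _ → 1ℚ + x)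
      ∫∏ = trans (∫-∏ uniform k (λ i j → 1ℚ + δ′ i j))
        (∏-cong k (λ i → trans (∫-+ uniform (λ _ → 1ℚ) (δ′ i)) (cong₂ _+_ uniform-isProbability (∫-uniform-kronecker (Vec.lookup js i)))))
      ∫Σ : (∫[ js′ ∈ positions ] ∫[ i ∈ counting k ] δ′ i (Vec.lookup js′ i)) ≡ (∫[ _ ∈ counting k ] x)
      ∫Σ = trans (∫-swap positions (counting k) _)
        (∫-cong (counting k) (λ i → trans (∫-positions-lookup k i (δ′ i)) (∫-uniform-kronecker (Vec.lookup js i))))

    -- Schur's test for the correlation kernel K.
    kernel : ∀ (g : Sample → ℚ) → (∫[ σ ∈ Ω ] (∫[ c ∈ μ ] g c * (L σ c - 1ℚ)) * (∫[ c ∈ μ ] g c * (L σ c - 1ℚ)))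
                   ≤ κ * (∫[ c ∈ μ ] g c * g c)
    kernel g = begin
      (∫[ σ ∈ Ω ] (∫[ c ∈ μ ] g c * (L σ c - 1ℚ)) * (∫[ c ∈ μ ] g c * (L σ c - 1ℚ)))
        ≡⟨ expand ⟩
      (∫[ c ∈ μ ] ∫[ c′ ∈ μ ] g c * g c′ * K c c′)
        ≤⟨ ∫-mono μ (λ c → ∫-mono μ (λ c′ → schur c c′)) ⟩
      (∫[ c ∈ μ ] ∫[ c′ ∈ μ ] ½ * (g c * g c * M c c′) + ½ * (g c′ * g c′ * M c c′))
        ≡⟨ trans (∫-cong μ (λ c → ∫-+ μ _ _)) (∫-+ μ _ _) ⟩
      (∫[ c ∈ μ ] ∫[ c′ ∈ μ ] ½ * (g c * g c * M c c′)) + (∫[ c ∈ μ ] ∫[ c′ ∈ μ ] ½ * (g c′ * g c′ * M c c′))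
        ≡⟨ cong ((∫[ c ∈ μ ] ∫[ c′ ∈ μ ] ½ * (g c * g c * M c c′)) +_) (trans (∫-swap μ μ _)
             (∫-cong μ (λ c → ∫-cong μ (λ c′ → cong (λ t → ½ * (g c * g c * t)) (M-sym c′ c))))) ⟩
      (∫[ c ∈ μ ] ∫[ c′ ∈ μ ] ½ * (g c * g c * M c c′)) + (∫[ c ∈ μ ] ∫[ c′ ∈ μ ] ½ * (g c * g c * M c c′))
        ≡⟨ cong (λ t → t + t) (trans (∫-cong μ (λ c → trans (∫-* μ ½ _) (cong (½ *_) (∫-* μ (g c * g c) _)))) (∫-* μ ½ _)) ⟩
      ½ * (∫[ c ∈ μ ] g c * g c * (∫[ c′ ∈ μ ] M c c′)) + ½ * (∫[ c ∈ μ ] g c * g c * (∫[ c′ ∈ μ ] M c c′))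
        ≡⟨ halves (∫[ c ∈ μ ] g c * g c * (∫[ c′ ∈ μ ] M c c′)) ⟩
      (∫[ c ∈ μ ] g c * g c * (∫[ c′ ∈ μ ] M c c′))
        ≤⟨ ∫-mono μ (λ c → *-monoˡ-≤ (g c * g c) (p*p-nonneg (g c)) (∫M≤ c)) ⟩
      (∫[ c ∈ μ ] g c * g c * κ)
        ≡⟨ trans (∫-*ʳ μ _ κ) (ℚ.*-comm _ κ) ⟩
      κ * (∫[ c ∈ μ ] g c * g c) ∎
      where
      halves : ∀ t → ½ * t + ½ * t ≡ t
      halves = solve-∀ ℚ-ring
      regroup : ∀ a l b l′ → (a * l) * (b * l′) ≡ a * b * (l * l′)
      regroup = solve-∀ ℚ-ring
      expand : (∫[ σ ∈ Ω ] (∫[ c ∈ μ ] g c * (L σ c - 1ℚ)) * (∫[ c ∈ μ ] g c * (L σ c - 1ℚ))) ≡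
        (∫[ c ∈ μ ] ∫[ c′ ∈ μ ] g c * g c′ * K c c′)
      expand = begin-equality
        (∫[ σ ∈ Ω ] (∫[ c ∈ μ ] g c * (L σ c - 1ℚ)) * (∫[ c ∈ μ ] g c * (L σ c - 1ℚ)))
          ≡⟨ ∫-cong Ω (λ σ → trans (sym (∫-*ʳ μ _ _)) (∫-cong μ (λ c → trans (sym (∫-* μ (g c * (L σ c - 1ℚ)) _))
               (∫-cong μ (λ c′ → regroup (g c) (L σ c - 1ℚ) (g c′) (L σ c′ - 1ℚ)))))) ⟩
        (∫[ σ ∈ Ω ] ∫[ c ∈ μ ] ∫[ c′ ∈ μ ] g c * g c′ * ((L σ c - 1ℚ) * (L σ c′ - 1ℚ)))
          ≡⟨ trans (∫-swap Ω μ _) (∫-cong μ (λ c → ∫-swap Ω μ _)) ⟩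
        (∫[ c ∈ μ ] ∫[ c′ ∈ μ ] ∫[ σ ∈ Ω ] g c * g c′ * ((L σ c - 1ℚ) * (L σ c′ - 1ℚ)))
          ≡⟨ ∫-cong μ (λ c → ∫-cong μ (λ c′ → ∫-* Ω (g c * g c′) _)) ⟩
        (∫[ c ∈ μ ] ∫[ c′ ∈ μ ] g c * g c′ * K c c′) ∎
      schur : ∀ c c′ → g c * g c′ * K c c′ ≤ ½ * (g c * g c * M c c′) + ½ * (g c′ * g c′ * M c c′)
      schur c c′ = ≤-by
        ((½ * ½) * ((g c - g c′) * (g c - g c′) * (M c c′ + K c c′) + (g c + g c′) * (g c + g c′) * (M c c′ - K c c′)))
        (*-nonneg (ℚ.nonNegative⁻¹ (½ * ½)) (+-nonneg
          (*-nonneg (p*p-nonneg (g c - g c′)) (subst (0ℚ ≤_) (sub-neg (M c c′) (K c c′)) (0≤q-p (ℚ.≤-trans -K≤∣K∣ (∣K∣≤M c c′)))))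
          (*-nonneg (p*p-nonneg (g c + g c′)) (0≤q-p (ℚ.≤-trans (p≤∣p∣ (K c c′)) (∣K∣≤M c c′))))))
        (identity (g c) (g c′) (K c c′) (M c c′))
        where
        -K≤∣K∣ : - K c c′ ≤ ∣ K c c′ ∣
        -K≤∣K∣ = subst (- K c c′ ≤_) (ℚ.∣-p∣≡∣p∣ (K c c′)) (p≤∣p∣ (- K c c′))
        sub-neg : ∀ m k → m - (- k) ≡ m + k
        sub-neg = solve-∀ ℚ-ring
        identity : ∀ a b k m → ½ * (a * a * m) + ½ * (b * b * m) ≡ a * b * k +
          (½ * ½) * ((a - b) * (a - b) * (m + k) + (a + b) * (a + b) * (m - k))
        identity = solve-∀ ℚ-ring

-- Natural numbers as rationals

ι-+ : ∀ m n → ι (m ℕ.+ n) ≡ ι m + ι n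
ι-+ zero    n = sym (ℚ.+-identityˡ (ι n))
ι-+ (suc m) n = trans (cong (1ℚ +_) (ι-+ m n)) (sym (ℚ.+-assoc 1ℚ (ι m) (ι n)))

ι-* : ∀ m n → ι (m ℕ.* n) ≡ ι m * ι n
ι-* zero    n = sym (ℚ.*-zeroˡ (ι n))
ι-* (suc m) n = trans (ι-+ n (m ℕ.* n)) (trans (cong (ι n +_) (ι-* m n)) (distrib (ι m) (ι n)))
  where
  distrib : ∀ m n → n + m * n ≡ (1ℚ + m) * n
  distrib = solve-∀ ℚ-ring

ι-^ : ∀ m n → ι (m ℕ.^ n) ≡ ι m ^ n
ι-^ m zero    = refl
ι-^ m (suc n) = trans (ι-* m (m ℕ.^ n)) (cong (ι m *_) (ι-^ m n))

0≤ι : ∀ n → 0ℚ ≤ ι n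
0≤ι zero    = ℚ.≤-refl
0≤ι (suc n) = +-nonneg 0≤1 (0≤ι n)

ι-mono-≤ : ∀ {m n} → m ℕ.≤ n → ι m ≤ ι n
ι-mono-≤ {n = n} ℕ.z≤n = 0≤ι n
ι-mono-≤ (ℕ.s≤s m≤n)   = ℚ.+-monoʳ-≤ 1ℚ (ι-mono-≤ m≤n)

0<ι : ∀ n → 0ℚ < ι (suc n)
0<ι n = ℚ.<-≤-trans (ℚ.positive⁻¹ 1ℚ) (ι-mono-≤ {1} {suc n} (ℕ.s≤s ℕ.z≤n))

ι-cancel-≤ : ∀ {m n} → ι m ≤ ι n → m ℕ.≤ n
ι-cancel-≤ {m} {n} ιm≤ιn with m ℕ.≤? n
... | yes m≤n = m≤n
... | no m≰n  = contradiction ιm≤ιn (<⇒≱ (ℚ.<-≤-trans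
  (subst (_< 1ℚ + ι n) (ℚ.+-identityˡ (ι n)) (ℚ.+-monoˡ-< (ι n) (ℚ.positive⁻¹ 1ℚ))) (ι-mono-≤ (ℕ.≰⇒> m≰n))))

ι≡/1 : ∀ n → ι n ≡ ℤ.+ n / 1
ι≡/1 zero    = refl
ι≡/1 (suc n) = trans (cong (1ℚ +_) (ι≡/1 n)) (ℚ.toℚᵘ-injective (begin
  ℚ.toℚᵘ (1ℚ + ℤ.+ n / 1)                          ≈⟨ ℚ.toℚᵘ-homo-+ 1ℚ (ℤ.+ n / 1) ⟩
  ℚ.toℚᵘ 1ℚ ℚᵘ.+ ℚ.toℚᵘ (ℤ.+ n / 1)                ≈⟨ ℚᵘ.+-congʳ (ℚ.toℚᵘ 1ℚ) (ℚ.toℚᵘ-fromℚᵘ (ℚᵘ.mkℚᵘ (ℤ.+ n) 0)) ⟩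
  ℚ.toℚᵘ 1ℚ ℚᵘ.+ ℚᵘ.mkℚᵘ (ℤ.+ n) 0                 ≈⟨ ℚᵘ.*≡* (cong (λ t → (ℤ.+ 1 ℤ.+ t) ℤ.* ℤ.+ 1) (ℤ.*-identityʳ (ℤ.+ n))) ⟩
  ℚᵘ.mkℚᵘ (ℤ.+ suc n) 0                            ≈⟨ ℚ.toℚᵘ-fromℚᵘ (ℚᵘ.mkℚᵘ (ℤ.+ suc n) 0) ⟨
  ℚ.toℚᵘ (ℤ.+ suc n / 1)                           ∎))
  where open ℚᵘ.≃-Reasoning

/*ι : ∀ m n → (ℤ.+ m / suc n) * ι (suc n) ≡ ι m
/*ι m n = trans (cong ((ℤ.+ m / suc n) *_) (ι≡/1 (suc n))) (trans (ℚ.toℚᵘ-injective (begin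
  ℚ.toℚᵘ ((ℤ.+ m / suc n) * (ℤ.+ suc n / 1))
    ≈⟨ ℚ.toℚᵘ-homo-* (ℤ.+ m / suc n) (ℤ.+ suc n / 1) ⟩
  ℚ.toℚᵘ (ℤ.+ m / suc n) ℚᵘ.* ℚ.toℚᵘ (ℤ.+ suc n / 1)
    ≈⟨ ℚᵘ.*-cong (ℚ.toℚᵘ-fromℚᵘ (ℚᵘ.mkℚᵘ (ℤ.+ m) n)) (ℚ.toℚᵘ-fromℚᵘ (ℚᵘ.mkℚᵘ (ℤ.+ suc n) 0)) ⟩
  ℚᵘ.mkℚᵘ (ℤ.+ m) n ℚᵘ.* ℚᵘ.mkℚᵘ (ℤ.+ suc n) 0
    ≈⟨ ℚᵘ.*≡* (trans (ℤ.*-identityʳ (ℤ.+ m ℤ.* ℤ.+ suc n)) (cong (λ t → ℤ.+ m ℤ.* ℤ.+ t) (sym (ℕ.*-identityʳ (suc n))))) ⟩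
  ℚᵘ.mkℚᵘ (ℤ.+ m) 0
    ≈⟨ ℚ.toℚᵘ-fromℚᵘ (ℚᵘ.mkℚᵘ (ℤ.+ m) 0) ⟨
  ℚ.toℚᵘ (ℤ.+ m / 1) ∎)) (sym (ι≡/1 m)))
  where open ℚᵘ.≃-Reasoning

*-cancelʳ-≡ : ∀ {p q r} → 0ℚ < r → p * r ≡ q * r → p ≡ q
*-cancelʳ-≡ {p} {q} {r} 0<r pr≡qr = ℚ.≤-antisym
  (ℚ.*-cancelʳ-≤-pos r {{ℚ.positive 0<r}} (ℚ.≤-reflexive pr≡qr))
  (ℚ.*-cancelʳ-≤-pos r {{ℚ.positive 0<r}} (ℚ.≤-reflexive (sym pr≡qr)))

^-* : ∀ x m n → x ^ (m ℕ.* n) ≡ (x ^ m) ^ n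
^-* x m n = sym (^-assocʳ x m n)

^-pos : ∀ {p} n → 0ℚ < p → 0ℚ < p ^ n
^-pos zero    0<p = ℚ.positive⁻¹ 1ℚ
^-pos (suc n) 0<p = *-pos 0<p (^-pos n 0<p)

^-monoʳ-≤ : ∀ {p m n} → 1ℚ ≤ p → m ℕ.≤ n → p ^ m ≤ p ^ n
^-monoʳ-≤ {n = n} 1≤p ℕ.z≤n           = 1≤p⇒1≤p^n n 1≤p
^-monoʳ-≤ {p} 1≤p (ℕ.s≤s m≤n) = *-monoˡ-≤ p (ℚ.≤-trans 0≤1 1≤p) (^-monoʳ-≤ 1≤p m≤n)

bernoulli : ∀ n {x} → 0ℚ ≤ 1ℚ + x → 1ℚ + ι n * x ≤ (1ℚ + x) ^ n
bernoulli zero    {x} 0≤1+x = ℚ.≤-reflexive (trans (cong (1ℚ +_) (ℚ.*-zeroˡ x)) (ℚ.+-identityʳ 1ℚ))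
bernoulli (suc n) {x} 0≤1+x = begin
  1ℚ + (1ℚ + ι n) * x            ≤⟨ ≤-by (ι n * (x * x)) (*-nonneg (0≤ι n) (p*p-nonneg x)) (expand (ι n) x) ⟩
  (1ℚ + x) * (1ℚ + ι n * x)      ≤⟨ *-monoˡ-≤ (1ℚ + x) 0≤1+x (bernoulli n 0≤1+x) ⟩
  (1ℚ + x) ^ suc n               ∎
  where
  open ℚ.≤-Reasoning
  expand : ∀ n x → (1ℚ + x) * (1ℚ + n * x) ≡ 1ℚ + (1ℚ + n) * x + n * (x * x)
  expand = solve-∀ ℚ-ring

-- Counting satisfying points

count : (A → Bool) → List A → ℕ
count f xs = List.length (List.filterᵇ f xs)

indicator : Bool → ℚ
indicator true  = 1ℚ
indicator false = 0ℚ

count-∷ : ∀ (f : A → Bool) x xs → ι (count f (x ∷ xs)) ≡ indicator (f x) + ι (count f xs)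
count-∷ f x xs with f x
... | true  = refl
... | false = sym (ℚ.+-identityˡ (ι (count f xs)))

count-++ : ∀ (f : A → Bool) xs ys → ι (count f (xs ++ ys)) ≡ ι (count f xs) + ι (count f ys)
count-++ f []       ys = sym (ℚ.+-identityˡ _)
count-++ f (x ∷ xs) ys = begin
  ι (count f (x ∷ xs ++ ys))                             ≡⟨ count-∷ f x (xs ++ ys) ⟩
  indicator (f x) + ι (count f (xs ++ ys))               ≡⟨ cong (indicator (f x) +_) (count-++ f xs ys) ⟩
  indicator (f x) + (ι (count f xs) + ι (count f ys))    ≡⟨ ℚ.+-assoc (indicator (f x)) _ _ ⟨
  indicator (f x) + ι (count f xs) + ι (count f ys)      ≡⟨ cong (_+ ι (count f ys)) (count-∷ f x xs) ⟨
  ι (count f (x ∷ xs)) + ι (count f ys)                  ∎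
  where open ≡-Reasoning

count-map : ∀ (f : B → Bool) (g : A → B) xs → ι (count f (List.map g xs)) ≡ ι (count (f ∘ g) xs)
count-map f g []       = refl
count-map f g (x ∷ xs) = trans (count-∷ f (g x) (List.map g xs))
  (trans (cong (indicator (f (g x)) +_) (count-map f g xs)) (sym (count-∷ (f ∘ g) x xs)))

count-cube : ∀ n (f : Vec Sign n → Bool) →
  ι (count f (signVectors n)) ≡ 2ℚ ^ n * (∫[ x ∈ cube n ] indicator (f x))
count-cube zero    f = trans (count-∷ f [] []) (trans (ℚ.+-identityʳ (indicator (f [])))
  (sym (trans (ℚ.*-identityˡ _) (∫-dirac {A = Vec Sign zero} [] (indicator ∘ f)))))
count-cube (suc n) f = begin
  ι (count f (List.map (Sign.- ∷_) V ++ (List.map (Sign.+ ∷_) V ++ [])))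
    ≡⟨ cong (λ t → ι (count f (List.map (Sign.- ∷_) V ++ t))) (List.++-identityʳ (List.map (Sign.+ ∷_) V)) ⟩
  ι (count f (List.map (Sign.- ∷_) V ++ List.map (Sign.+ ∷_) V))
    ≡⟨ count-++ f (List.map (Sign.- ∷_) V) (List.map (Sign.+ ∷_) V) ⟩
  ι (count f (List.map (Sign.- ∷_) V)) + ι (count f (List.map (Sign.+ ∷_) V))
    ≡⟨ cong₂ _+_ (trans (count-map f (Sign.- ∷_) V) (count-cube n _)) (trans (count-map f (Sign.+ ∷_) V) (count-cube n _)) ⟩
  2ℚ ^ n * I₋ + 2ℚ ^ n * I₊
    ≡⟨ regroup (2ℚ ^ n) I₋ I₊ ⟩
  2ℚ ^ suc n * (½ * I₋ + ½ * I₊)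
    ≡⟨ cong (2ℚ ^ suc n *_) (trans (∫-cube n _) (trans (∫-+ (cube n) _ _) (cong₂ _+_ (∫-* (cube n) ½ _) (∫-* (cube n) ½ _)))) ⟨
  2ℚ ^ suc n * (∫[ x ∈ cube (suc n) ] indicator (f x)) ∎
  where
  open ≡-Reasoning
  V = signVectors n
  I₋ = ∫[ x ∈ cube n ] indicator (f (Sign.- ∷ x))
  I₊ = ∫[ x ∈ cube n ] indicator (f (Sign.+ ∷ x))
  regroup : ∀ t a b → t * a + t * b ≡ ((1ℚ + 1ℚ) * t) * (½ * a + ½ * b)
  regroup = solve-∀ ℚ-ring

0<2^ : ∀ n → 0ℚ < 2ℚ ^ n
0<2^ n = ^-pos n (ℚ.positive⁻¹ 2ℚ)

fraction : ∀ m n .{{_ : ℕ.NonZero n}} → (ℤ.+ m / n) * ι n ≡ ι m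
fraction m (suc n) = /*ι m n

ρ*2^k : ∀ {k} (f : Predicate k) → ρ f * 2ℚ ^ k ≡ ι (count f (signVectors k))
ρ*2^k {k} f = trans (cong (ρ f *_) (sym (ι-^ 2 k))) (fraction (count f (signVectors k)) (2 ℕ.^ k) {{ℕ.m^n≢0 2 k}})

ρ≡∫ : ∀ {k} (f : Predicate k) → ρ f ≡ (∫[ x ∈ cube k ] indicator (f x))
ρ≡∫ {k} f = *-cancelʳ-≡ (0<2^ k) (trans (ρ*2^k f) (trans (count-cube k f) (ℚ.*-comm (2ℚ ^ k) _)))

-- Multiplying by fixed signs permutes the cube. This is why a constraint with uniform signs is
-- satisfied by every assignment with probability ρ f.
∫-translate : ∀ n (s : Fin n → Sign) (F : Vec Sign n → ℚ) →
  (∫[ b ∈ cube n ] F (Vec.tabulate (λ i → Vec.lookup b i Sign.* s i))) ≡ ∫ (cube n) F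
∫-translate zero    s F = ∫-cong (cube zero) {λ b → F (Vec.tabulate (λ i → Vec.lookup b i Sign.* s i))} {F} λ { [] → refl }
∫-translate (suc n) s F = begin
  _ ≡⟨ ∫-cube n _ ⟩
  (∫[ b ∈ cube n ] ½ * G Sign.- b + ½ * G Sign.+ b)
    ≡⟨ ∫-cong (cube n) (λ b → swap (s zero) b) ⟩
  (∫[ b ∈ cube n ] ½ * F (Sign.- ∷ t b) + ½ * F (Sign.+ ∷ t b))
    ≡⟨ ∫-translate n (s ∘ suc) (λ x → ½ * F (Sign.- ∷ x) + ½ * F (Sign.+ ∷ x)) ⟩
  (∫[ x ∈ cube n ] ½ * F (Sign.- ∷ x) + ½ * F (Sign.+ ∷ x))
    ≡⟨ ∫-cube n F ⟨
  ∫ (cube (suc n)) F ∎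
  where
  open ≡-Reasoning
  t : Vec Sign n → Vec Sign n
  t b = Vec.tabulate (λ i → Vec.lookup b i Sign.* s (suc i))
  G : Sign → Vec Sign n → ℚ
  G u b = F (Vec.tabulate (λ i → Vec.lookup (u ∷ b) i Sign.* s i))
  swap : ∀ u b → ½ * F ((Sign.- Sign.* u) ∷ t b) + ½ * F ((Sign.+ Sign.* u) ∷ t b) ≡
    ½ * F (Sign.- ∷ t b) + ½ * F (Sign.+ ∷ t b)
  swap Sign.- b = ℚ.+-comm (½ * F (Sign.+ ∷ t b)) (½ * F (Sign.- ∷ t b))
  swap Sign.+ b = refl

point≤∫ : ∀ n (F : Vec Sign n → ℚ) → (∀ x → 0ℚ ≤ F x) → ∀ x → F x ≤ 2ℚ ^ n * ∫ (cube n) F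
point≤∫ zero    F 0≤F []      = ℚ.≤-reflexive (sym (trans (ℚ.*-identityˡ _) (∫-dirac {A = Vec Sign zero} [] F)))
point≤∫ (suc n) F 0≤F (s ∷ x) = begin
  F (s ∷ x)
    ≤⟨ each s ⟩
  F (Sign.- ∷ x) + F (Sign.+ ∷ x)
    ≤⟨ point≤∫ n (λ x → F (Sign.- ∷ x) + F (Sign.+ ∷ x)) (λ x → +-nonneg (0≤F (Sign.- ∷ x)) (0≤F (Sign.+ ∷ x))) x ⟩
  2ℚ ^ n * (∫[ x ∈ cube n ] F (Sign.- ∷ x) + F (Sign.+ ∷ x))
    ≡⟨ cong (2ℚ ^ n *_) (∫-cong (cube n) (λ x → halve (F (Sign.- ∷ x)) (F (Sign.+ ∷ x)))) ⟩
  2ℚ ^ n * (∫[ x ∈ cube n ] 2ℚ * (½ * F (Sign.- ∷ x) + ½ * F (Sign.+ ∷ x)))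
    ≡⟨ cong (2ℚ ^ n *_) (trans (∫-* (cube n) 2ℚ _) (cong (2ℚ *_) (sym (∫-cube n F)))) ⟩
  2ℚ ^ n * (2ℚ * ∫ (cube (suc n)) F)
    ≡⟨ regroup (2ℚ ^ n) 2ℚ (∫ (cube (suc n)) F) ⟩
  2ℚ ^ suc n * ∫ (cube (suc n)) F ∎
  where
  open ℚ.≤-Reasoning
  each : ∀ s → F (s ∷ x) ≤ F (Sign.- ∷ x) + F (Sign.+ ∷ x)
  each Sign.- = ≤-by _ (0≤F (Sign.+ ∷ x)) refl
  each Sign.+ = ≤-by _ (0≤F (Sign.- ∷ x)) (ℚ.+-comm (F (Sign.- ∷ x)) (F (Sign.+ ∷ x)))
  halve : ∀ a b → a + b ≡ (1ℚ + 1ℚ) * (½ * a + ½ * b)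
  halve = solve-∀ ℚ-ring
  regroup : ∀ a b c → a * (b * c) ≡ (b * a) * c
  regroup = solve-∀ ℚ-ring

-- Concentration

-- A Chernoff bound in which every estimate is Bernoulli's inequality: with
-- lam = 1/(3eK) the exponential moment beats the threshold R/K + 1/e.
module Chernoff (K R e : ℕ) (R≤K : R ℕ.≤ K) (q : ℚ) (0≤q : 0ℚ ≤ q) (q≤1 : q ≤ 1ℚ) (qK≡R : q * ι K ≡ ι R)
  (lam : ℚ) (0≤lam : 0ℚ ≤ lam) (lam≡ : ι 3 * ι e * (lam * ι K) ≡ 1ℚ) (X≤1 : lam * ι K ≤ 1ℚ) (lam≤1 : lam ≤ 1ℚ)
  where

  open ℚ.≤-Reasoning

  private
    X = lam * ι K
    u = lam * ι R
    0≤X : 0ℚ ≤ X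
    0≤X = *-nonneg 0≤lam (0≤ι K)
    0≤u : 0ℚ ≤ u
    0≤u = *-nonneg 0≤lam (0≤ι R)
    u≤X : u ≤ X
    u≤X = *-monoˡ-≤ lam 0≤lam (ι-mono-≤ R≤K)
    0≤1+lam : 0ℚ ≤ 1ℚ + lam
    0≤1+lam = +-nonneg 0≤1 0≤lam
    y = lam * q
    0≤y : 0ℚ ≤ y
    0≤y = *-nonneg 0≤lam 0≤q
    y≤1 : y ≤ 1ℚ
    y≤1 = *-mono-≤ 0≤lam 0≤1 lam≤1 q≤1
    Ky≡u : ι K * y ≡ u
    Ky≡u = trans (commute (ι K) lam q) (cong (lam *_) qK≡R)
      where
      commute : ∀ k l q → k * (l * q) ≡ l * (q * k)
      commute = solve-∀ ℚ-ring
    0≤1+y : 0ℚ ≤ 1ℚ + y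
    0≤1+y = +-nonneg 0≤1 0≤y
    minus : ∀ a b → a * (- b) ≡ - (a * b)
    minus = solve-∀ ℚ-ring

    -- An upper bound on a power from Bernoulli's lower bound: (1 - y)^K ≥ 1 - u, and (1 + y)(1 - y)
    -- ≤ 1.
    first : (1ℚ + y) ^ K * (1ℚ - u) ≤ 1ℚ
    first = begin
      (1ℚ + y) ^ K * (1ℚ - u)
        ≡⟨ cong (λ t → (1ℚ + y) ^ K * (1ℚ + t)) (trans (cong -_ (sym Ky≡u)) (sym (minus (ι K) y))) ⟩
      (1ℚ + y) ^ K * (1ℚ + ι K * (- y))
        ≤⟨ *-monoˡ-≤ ((1ℚ + y) ^ K) (^-nonneg K 0≤1+y) (bernoulli K (0≤q-p y≤1)) ⟩
      (1ℚ + y) ^ K * (1ℚ - y) ^ K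
        ≡⟨ ^-distrib-* (1ℚ + y) (1ℚ - y) K ⟨
      ((1ℚ + y) * (1ℚ - y)) ^ K
        ≤⟨ ^-mono-≤ K (*-nonneg 0≤1+y (0≤q-p y≤1)) (≤-by (y * y) (p*p-nonneg y) (difference y)) ⟩
      1ℚ ^ K
        ≡⟨ 1^n≡1 K ⟩
      1ℚ ∎
      where
      difference : ∀ y → 1ℚ ≡ (1ℚ + y) * (1ℚ - y) + y * y
      difference = solve-∀ ℚ-ring

    second : (1ℚ + y) ^ K * (1ℚ - u * u) ≤ (1ℚ + lam) ^ R
    second = begin
      (1ℚ + y) ^ K * (1ℚ - u * u)
        ≡⟨ difference ((1ℚ + y) ^ K) u ⟩
      ((1ℚ + y) ^ K * (1ℚ - u)) * (1ℚ + u)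
        ≤⟨ *-monoʳ-≤ (1ℚ + u) (+-nonneg 0≤1 0≤u) first ⟩
      1ℚ * (1ℚ + u)
        ≡⟨ trans (ℚ.*-identityˡ (1ℚ + u)) (cong (1ℚ +_) (ℚ.*-comm lam (ι R))) ⟩
      1ℚ + ι R * lam
        ≤⟨ bernoulli R 0≤1+lam ⟩
      (1ℚ + lam) ^ R ∎
      where
      difference : ∀ t u → t * (1ℚ - u * u) ≡ (t * (1ℚ - u)) * (1ℚ + u)
      difference = solve-∀ ℚ-ring

    u*u≤1 : u * u ≤ 1ℚ
    u*u≤1 = *-mono-≤ 0≤u 0≤1 (ℚ.≤-trans u≤X X≤1) (ℚ.≤-trans u≤X X≤1)

    third : (1ℚ + y) ^ (K ℕ.* e) * (1ℚ - ι e * (X * X)) ≤ (1ℚ + lam) ^ (R ℕ.* e)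
    third = begin
      (1ℚ + y) ^ (K ℕ.* e) * (1ℚ - ι e * (X * X))
        ≤⟨ *-monoˡ-≤ _ (^-nonneg (K ℕ.* e) 0≤1+y) (begin
             1ℚ - ι e * (X * X)         ≤⟨ ℚ.+-monoʳ-≤ 1ℚ (ℚ.neg-antimono-≤ (*-monoˡ-≤ (ι e) (0≤ι e) (*-mono-≤ 0≤u 0≤X u≤X u≤X))) ⟩
             1ℚ - ι e * (u * u)         ≡⟨ cong (1ℚ +_) (minus (ι e) (u * u)) ⟨
             1ℚ + ι e * (- (u * u))     ≤⟨ bernoulli e (0≤q-p u*u≤1) ⟩
             (1ℚ - u * u) ^ e           ∎) ⟩
      (1ℚ + y) ^ (K ℕ.* e) * (1ℚ - u * u) ^ e
        ≡⟨ trans (cong (_* (1ℚ - u * u) ^ e) (^-* (1ℚ + y) K e)) (sym (^-distrib-* _ _ e)) ⟩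
      ((1ℚ + y) ^ K * (1ℚ - u * u)) ^ e
        ≤⟨ ^-mono-≤ e (*-nonneg (^-nonneg K 0≤1+y) (0≤q-p u*u≤1)) second ⟩
      ((1ℚ + lam) ^ R) ^ e
        ≡⟨ ^-* (1ℚ + lam) R e ⟨
      (1ℚ + lam) ^ (R ℕ.* e) ∎

  -- Since X = 1/(3e), the accumulated second-order error e X² of `third` is X/3. The K additional
  -- factors gain 1 + X, and (1 - X/3)(1 + X) ≥ 1 + X/3.
  gap : (1ℚ + lam * q) ^ (K ℕ.* e) * (1ℚ + X * (ℤ.+ 1 / 3)) ≤ (1ℚ + lam) ^ (R ℕ.* e ℕ.+ K)
  gap = begin
    (1ℚ + y) ^ (K ℕ.* e) * (1ℚ + X * (ℤ.+ 1 / 3))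
      ≤⟨ *-monoˡ-≤ _ (^-nonneg (K ℕ.* e) 0≤1+y) (≤-by ((ℤ.+ 1 / 3) * (X * (1ℚ - X)))
           (*-nonneg (ℚ.nonNegative⁻¹ (ℤ.+ 1 / 3)) (*-nonneg 0≤X (0≤q-p X≤1))) split) ⟩
    (1ℚ + y) ^ (K ℕ.* e) * ((1ℚ - ι e * (X * X)) * (1ℚ + X))
      ≡⟨ ℚ.*-assoc ((1ℚ + y) ^ (K ℕ.* e)) (1ℚ - ι e * (X * X)) (1ℚ + X) ⟨
    (1ℚ + y) ^ (K ℕ.* e) * (1ℚ - ι e * (X * X)) * (1ℚ + X)
      ≤⟨ ℚ.≤-trans (*-monoʳ-≤ (1ℚ + X) (+-nonneg 0≤1 0≤X) third)
           (*-monoˡ-≤ _ (^-nonneg (R ℕ.* e) 0≤1+lam)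
             (subst (λ t → 1ℚ + t ≤ (1ℚ + lam) ^ K) (ℚ.*-comm (ι K) lam) (bernoulli K 0≤1+lam))) ⟩
    (1ℚ + lam) ^ (R ℕ.* e) * (1ℚ + lam) ^ K
      ≡⟨ ^-homo-* (1ℚ + lam) (R ℕ.* e) K ⟨
    (1ℚ + lam) ^ (R ℕ.* e ℕ.+ K) ∎
    where
    third-of : ι e * (X * X) ≡ (ℤ.+ 1 / 3) * X
    third-of = trans (rearrange (ι e) X) (trans (cong (λ t → (ℤ.+ 1 / 3) * (t * X)) lam≡) (cong ((ℤ.+ 1 / 3) *_) (ℚ.*-identityˡ X)))
      where
      rearrange : ∀ e X → e * (X * X) ≡ (ℤ.+ 1 / 3) * ((1ℚ + (1ℚ + (1ℚ + 0ℚ))) * e * X * X)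
      rearrange = solve-∀ ℚ-ring
    split : (1ℚ - ι e * (X * X)) * (1ℚ + X) ≡ 1ℚ + X * (ℤ.+ 1 / 3) + (ℤ.+ 1 / 3) * (X * (1ℚ - X))
    split = trans (cong (λ t → (1ℚ - t) * (1ℚ + X)) third-of) (identity X)
      where
      identity : ∀ X → (1ℚ - (ℤ.+ 1 / 3) * X) * (1ℚ + X) ≡ 1ℚ + X * (ℤ.+ 1 / 3) + (ℤ.+ 1 / 3) * (X * (1ℚ - X))
      identity = solve-∀ ℚ-ring

module _ {C : Set} (μ : Measure C) (μ₁ : IsProbability μ) (φ : C → Bool) (q : ℚ)
  (∫φ : (∫[ c ∈ μ ] indicator (φ c)) ≡ q) (lam : ℚ) where

  exponential-moment : ∀ t →
    (∫[ cs ∈ pow μ t ] (1ℚ + lam) ^ count φ (Vec.toList cs)) ≡ (1ℚ + lam * q) ^ t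
  exponential-moment zero    = ∫-dirac {A = Vec C zero} [] (λ _ → 1ℚ)
  exponential-moment (suc t) = begin
    (∫[ cs ∈ pow μ (suc t) ] (1ℚ + lam) ^ count φ (Vec.toList cs))
      ≡⟨ ∫-pow μ t _ ⟩
    (∫[ c ∈ μ ] ∫[ cs ∈ pow μ t ] (1ℚ + lam) ^ count φ (c ∷ Vec.toList cs))
      ≡⟨ ∫-cong μ (λ c → trans (∫-cong (pow μ t) (λ cs → head c (Vec.toList cs))) (∫-* (pow μ t) (1ℚ + lam * indicator (φ c)) _)) ⟩
    (∫[ c ∈ μ ] (1ℚ + lam * indicator (φ c)) * (∫[ cs ∈ pow μ t ] (1ℚ + lam) ^ count φ (Vec.toList cs)))
      ≡⟨ ∫-*ʳ μ _ _ ⟩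
    (∫[ c ∈ μ ] 1ℚ + lam * indicator (φ c)) * (∫[ cs ∈ pow μ t ] (1ℚ + lam) ^ count φ (Vec.toList cs))
      ≡⟨ cong₂ _*_ (trans (∫-+ μ (λ _ → 1ℚ) _) (cong₂ _+_ μ₁ (trans (∫-* μ lam _) (cong (lam *_) ∫φ)))) (exponential-moment t) ⟩
    (1ℚ + lam * q) ^ suc t ∎
    where
    open ≡-Reasoning
    head : ∀ c cs → (1ℚ + lam) ^ count φ (c ∷ cs) ≡ (1ℚ + lam * indicator (φ c)) * (1ℚ + lam) ^ count φ cs
    head c cs with φ c
    ... | true  = cong (λ t → (1ℚ + t) * (1ℚ + lam) ^ count φ cs) (sym (ℚ.*-identityʳ lam))
    ... | false = sym (trans (cong (λ t → (1ℚ + t) * (1ℚ + lam) ^ count φ cs) (ℚ.*-zeroʳ lam)) (ℚ.*-identityˡ _))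

module _ {C : Set} (μ : Measure C) (μ₁ : IsProbability μ) {n : ℕ} (φ : Vec Sign n → C → Bool) (q : ℚ) (0≤q : 0ℚ ≤ q)
  (∫φ : ∀ σ → (∫[ c ∈ μ ] indicator (φ σ c)) ≡ q) (lam : ℚ) (0≤lam : 0ℚ ≤ lam) where

  open ℚ.≤-Reasoning

  -- Markov's inequality for the exponential moment. The sum over assignments is written as 2ⁿ times
  -- the average over the cube, which exceeds its value at the offending σ.
  union-bound : ∀ t h (bad : Vec C t → ℚ) → (∀ cs → 0ℚ ≤ bad cs) →
    (∀ cs → bad cs ≡ 0ℚ ⊎ (bad cs ≤ 1ℚ × ∃ λ σ → h ℕ.≤ count (φ σ) (Vec.toList cs))) →
    ∫ (pow μ t) bad * (1ℚ + lam) ^ h ≤ 2ℚ ^ n * (1ℚ + lam * q) ^ t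
  union-bound t h bad 0≤bad large = begin
    ∫ (pow μ t) bad * (1ℚ + lam) ^ h
      ≡⟨ ∫-*ʳ (pow μ t) bad ((1ℚ + lam) ^ h) ⟨
    (∫[ cs ∈ pow μ t ] bad cs * (1ℚ + lam) ^ h)
      ≤⟨ ∫-mono (pow μ t) (λ cs → each cs (large cs)) ⟩
    (∫[ cs ∈ pow μ t ] 2ℚ ^ n * (∫[ σ ∈ cube n ] (1ℚ + lam) ^ count (φ σ) (Vec.toList cs)))
      ≡⟨ trans (∫-* (pow μ t) (2ℚ ^ n) _) (cong (2ℚ ^ n *_) (∫-swap (pow μ t) (cube n) _)) ⟩
    2ℚ ^ n * (∫[ σ ∈ cube n ] ∫[ cs ∈ pow μ t ] (1ℚ + lam) ^ count (φ σ) (Vec.toList cs))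
      ≡⟨ cong (2ℚ ^ n *_) (trans (∫-cong (cube n) (λ σ → exponential-moment μ μ₁ (φ σ) q (∫φ σ) lam t))
           (∫-const (cube n) (cube-isProbability n) _)) ⟩
    2ℚ ^ n * (1ℚ + lam * q) ^ t ∎
    where
    0≤1+lam = +-nonneg 0≤1 0≤lam
    each : ∀ cs → bad cs ≡ 0ℚ ⊎ (bad cs ≤ 1ℚ × ∃ λ σ → h ℕ.≤ count (φ σ) (Vec.toList cs)) →
      bad cs * (1ℚ + lam) ^ h ≤ 2ℚ ^ n * (∫[ σ ∈ cube n ] (1ℚ + lam) ^ count (φ σ) (Vec.toList cs))
    each cs (inj₁ bad≡0) = begin
      bad cs * (1ℚ + lam) ^ h
        ≡⟨ trans (cong (_* (1ℚ + lam) ^ h) bad≡0) (ℚ.*-zeroˡ ((1ℚ + lam) ^ h)) ⟩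
      0ℚ
        ≤⟨ *-nonneg (^-nonneg n (ℚ.nonNegative⁻¹ 2ℚ)) (∫-nonneg (cube n) (λ σ → ^-nonneg (count (φ σ) (Vec.toList cs)) 0≤1+lam)) ⟩
      2ℚ ^ n * (∫[ σ ∈ cube n ] (1ℚ + lam) ^ count (φ σ) (Vec.toList cs)) ∎
    each cs (inj₂ (bad≤1 , σ , h≤)) = begin
      bad cs * (1ℚ + lam) ^ h
        ≤⟨ *-monoʳ-≤ _ (^-nonneg h 0≤1+lam) bad≤1 ⟩
      1ℚ * (1ℚ + lam) ^ h
        ≡⟨ ℚ.*-identityˡ _ ⟩
      (1ℚ + lam) ^ h
        ≤⟨ ^-monoʳ-≤ (≤-by lam 0≤lam refl) h≤ ⟩
      (1ℚ + lam) ^ count (φ σ) (Vec.toList cs)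
        ≤⟨ point≤∫ n (λ σ → (1ℚ + lam) ^ count (φ σ) (Vec.toList cs)) (λ σ → ^-nonneg (count (φ σ) (Vec.toList cs)) 0≤1+lam) σ ⟩
      2ℚ ^ n * (∫[ σ ∈ cube n ] (1ℚ + lam) ^ count (φ σ) (Vec.toList cs)) ∎

-- Cofinite statements

-- For each error, a real inequality says that a rational one holds eventually. Finitely many of
-- them then hold at a common index, where rational arithmetic takes over.
Eventually : (ℕ → Set) → Set
Eventually P = ∃ λ M → ∀ m → M ℕ.≤ m → P m

eventually-map : ∀ {P Q : ℕ → Set} → (∀ m → P m → Q m) → Eventually P → Eventually Q
eventually-map P⇒Q (M , p) = M , λ m M≤m → P⇒Q m (p m M≤m)

eventually-× : ∀ {P Q : ℕ → Set} → Eventually P → Eventually Q → Eventually (λ m → P m × Q m)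
eventually-× (M , p) (N , q) = M ℕ.⊔ N , λ m ≤m →
  p m (ℕ.m⊔n≤o⇒m≤o M N ≤m) , q m (ℕ.m⊔n≤o⇒n≤o M N ≤m)

-- Finiteness in the form in which it is used: thresholds that depend on an element have a common
-- bound.
Uniform : Set → Set₁
Uniform A = ∀ (P : A → ℕ → Set) → (∀ a → Eventually (P a)) → Eventually (λ m → ∀ a → P a m)

uniform-Bool : Uniform Bool
uniform-Bool P p = eventually-map (λ { m (f , t) false → f ; m (f , t) true → t }) (eventually-× (p false) (p true))

uniform-Sign : Uniform Sign
uniform-Sign P p = eventually-map (λ { m (f , t) Sign.- → f ; m (f , t) Sign.+ → t }) (eventually-× (p Sign.-) (p Sign.+))

uniform-Fin : ∀ n → Uniform (Fin n)
uniform-Fin zero    P p = 0 , λ _ _ ()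
uniform-Fin (suc n) P p = eventually-map (λ { m (p₀ , ps) zero → p₀ ; m (p₀ , ps) (suc i) → ps i })
  (eventually-× (p zero) (uniform-Fin n (P ∘ suc) (p ∘ suc)))

uniform-× : Uniform A → Uniform B → Uniform (A × B)
uniform-× uA uB P p = eventually-map (λ m h (a , b) → h a b)
  (uA (λ a m → ∀ b → P (a , b) m) (λ a → uB (λ b → P (a , b)) (λ b → p (a , b))))

uniform-Vec : Uniform A → ∀ n → Uniform (Vec A n)
uniform-Vec uA zero    P p = eventually-map (λ { m h [] → h }) (p [])
uniform-Vec uA (suc n) P p = eventually-map (λ { m h (a ∷ v) → h a v })
  (uA (λ a m → ∀ v → P (a ∷ v) m) (λ a → uniform-Vec uA n (λ v → P (a ∷ v)) (λ v → p (a ∷ v))))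

-- Real inequalities

halves-of : ∀ {ε} → 0ℚ < ε → 0ℚ < ½ * ε
halves-of = *-pos (ℚ.positive⁻¹ ½)

half+half≡ : ∀ ε → ½ * ε + ½ * ε ≡ ε
half+half≡ = solve-∀ ℚ-ring

≤ℝ-trans : ∀ {x y z} → x ≤ℝ y → y ≤ℝ z → x ≤ℝ z
≤ℝ-trans {x} {y} {z} x≤y y≤z ε 0<ε =
  eventually-map (λ m (p , q) → begin
    seq x m                           ≤⟨ p ⟩
    seq y m + ½ * ε                   ≤⟨ ℚ.+-monoˡ-≤ (½ * ε) q ⟩
    (seq z m + ½ * ε) + ½ * ε         ≡⟨ ℚ.+-assoc (seq z m) (½ * ε) (½ * ε) ⟩
    seq z m + (½ * ε + ½ * ε)         ≡⟨ cong (seq z m +_) (half+half≡ ε) ⟩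
    seq z m + ε                       ∎)
  (eventually-× (x≤y (½ * ε) (halves-of 0<ε)) (y≤z (½ * ε) (halves-of 0<ε)))
  where open ℚ.≤-Reasoning

+ℝ-mono-≤ : ∀ {x y u v} → x ≤ℝ y → u ≤ℝ v → x +ℝ u ≤ℝ y +ℝ v
+ℝ-mono-≤ {x} {y} {u} {v} x≤y u≤v ε 0<ε =
  eventually-map (λ m (p , q) → begin
    seq x m + seq u m                          ≤⟨ ℚ.+-mono-≤ p q ⟩
    (seq y m + ½ * ε) + (seq v m + ½ * ε)      ≡⟨ regroup (seq y m) (seq v m) ε ⟩
    (seq y m + seq v m) + ε                    ∎)
  (eventually-× (x≤y (½ * ε) (halves-of 0<ε)) (u≤v (½ * ε) (halves-of 0<ε)))
  where
  open ℚ.≤-Reasoning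
  regroup : ∀ y v ε → (y + ½ * ε) + (v + ½ * ε) ≡ (y + v) + ε
  regroup = solve-∀ ℚ-ring

∑ℚ : List A → (A → ℚ) → ℚ
∑ℚ xs g = List.foldr (λ a r → g a + r) 0ℚ xs

seq-∑ : ∀ (xs : List A) g m → seq (∑ xs g) m ≡ ∑ℚ xs (λ a → seq (g a) m)
seq-∑ []       g m = refl
seq-∑ (x ∷ xs) g m = cong (seq (g x) m +_) (seq-∑ xs g m)

-- Rational approximation of a one-wise independent distribution

listed : List A → Measure A
listed []       = measure [] []
listed (x ∷ xs) = dirac x ⊕ listed xs

∫-listed : ∀ (xs : List A) g → ∫ (listed xs) g ≡ ∑ℚ xs g
∫-listed []       g = refl
∫-listed (x ∷ xs) g = trans (∫-⊕ (dirac x) (listed xs) g) (cong₂ _+_ (∫-dirac x g) (∫-listed xs g))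

∣-∣≤ : ∀ {p q ε} → p ≤ q + ε → q ≤ p + ε → ∣ p - q ∣ ≤ ε
∣-∣≤ {p} {q} {ε} p≤ q≤ with ℚ.∣p∣≡p∨∣p∣≡-p (p - q)
... | inj₁ eq = subst (_≤ ε) (sym eq) (≤-by ((q + ε) - p) (0≤q-p p≤) (identity p q ε))
  where
  identity : ∀ p q ε → ε ≡ (p - q) + ((q + ε) - p)
  identity = solve-∀ ℚ-ring
... | inj₂ eq = subst (_≤ ε) (sym eq) (≤-by ((p + ε) - q) (0≤q-p q≤) (identity p q ε))
  where
  identity : ∀ p q ε → ε ≡ - (p - q) + ((p + ε) - q)
  identity = solve-∀ ℚ-ring

record Approximation {k : ℕ} (f : Predicate k) (x : ℚ) : Set where
  field
    D             : Measure (Vec Sign k)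
    isProbability : IsProbability D
    -- Stated through integrals, because the measure constructed below keeps vectors outside f⁻¹(1)
    -- as atoms of weight 0.
    support       : ∀ u → (∀ a → f a ≡ true → u a ≡ 0ℚ) → ∫ D u ≡ 0ℚ
    mean          : ∀ i → (∫[ a ∈ D ] sgn (Vec.lookup a i)) * (∫[ a ∈ D ] sgn (Vec.lookup a i)) ≤ x

module _ {k : ℕ} {f : Predicate k} (ind : SupportsOneWiseIndependence f) where

  private
    module I = SupportsOneWiseIndependence ind
    V = listed (signVectors k)
    total = ∫[ _ ∈ V ] 1ℚ
    0≤total : 0ℚ ≤ total
    0≤total = ∫-nonneg V (λ _ → 0≤1)

  module _ (x : ℚ) (0<x : 0ℚ < x) (x≤1 : x ≤ 1ℚ) (ε : ℚ) (0<ε : 0ℚ < ε)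
           (small : (1ℚ + total) * ε ≡ ½ * x) (m : ℕ)
           (nonneg-at : ∀ a → 0ℚ ≤ seq (I.D a) m + ε)
           (support-at : ∀ a → f a ≡ false → seq (I.D a) m ≤ 0ℚ + ε)
           (total≤ : seq (∑ (signVectors k) I.D) m ≤ 1ℚ + ε)
           (total≥ : 1ℚ ≤ seq (∑ (signVectors k) I.D) m + ε)
           (mean≤ : ∀ i → seq (∑ (signVectors k) (λ a → I.D a *ℝ signℝ (Vec.lookup a i))) m ≤ 0ℚ + ε)
           (mean≥ : ∀ i → 0ℚ ≤ seq (∑ (signVectors k) (λ a → I.D a *ℝ signℝ (Vec.lookup a i))) m + ε) where

    private
      open ℚ.≤-Reasoning
      0≤ε = ℚ.<⇒≤ 0<ε
      d₀ d : Vec Sign k → ℚ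
      d₀ a = seq (I.D a) m
      -- Values outside f⁻¹(1) are erased and negative ones clipped; either change is at most ε at
      -- the chosen index.
      d a = if f a then 0ℚ ⊔ d₀ a else 0ℚ

      0≤d : ∀ a → 0ℚ ≤ d a
      0≤d a with f a
      ... | true  = ℚ.p≤p⊔q 0ℚ (d₀ a)
      ... | false = ℚ.≤-refl

      close : ∀ a → ∣ d a - d₀ a ∣ ≤ ε
      close a with f a in eq
      ... | true  = ∣-∣≤ {0ℚ ⊔ d₀ a} {d₀ a} (ℚ.⊔-lub (nonneg-at a) (≤-by {d₀ a} ε 0≤ε refl))
                         (ℚ.≤-trans (ℚ.p≤q⊔p 0ℚ (d₀ a)) (≤-by {0ℚ ⊔ d₀ a} ε 0≤ε refl))
      ... | false = ∣-∣≤ {0ℚ} {d₀ a} (nonneg-at a) (support-at a eq)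

      sgn≡ : ∀ s → seq (signℝ s) m ≡ sgn s
      sgn≡ Sign.- = refl
      sgn≡ Sign.+ = refl

      -- Replacing d₀ by d costs ε at each of the `total` sign vectors, and the given estimate costs
      -- one more ε; `small` makes the sum ½ x.
      near : ∀ (u : Vec Sign k → ℚ) → (∀ a → ∣ u a ∣ ≡ 1ℚ) → ∀ {t} → ∣ (∫[ a ∈ V ] d₀ a * u a) - t ∣ ≤ ε →
        ∣ (∫[ a ∈ V ] d a * u a) - t ∣ ≤ ½ * x
      near u ∣u∣≡1 {t} h = begin
        ∣ (∫[ a ∈ V ] d a * u a) - t ∣
          ≡⟨ cong (λ s → ∣ s - t ∣) (trans (∫-cong V (λ a → split (d a) (d₀ a) (u a))) (∫-+ V _ _)) ⟩
        ∣ ((∫[ a ∈ V ] (d a - d₀ a) * u a) + (∫[ a ∈ V ] d₀ a * u a)) - t ∣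
          ≡⟨ cong ∣_∣ (ℚ.+-assoc (∫[ a ∈ V ] (d a - d₀ a) * u a) (∫[ a ∈ V ] d₀ a * u a) (- t)) ⟩
        ∣ (∫[ a ∈ V ] (d a - d₀ a) * u a) + ((∫[ a ∈ V ] d₀ a * u a) - t) ∣
          ≤⟨ ℚ.∣p+q∣≤∣p∣+∣q∣ (∫[ a ∈ V ] (d a - d₀ a) * u a) _ ⟩
        ∣ (∫[ a ∈ V ] (d a - d₀ a) * u a) ∣ + ∣ (∫[ a ∈ V ] d₀ a * u a) - t ∣
          ≤⟨ ℚ.+-mono-≤ (∣∫∣≤ V _ each) h ⟩
        (∫[ a ∈ V ] ε * 1ℚ) + ε
          ≡⟨ cong (_+ ε) (∫-* V ε (λ _ → 1ℚ)) ⟩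
        ε * total + ε
          ≡⟨ trans (collect ε total) small ⟩
        ½ * x ∎
        where
        split : ∀ d e u → d * u ≡ (d - e) * u + e * u
        split = solve-∀ ℚ-ring
        collect : ∀ e t → e * t + e ≡ (1ℚ + t) * e
        collect = solve-∀ ℚ-ring
        each : ∀ a → ∣ (d a - d₀ a) * u a ∣ ≤ ε * 1ℚ
        each a = subst (_≤ ε * 1ℚ) (sym (trans (ℚ.∣p*q∣≡∣p∣*∣q∣ (d a - d₀ a) (u a)) (cong (∣ d a - d₀ a ∣ *_) (∣u∣≡1 a))))
          (*-monoʳ-≤ 1ℚ 0≤1 (close a))

      Z = ∫[ a ∈ V ] d a * 1ℚ

      Z-near : ∣ Z - 1ℚ ∣ ≤ ½ * x
      Z-near = near (λ _ → 1ℚ) (λ _ → refl) {1ℚ} (∣-∣≤ (subst (_≤ 1ℚ + ε) eq total≤) (subst (λ t → 1ℚ ≤ t + ε) eq total≥))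
        where
        eq : seq (∑ (signVectors k) I.D) m ≡ (∫[ a ∈ V ] d₀ a * 1ℚ)
        eq = trans (seq-∑ (signVectors k) I.D m) (trans (sym (∫-listed (signVectors k) d₀)) (∫-cong V (λ a → sym (ℚ.*-identityʳ (d₀ a)))))

      mean-near : ∀ i → ∣ (∫[ a ∈ V ] d a * sgn (Vec.lookup a i)) - 0ℚ ∣ ≤ ½ * x
      mean-near i = near (λ a → sgn (Vec.lookup a i)) (λ a → ∣sgn∣ (Vec.lookup a i)) {0ℚ}
        (∣-∣≤ (subst (_≤ 0ℚ + ε) eq (mean≤ i)) (subst (λ t → 0ℚ ≤ t + ε) eq (mean≥ i)))
        where
        eq : seq (∑ (signVectors k) (λ a → I.D a *ℝ signℝ (Vec.lookup a i))) m ≡ (∫[ a ∈ V ] d₀ a * sgn (Vec.lookup a i))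
        eq = trans (seq-∑ (signVectors k) _ m) (trans (sym (∫-listed (signVectors k) _))
          (∫-cong V (λ a → cong (d₀ a *_) (sgn≡ (Vec.lookup a i)))))

      ½≤Z : ½ ≤ Z
      ½≤Z = ≤-by ((½ * x - ∣ Z - 1ℚ ∣) + (½ * (1ℚ - x) + (∣ Z - 1ℚ ∣ + (Z - 1ℚ))))
        (+-nonneg (0≤q-p Z-near) (+-nonneg (*-nonneg (ℚ.nonNegative⁻¹ ½) (0≤q-p x≤1)) abs))
        (identity x Z ∣ Z - 1ℚ ∣)
        where
        abs : 0ℚ ≤ ∣ Z - 1ℚ ∣ + (Z - 1ℚ)
        abs = subst (0ℚ ≤_) (neg-sub ∣ Z - 1ℚ ∣ (Z - 1ℚ))
          (0≤q-p (subst (- (Z - 1ℚ) ≤_) (ℚ.∣-p∣≡∣p∣ (Z - 1ℚ)) (p≤∣p∣ (- (Z - 1ℚ)))))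
          where
          neg-sub : ∀ a b → a - (- b) ≡ a + b
          neg-sub = solve-∀ ℚ-ring
        identity : ∀ x Z A → Z ≡ ½ + ((½ * x - A) + (½ * (1ℚ - x) + (A + (Z - 1ℚ))))
        identity = solve-∀ ℚ-ring

      r : ℚ
      r = proj₁ (reciprocal (ℚ.<-≤-trans (ℚ.positive⁻¹ ½) ½≤Z))
      0≤r : 0ℚ ≤ r
      0≤r = proj₁ (proj₂ (reciprocal (ℚ.<-≤-trans (ℚ.positive⁻¹ ½) ½≤Z)))
      rZ≡1 : r * Z ≡ 1ℚ
      rZ≡1 = proj₂ (proj₂ (reciprocal (ℚ.<-≤-trans (ℚ.positive⁻¹ ½) ½≤Z)))

      -- Normalising at most doubles the error of the means, which is why ½ x was aimed at before.
      r≤2 : r ≤ 2ℚ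
      r≤2 = ≤-by (2ℚ * (r * (Z - ½))) (*-nonneg (ℚ.nonNegative⁻¹ 2ℚ) (*-nonneg 0≤r (0≤q-p ½≤Z)))
        (trans (trans (sym (ℚ.*-identityʳ 2ℚ)) (cong (2ℚ *_) (sym rZ≡1))) (identity r Z))
        where
        identity : ∀ r Z → (1ℚ + 1ℚ) * (r * Z) ≡ r + (1ℚ + 1ℚ) * (r * (Z - ½))
        identity = solve-∀ ℚ-ring

      E : Measure (Vec Sign k)
      E = V >>= λ a → scale (r * d a) (*-nonneg 0≤r (0≤d a)) (dirac a)

      ∫-E : ∀ u → ∫ E u ≡ r * (∫[ a ∈ V ] d a * u a)
      ∫-E u = trans (∫->>= V _ u) (trans
        (∫-cong V (λ a → trans (∫-scale (r * d a) (*-nonneg 0≤r (0≤d a)) (dirac a) u) (trans (cong (r * d a *_) (∫-dirac a u)) (ℚ.*-assoc r (d a) (u a)))))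
        (∫-* V r _))

    approximation-at : Approximation f x
    approximation-at = record
      { D             = E
      ; isProbability = trans (∫-E (λ _ → 1ℚ)) rZ≡1
      ; support       = λ u u≡0 → trans (∫-E u) (trans (cong (r *_) (trans (∫-cong V (λ a → vanish u u≡0 a)) (∫-0 V))) (ℚ.*-zeroʳ r))
      ; mean          = mean′
      }
      where
      vanish : ∀ u → (∀ a → f a ≡ true → u a ≡ 0ℚ) → ∀ a → d a * u a ≡ 0ℚ
      vanish u u≡0 a with f a in eq
      ... | true  = trans (cong ((0ℚ ⊔ d₀ a) *_) (u≡0 a eq)) (ℚ.*-zeroʳ (0ℚ ⊔ d₀ a))
      ... | false = ℚ.*-zeroˡ (u a)
      mean′ : ∀ i → (∫[ a ∈ E ] sgn (Vec.lookup a i)) * (∫[ a ∈ E ] sgn (Vec.lookup a i)) ≤ x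
      mean′ i = begin
        M * M                 ≡⟨ trans (sym (ℚ.0≤p⇒∣p∣≡p (p*p-nonneg M))) (ℚ.∣p*q∣≡∣p∣*∣q∣ M M) ⟩
        ∣ M ∣ * ∣ M ∣         ≤⟨ *-mono-≤ (ℚ.0≤∣p∣ M) (ℚ.<⇒≤ 0<x) ∣M∣≤x ∣M∣≤x ⟩
        x * x                 ≤⟨ *-monoʳ-≤ x (ℚ.<⇒≤ 0<x) x≤1 ⟩
        1ℚ * x                ≡⟨ ℚ.*-identityˡ x ⟩
        x                     ∎
        where
        M = ∫[ a ∈ E ] sgn (Vec.lookup a i)
        W = ∫[ a ∈ V ] d a * sgn (Vec.lookup a i)
        two-halves : ∀ x → (1ℚ + 1ℚ) * (½ * x) ≡ x
        two-halves = solve-∀ ℚ-ring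
        ∣M∣≤x : ∣ M ∣ ≤ x
        ∣M∣≤x = begin
          ∣ M ∣            ≡⟨ trans (cong ∣_∣ (∫-E _)) (ℚ.∣p*q∣≡∣p∣*∣q∣ r W) ⟩
          ∣ r ∣ * ∣ W ∣    ≡⟨ cong₂ _*_ (ℚ.0≤p⇒∣p∣≡p 0≤r) (cong ∣_∣ (sym (ℚ.+-identityʳ W))) ⟩
          r * ∣ W - 0ℚ ∣   ≤⟨ *-mono-≤ 0≤r (*-nonneg (ℚ.nonNegative⁻¹ ½) (ℚ.<⇒≤ 0<x)) r≤2 (mean-near i) ⟩
          2ℚ * (½ * x)     ≡⟨ two-halves x ⟩
          x                ∎

  rational-approximation : ∀ x → 0ℚ < x → x ≤ 1ℚ → Approximation f x
  rational-approximation x 0<x x≤1 with reciprocal (ℚ.<-≤-trans (ℚ.positive⁻¹ 1ℚ) (≤-by {1ℚ} {1ℚ + total} total 0≤total refl))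
  ... | r , 0≤r , r[1+t]≡1 = build (eventually-× (uniform-Vec uniform-Sign k _ (λ a → I.D-nonneg a ε 0<ε))
          (eventually-× (uniform-Vec uniform-Sign k _ support-eventually)
          (eventually-× (eventually-× (proj₁ I.D-total ε 0<ε) (proj₂ I.D-total ε 0<ε))
          (eventually-× (uniform-Fin k _ (λ i → proj₁ (I.D-mean i) ε 0<ε)) (uniform-Fin k _ (λ i → proj₂ (I.D-mean i) ε 0<ε))))))
    where
    ε = r * (½ * x)
    0<r : 0ℚ < r
    0<r = 0≤∧≢0⇒> 0≤r (λ { refl → contradiction (trans (sym (ℚ.*-zeroˡ (1ℚ + total))) r[1+t]≡1) λ () })
    0<ε : 0ℚ < ε
    0<ε = *-pos 0<r (halves-of 0<x)
    small : (1ℚ + total) * ε ≡ ½ * x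
    small = trans (regroup (1ℚ + total) r (½ * x)) (trans (cong (_* (½ * x)) r[1+t]≡1) (ℚ.*-identityˡ (½ * x)))
      where
      regroup : ∀ t r h → t * (r * h) ≡ (r * t) * h
      regroup = solve-∀ ℚ-ring
    support-eventually : ∀ a → Eventually (λ m → f a ≡ false → seq (I.D a) m ≤ 0ℚ + ε)
    support-eventually a with f a in eq
    ... | true  = 0 , λ _ _ ()
    ... | false = eventually-map (λ m h _ → h) (proj₁ (I.D-support a eq) ε 0<ε)
    build : Eventually (λ m → (∀ a → 0ℚ ≤ seq (I.D a) m + ε) × (∀ a → f a ≡ false → seq (I.D a) m ≤ 0ℚ + ε) ×
      (seq (∑ (signVectors k) I.D) m ≤ 1ℚ + ε × 1ℚ ≤ seq (∑ (signVectors k) I.D) m + ε) ×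
      ((∀ i → seq (∑ (signVectors k) (λ a → I.D a *ℝ signℝ (Vec.lookup a i))) m ≤ 0ℚ + ε) ×
       (∀ i → 0ℚ ≤ seq (∑ (signVectors k) (λ a → I.D a *ℝ signℝ (Vec.lookup a i))) m + ε))) → Approximation f x
    build (M , h) with h M ℕ.≤-refl
    ... | nonneg-at , support-at , (total≤ , total≥) , (mean≤ , mean≥) =
      approximation-at x 0<x x≤1 ε 0<ε small M nonneg-at support-at total≤ total≥ mean≤ mean≥

-- Memory states

bools : Measure Bool
bools = measure ((1ℚ , false) ∷ (1ℚ , true) ∷ []) (0≤1 ∷ 0≤1 ∷ [])

states : ∀ s → Measure (Vec Bool s)
states = pow bools

total-states : ∀ s → (∫[ _ ∈ states s ] 1ℚ) ≡ 2ℚ ^ s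
total-states = ∫-1-pow bools

δ-Bool : Bool → Bool → ℚ
δ-Bool false false = 1ℚ
δ-Bool false true  = 0ℚ
δ-Bool true  false = 0ℚ
δ-Bool true  true  = 1ℚ

δ-state : ∀ {s} → Vec Bool s → Vec Bool s → ℚ
δ-state []      []      = 1ℚ
δ-state (b ∷ z) (c ∷ y) = δ-Bool b c * δ-state z y

δ-Bool-bounds : ∀ b c → 0ℚ ≤ δ-Bool b c × δ-Bool b c ≤ 1ℚ
δ-Bool-bounds false false = 0≤1 , ℚ.≤-refl
δ-Bool-bounds false true  = ℚ.≤-refl , 0≤1
δ-Bool-bounds true  false = ℚ.≤-refl , 0≤1
δ-Bool-bounds true  true  = 0≤1 , ℚ.≤-refl

0≤δ-state : ∀ {s} (z y : Vec Bool s) → 0ℚ ≤ δ-state z y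
0≤δ-state []      []      = 0≤1
0≤δ-state (b ∷ z) (c ∷ y) = *-nonneg (proj₁ (δ-Bool-bounds b c)) (0≤δ-state z y)

δ-state≤1 : ∀ {s} (z y : Vec Bool s) → δ-state z y ≤ 1ℚ
δ-state≤1 []      []      = ℚ.≤-refl
δ-state≤1 (b ∷ z) (c ∷ y) = *-mono-≤ (proj₁ (δ-Bool-bounds b c)) 0≤1 (proj₂ (δ-Bool-bounds b c)) (δ-state≤1 z y)

∫-δ-state : ∀ {s} (z : Vec Bool s) u → (∫[ y ∈ states s ] δ-state z y * u y) ≡ u z
∫-δ-state []      u = trans (∫-dirac {A = Vec Bool zero} [] (λ y → δ-state [] y * u y)) (ℚ.*-identityˡ (u []))
∫-δ-state {suc s} (b ∷ z) u = begin
  (∫[ y ∈ states (suc s) ] δ-state (b ∷ z) y * u y)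
    ≡⟨ ∫-pow bools s _ ⟩
  (∫[ c ∈ bools ] ∫[ y ∈ states s ] δ-Bool b c * δ-state z y * u (c ∷ y))
    ≡⟨ ∫-cong bools (λ c → trans (∫-cong (states s) (λ y → ℚ.*-assoc (δ-Bool b c) (δ-state z y) (u (c ∷ y))))
         (trans (∫-* (states s) (δ-Bool b c) _) (cong (δ-Bool b c *_) (∫-δ-state z (λ y → u (c ∷ y)))))) ⟩
  (∫[ c ∈ bools ] δ-Bool b c * u (c ∷ z))
    ≡⟨ select b ⟩
  u (b ∷ z) ∎
  where
  open ≡-Reasoning
  selectˡ : ∀ p q → 1ℚ * (1ℚ * p) + (1ℚ * (0ℚ * q) + 0ℚ) ≡ p
  selectˡ = solve-∀ ℚ-ring
  selectʳ : ∀ p q → 1ℚ * (0ℚ * p) + (1ℚ * (1ℚ * q) + 0ℚ) ≡ q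
  selectʳ = solve-∀ ℚ-ring
  select : ∀ b → (∫[ c ∈ bools ] δ-Bool b c * u (c ∷ z)) ≡ u (b ∷ z)
  select false = selectˡ (u (false ∷ z)) (u (true ∷ z))
  select true  = selectʳ (u (false ∷ z)) (u (true ∷ z))

-- Averaging over a randomized algorithm

module _ {k n s : ℕ} (𝒜 : RandomizedAlgorithm k n s) where

  open RandomizedAlgorithm 𝒜 hiding (Pr[outputs-1])

  module _ {I : Set} (inst : I → Instance k n) where

    combination : List (ℚ × I) → DeterministicAlgorithm k n s → ℝ
    combination xs A = ∑ xs (λ (c , i) → fromℚ c *ℝ run A (List⁺.toList (inst i)))

    combination-rv : ∀ xs → RandomVariable (combination xs)
    combination-rv []             = rv-const 0ℝ
    combination-rv ((c , i) ∷ xs) = rv-+ (rv-* (fromℚ c) (run-rv (List⁺.toList (inst i)))) (combination-rv xs)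

    combination-𝔼 : ∀ xs → ∑ xs (λ (c , i) → fromℚ c *ℝ Pr[outputs-1] 𝒜 (inst i)) ≤ℝ 𝔼 (combination-rv xs)
    combination-𝔼 []             = proj₂ (𝔼-const 0ℝ)
    combination-𝔼 ((c , i) ∷ xs) = ≤ℝ-trans
      {fromℚ c *ℝ Pr[outputs-1] 𝒜 (inst i) +ℝ ∑ xs (λ (c , i) → fromℚ c *ℝ Pr[outputs-1] 𝒜 (inst i))}
      {𝔼 (rv-* (fromℚ c) (run-rv (List⁺.toList (inst i)))) +ℝ 𝔼 (combination-rv xs)}
      {𝔼 (combination-rv ((c , i) ∷ xs))}
      (+ℝ-mono-≤ {fromℚ c *ℝ Pr[outputs-1] 𝒜 (inst i)} {𝔼 (rv-* (fromℚ c) (run-rv (List⁺.toList (inst i))))}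
                 {∑ xs (λ (c , i) → fromℚ c *ℝ Pr[outputs-1] 𝒜 (inst i))} {𝔼 (combination-rv xs)}
        (proj₂ (𝔼-* (fromℚ c) (run-rv (List⁺.toList (inst i))))) (combination-𝔼 xs))
      (proj₂ (𝔼-+ (rv-* (fromℚ c) (run-rv (List⁺.toList (inst i)))) (combination-rv xs)))

    -- The easy half of Yao's principle: a linear combination of acceptance probabilities is the
    -- expectation of the same combination of deterministic outputs. Coefficients may be negative,
    -- so the difference between planted and random streams is covered.
    averaged : ∀ xs b → (∀ A → combination xs A ≤ℝ fromℚ b) →
      ∑ xs (λ (c , i) → fromℚ c *ℝ Pr[outputs-1] 𝒜 (inst i)) ≤ℝ fromℚ b
    averaged xs b h = ≤ℝ-trans
      {∑ xs (λ (c , i) → fromℚ c *ℝ Pr[outputs-1] 𝒜 (inst i))} {𝔼 (combination-rv xs)} {fromℚ b}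
      (combination-𝔼 xs)
      (≤ℝ-trans {𝔼 (combination-rv xs)} {𝔼 (rv-const (fromℚ b))} {fromℚ b}
        (𝔼-mono (combination-rv xs) (rv-const (fromℚ b)) h) (proj₁ (𝔼-const (fromℚ b))))

  Pr≤1 : ∀ Ψ → Pr[outputs-1] 𝒜 Ψ ≤ℝ 1ℝ
  Pr≤1 Ψ = ≤ℝ-trans {Pr[outputs-1] 𝒜 Ψ} {𝔼 (rv-const 1ℝ)} {1ℝ}
    (𝔼-mono (run-rv (List⁺.toList Ψ)) (rv-const 1ℝ) (λ A → v≤1 A _)) (proj₁ (𝔼-const 1ℝ))

-- From samples to instances

∈-signVectors : ∀ {n} (σ : Vec Sign n) → σ ∈ signVectors n
∈-signVectors []           = here refl
∈-signVectors (Sign.- ∷ σ) = ∈.∈-cartesianProductWith⁺ _∷_ {xs = Sign.- ∷ Sign.+ ∷ []} (here refl) (∈-signVectors σ)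
∈-signVectors (Sign.+ ∷ σ) = ∈.∈-cartesianProductWith⁺ _∷_ {xs = Sign.- ∷ Sign.+ ∷ []} (there (here refl)) (∈-signVectors σ)

maximum : (A → ℚ) → List A → ℚ
maximum g = List.foldr (λ a r → g a ⊔ r) 0ℚ

≤maximum : ∀ (g : A → ℚ) {a xs} → a ∈ xs → g a ≤ maximum g xs
≤maximum g {xs = x ∷ xs} (here refl) = ℚ.p≤p⊔q (g x) (maximum g xs)
≤maximum g {xs = x ∷ xs} (there a∈xs) = ℚ.≤-trans (≤maximum g a∈xs) (ℚ.p≤q⊔p (g x) (maximum g xs))

maximum-attained : ∀ (g : A → ℚ) {b} xs → 0ℚ ≤ b → ¬ maximum g xs ≤ b → ∃ λ a → b < g a
maximum-attained g []       0≤b 0≰b = contradiction 0≤b 0≰b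
maximum-attained g {b} (x ∷ xs) 0≤b max≰b with g x ℚ.≤? b
... | no gx≰b  = x , ℚ.≰⇒> gx≰b
... | yes gx≤b = maximum-attained g xs 0≤b (λ max≤b → max≰b (ℚ.⊔-lub gx≤b max≤b))

val-upper : ∀ {k n} (f : Predicate k) (Ψ : Instance k n) σ → valAt f Ψ σ ≤ val f Ψ
val-upper f Ψ σ = ≤maximum (valAt f Ψ) (∈-signVectors σ)

val-attained : ∀ {k n} (f : Predicate k) (Ψ : Instance k n) {b} → 0ℚ ≤ b → ¬ val f Ψ ≤ b → ∃ λ σ → b < valAt f Ψ σ
val-attained {n = n} f Ψ = maximum-attained (valAt f Ψ) (signVectors n)

*ι≡ι⇒≡1 : ∀ {p t} → p * ι (suc t) ≡ ι (suc t) → p ≡ 1ℚ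
*ι≡ι⇒≡1 {p} {t} eq = *-cancelʳ-≡ (0<ι t) (trans eq (sym (ℚ.*-identityˡ (ι (suc t)))))

1≤val : ∀ {k n t} (f : Predicate k) (Ψ : Instance k n) σ → valAt f Ψ σ * ι (suc t) ≡ ι (suc t) → 1ℚ ≤ val f Ψ
1≤val {t = t} f Ψ σ eq = ℚ.≤-trans (ℚ.≤-reflexive (sym (*ι≡ι⇒≡1 {t = t} eq))) (val-upper f Ψ σ)

integrate-∑ℚ : ∀ (xs : List (ℚ × A)) (c g : A → ℚ) →
  ∑ℚ (List.map (λ (w , a) → w * c a , a) xs) (λ (w , a) → w * g a) ≡ integrate xs (λ a → c a * g a)
integrate-∑ℚ []             c g = refl
integrate-∑ℚ ((w , a) ∷ xs) c g = cong₂ _+_ (ℚ.*-assoc w (c a) (g a)) (integrate-∑ℚ xs c g)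

∫-likelihood : ∀ {H C : Set} (μ : Measure C) (L : H → C → ℚ) (∫L : ∀ σ → ∫ μ (L σ) ≡ 1ℚ) σ t →
  (∫[ cs ∈ pow μ t ] likelihood L σ cs) ≡ 1ℚ
∫-likelihood {C = C} μ L ∫L σ zero    = ∫-dirac {A = Vec C zero} [] (likelihood L σ)
∫-likelihood         μ L ∫L σ (suc t) = trans (∫-pow μ t (likelihood L σ)) (trans
  (∫-cong μ (λ c → trans (∫-* (pow μ t) (L σ c) (likelihood L σ)) (trans (cong (L σ c *_) (∫-likelihood μ L ∫L σ t)) (ℚ.*-identityʳ (L σ c)))))
  (∫L σ))

-- Approximation algorithms as distinguishers

module Reduction
  {k n : ℕ} (f : Predicate k) {C : Set} (uniform-C : Uniform C)
  (encode : C → Constraint k n)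
  (μ : Measure C) (μ₁ : IsProbability μ)
  (rate : ∀ σ → (∫[ c ∈ μ ] indicator (satisfies f σ (encode c))) ≡ ρ f)
  (L : Vec Sign n → C → ℚ) (0≤L : ∀ σ c → 0ℚ ≤ L σ c) (∫L : ∀ σ → ∫ μ (L σ) ≡ 1ℚ)
  (L-degree : ∀ c → Degree≤ k (λ σ → L σ c))
  (L-support : ∀ σ c → satisfies f σ (encode c) ≡ false → L σ c ≡ 0ℚ)
  (κ : ℚ) (0≤κ : 0ℚ ≤ κ)
  (kernel : ∀ (g : C → ℚ) → (∫[ σ ∈ cube n ] (∫[ c ∈ μ ] g c * (L σ c - 1ℚ)) * (∫[ c ∈ μ ] g c * (L σ c - 1ℚ)))
                  ≤ κ * (∫[ c ∈ μ ] g c * g c))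
  where

  private
    Ω = cube n

  instance-of : ∀ {t} → Vec C (suc t) → Instance k n
  instance-of (c ∷ cs) = encode c List⁺.∷ List.map encode (Vec.toList cs)

  toList-instance : ∀ {t} (cs : Vec C (suc t)) → List⁺.toList (instance-of cs) ≡ List.map encode (Vec.toList cs)
  toList-instance (c ∷ cs) = refl

  length-instance : ∀ {t} (cs : Vec C (suc t)) → List⁺.length (instance-of cs) ≡ suc t
  length-instance (c ∷ cs) = cong suc (trans (List.length-map encode (Vec.toList cs)) (Vec.length-toList cs))

  satisfied : Vec Sign (n) → ∀ {t} → Vec C t → ℕ
  satisfied σ cs = count (λ c → satisfies f σ (encode c)) (Vec.toList cs)

  valAt-instance : ∀ {t} (cs : Vec C (suc t)) σ → valAt f (instance-of cs) σ * ι (suc t) ≡ ι (satisfied σ cs)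
  valAt-instance {t} cs@(c ∷ cs′) σ = begin
    valAt f (instance-of cs) σ * ι (suc t)
      ≡⟨ cong (λ l → valAt f (instance-of cs) σ * ι l) (length-instance cs) ⟨
    valAt f (instance-of cs) σ * ι (suc (List.length (List.map encode (Vec.toList cs′))))
      ≡⟨ /*ι (count (satisfies f σ) (List⁺.toList (instance-of cs))) (List.length (List.map encode (Vec.toList cs′))) ⟩
    ι (count (satisfies f σ) (List.map encode (Vec.toList cs)))
      ≡⟨ count-map (satisfies f σ) encode (Vec.toList cs) ⟩
    ι (satisfied σ cs) ∎
    where open ≡-Reasoning

  likelihood-support : ∀ σ {t} (cs : Vec C t) → likelihood L σ cs ≡ 0ℚ ⊎ ι (satisfied σ cs) ≡ ι t
  likelihood-support σ []       = inj₂ refl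
  likelihood-support σ (c ∷ cs) with satisfies f σ (encode c) in eq | likelihood-support σ cs
  ... | false | _         = inj₁ (trans (cong (_* likelihood L σ cs) (L-support σ c eq)) (ℚ.*-zeroˡ (likelihood L σ cs)))
  ... | true  | inj₁ l≡0  = inj₁ (trans (cong (L σ c *_) l≡0) (ℚ.*-zeroʳ (L σ c)))
  ... | true  | inj₂ all  = inj₂ (cong (1ℚ +_) all)

  planted-satisfiable : ∀ {t} (cs : Vec C (suc t)) → ¬ 1ℚ ≤ val f (instance-of cs) → ∀ σ → likelihood L σ cs ≡ 0ℚ
  planted-satisfiable {t} cs val<1 σ = resolve (likelihood-support σ cs)
    where
    resolve : likelihood L σ cs ≡ 0ℚ ⊎ ι (satisfied σ cs) ≡ ι (suc t) → likelihood L σ cs ≡ 0ℚ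
    resolve (inj₁ l≡0) = l≡0
    resolve (inj₂ all) = contradiction (1≤val {t = t} f (instance-of cs) σ (trans (valAt-instance cs σ) all)) val<1

  module _ {s : ℕ} (A : DeterministicAlgorithm k (n) s) (t p : ℕ) where

    open ℚ.≤-Reasoning

    private
      T = suc t
      z₀ = Vec.replicate s false

    open Evolution μ μ₁ L 0≤L ∫L k L-degree κ 0≤κ kernel (states s) δ-state 0≤δ-state δ-state≤1 ∫-δ-state
      (λ z c → S A z (encode c)) z₀ p

    -- The density of the planted stream minus that of the random one. Its integral is 0, so test
    -- functions may be shifted by constants.
    weight : Vec C T → ℚ
    weight cs = (∫[ σ ∈ Ω ] likelihood L σ cs) - 1ℚ

    run-instance : ∀ cs → run A (List⁺.toList (instance-of {t} cs)) ≡ v A (final z₀ cs)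
    run-instance cs = cong (v A) (trans (cong (List.foldl (S A) z₀) (toList-instance cs)) (foldl-map z₀ (Vec.toList cs)))
      where
      foldl-map : ∀ z cs → List.foldl (S A) z (List.map encode cs) ≡ List.foldl (λ z c → S A z (encode c)) z cs
      foldl-map z []       = refl
      foldl-map z (c ∷ cs) = foldl-map (S A z (encode c)) cs

    ∫-weight : ∀ u → (∫[ cs ∈ pow μ T ] weight cs * u (final z₀ cs)) ≡ (∫[ σ ∈ Ω ] planted T σ u z₀) - random T u z₀
    ∫-weight u = begin-equality
      (∫[ cs ∈ pow μ T ] weight cs * u (final z₀ cs))
        ≡⟨ ∫-cong (pow μ T) (λ cs → trans (split (∫[ σ ∈ Ω ] likelihood L σ cs) (u (final z₀ cs))) (cong (λ l → l - u (final z₀ cs)) (sym (∫-*ʳ Ω (λ σ → likelihood L σ cs) (u (final z₀ cs)))))) ⟩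
      (∫[ cs ∈ pow μ T ] (∫[ σ ∈ Ω ] likelihood L σ cs * u (final z₀ cs)) - u (final z₀ cs))
        ≡⟨ trans (∫-- (pow μ T) _ _) (cong (λ l → l - random T u z₀) (∫-swap (pow μ T) Ω _)) ⟩
      (∫[ σ ∈ Ω ] planted T σ u z₀) - random T u z₀ ∎
      where
      split : ∀ l u → (l - 1ℚ) * u ≡ l * u - u
      split = solve-∀ ℚ-ring

    module _
      (bias≤ : (1ℚ + 2ℚ * (3ℚ ^ k) ^ p * κ) ^ T ≤ 1ℚ + ℤ.+ 1 / 100)
      (loss≤ : ι T * ((∫[ _ ∈ states s ] 1ℚ) * squares p ½) ≤ ℤ.+ 1 / 100) where

      -- At a fixed index of the Cauchy sequences an output is only known to lie in [-ε, 1 + ε]. It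
      -- is shifted by ε, which does not change the integral against `weight`, and divided by 1 +
      -- 2ε; this turns 1/4 into (1 + 2ε)/4 ≤ 1/4 + ε.
      distinguishing≤ : ∀ ε → 0ℚ ≤ ε → ∀ u → (∀ z → 0ℚ ≤ u z + ε) → (∀ z → u z ≤ 1ℚ + ε) →
        (∫[ cs ∈ pow μ T ] weight cs * u (final z₀ cs)) ≤ ℤ.+ 1 / 4 + ε
      distinguishing≤ ε 0≤ε u 0≤u u≤1 = rescaled
        (reciprocal (ℚ.<-≤-trans (ℚ.positive⁻¹ 1ℚ) (≤-by {1ℚ} {1ℚ + (ε + ε)} (ε + ε) (+-nonneg 0≤ε 0≤ε) refl)))
        where
        rescaled : (∃ λ q → 0ℚ ≤ q × q * (1ℚ + (ε + ε)) ≡ 1ℚ) →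
          (∫[ cs ∈ pow μ T ] weight cs * u (final z₀ cs)) ≤ ℤ.+ 1 / 4 + ε
        rescaled (q , 0≤q , q[1+2ε]≡1) = begin
          W u
            ≡⟨ rescale ⟩
          (1ℚ + (ε + ε)) * W u′
            ≤⟨ *-monoˡ-≤ (1ℚ + (ε + ε)) (+-nonneg 0≤1 (+-nonneg 0≤ε 0≤ε)) W≤ ⟩
          (1ℚ + (ε + ε)) * (ℤ.+ 1 / 4)
            ≤⟨ ≤-by ((ℤ.+ 1 / 2) * ε) (*-nonneg (ℚ.nonNegative⁻¹ (ℤ.+ 1 / 2)) 0≤ε) (quarter ε) ⟩
          ℤ.+ 1 / 4 + ε ∎
          where
          W : (Vec Bool s → ℚ) → ℚ
          W u = ∫[ cs ∈ pow μ T ] weight cs * u (final z₀ cs)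
          u′ : Vec Bool s → ℚ
          u′ z = q * (u z + ε)
          quarter : ∀ ε → ℤ.+ 1 / 4 + ε ≡ (1ℚ + (ε + ε)) * (ℤ.+ 1 / 4) + (ℤ.+ 1 / 2) * ε
          quarter = solve-∀ ℚ-ring
          W≤ : W u′ ≤ ℤ.+ 1 / 4
          W≤ = begin
            W u′
              ≡⟨ ∫-weight u′ ⟩
            (∫[ σ ∈ Ω ] planted T σ u′ z₀) - random T u′ z₀
              ≤⟨ ℚ.+-monoˡ-≤ (- random T u′ z₀) (indistinguishable T bias≤ loss≤ u′ (λ z → *-nonneg 0≤q (0≤u z)) u′≤1) ⟩
            (random T u′ z₀ + ℤ.+ 1 / 4) - random T u′ z₀
              ≡⟨ cancel (random T u′ z₀) (ℤ.+ 1 / 4) ⟩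
            ℤ.+ 1 / 4 ∎
            where
            cancel : ∀ a b → (a + b) - a ≡ b
            cancel = solve-∀ ℚ-ring
            u′≤1 : ∀ z → u′ z ≤ 1ℚ
            u′≤1 z = begin
              q * (u z + ε)            ≤⟨ *-monoˡ-≤ q 0≤q (ℚ.+-monoˡ-≤ ε (u≤1 z)) ⟩
              q * ((1ℚ + ε) + ε)       ≡⟨ trans (cong (q *_) (ℚ.+-assoc 1ℚ ε ε)) q[1+2ε]≡1 ⟩
              1ℚ                       ∎
          ∫weight≡0 : ∫ (pow μ T) weight ≡ 0ℚ
          ∫weight≡0 = trans (∫-- (pow μ T) _ (λ _ → 1ℚ)) (cong₂ _-_
            (trans (∫-swap (pow μ T) Ω _) (trans (∫-cong Ω (λ σ → ∫-likelihood μ L ∫L σ T)) (cube-isProbability (n))))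
            (pow-isProbability μ μ₁ T))
          unscale : ∀ w q u ε e → (1ℚ + e) * (w * (q * (u + ε))) ≡ (q * (1ℚ + e)) * (w * u + w * ε)
          unscale = solve-∀ ℚ-ring
          rescale : W u ≡ (1ℚ + (ε + ε)) * W u′
          rescale = sym (begin-equality
            (1ℚ + (ε + ε)) * W u′
              ≡⟨ ∫-* (pow μ T) (1ℚ + (ε + ε)) _ ⟨
            (∫[ cs ∈ pow μ T ] (1ℚ + (ε + ε)) * (weight cs * u′ (final z₀ cs)))
              ≡⟨ ∫-cong (pow μ T) (λ cs → trans (unscale (weight cs) q (u (final z₀ cs)) ε (ε + ε))
                   (trans (cong (_* (weight cs * u (final z₀ cs) + weight cs * ε)) q[1+2ε]≡1) (ℚ.*-identityˡ _))) ⟩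
            (∫[ cs ∈ pow μ T ] weight cs * u (final z₀ cs) + weight cs * ε)
              ≡⟨ trans (∫-+ (pow μ T) _ _) (cong (W u +_) (trans (∫-*ʳ (pow μ T) weight ε) (trans (cong (_* ε) ∫weight≡0) (ℚ.*-zeroˡ ε)))) ⟩
            W u + 0ℚ
              ≡⟨ ℚ.+-identityʳ (W u) ⟩
            W u ∎)

      signed-samples : List (ℚ × Vec C T)
      signed-samples = List.map (λ (w , cs) → w * weight cs , cs) (atoms (pow μ T))

      distinguishing≤ℝ : ∑ signed-samples (λ (c , cs) → fromℚ c *ℝ run A (List⁺.toList (instance-of cs))) ≤ℝ fromℚ (ℤ.+ 1 / 4)
      distinguishing≤ℝ ε 0<ε = eventually-map bound (uniform-Vec uniform-Bool s _
          (λ z → eventually-× (0≤v A z ε 0<ε) (v≤1 A z ε 0<ε)))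
        where
        bound : ∀ m → (∀ z → 0ℚ ≤ seq (v A z) m + ε × seq (v A z) m ≤ 1ℚ + ε) →
          seq (∑ signed-samples (λ (c , cs) → fromℚ c *ℝ run A (List⁺.toList (instance-of cs)))) m ≤ ℤ.+ 1 / 4 + ε
        bound m h = begin
          seq (∑ signed-samples (λ (c , cs) → fromℚ c *ℝ run A (List⁺.toList (instance-of cs)))) m
            ≡⟨ seq-∑ signed-samples _ m ⟩
          ∑ℚ signed-samples (λ (c , cs) → c * seq (run A (List⁺.toList (instance-of cs))) m)
            ≡⟨ integrate-∑ℚ (atoms (pow μ T)) weight (λ cs → seq (run A (List⁺.toList (instance-of cs))) m) ⟩
          (∫[ cs ∈ pow μ T ] weight cs * seq (run A (List⁺.toList (instance-of cs))) m)
            ≡⟨ ∫-cong (pow μ T) (λ cs → cong (λ y → weight cs * seq y m) (run-instance cs)) ⟩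
          (∫[ cs ∈ pow μ T ] weight cs * seq (v A (final z₀ cs)) m)
            ≤⟨ distinguishing≤ ε (ℚ.<⇒≤ 0<ε) (λ z → seq (v A z) m) (λ z → proj₁ (h z)) (λ z → proj₂ (h z)) ⟩
          ℤ.+ 1 / 4 + ε ∎

  module _ {s : ℕ} (𝒜 : RandomizedAlgorithm k (n) s) (t p M : ℕ)
    (bias≤ : (1ℚ + 2ℚ * (3ℚ ^ k) ^ p * κ) ^ suc t ≤ 1ℚ + ℤ.+ 1 / 100)
    (loss≤ : ι (suc t) * ((∫[ _ ∈ states s ] 1ℚ) * squares p ½) ≤ ℤ.+ 1 / 100)
    (β : ℚ) (ε : ℝ) (β≤ : Eventually (λ m → β ≤ seq ε m))
    (T≤M : suc t ℕ.≤ M) (solves : Solves f 1ℝ (fromℚ (ρ f) +ℝ ε) M 𝒜) where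

    open ℚ.≤-Reasoning

    private
      T = suc t
      ν = pow μ T
      ν₁ = pow-isProbability μ μ₁ T
      e′ = ℤ.+ 1 / 100
      0<e′ : 0ℚ < e′
      0<e′ = ℚ.positive⁻¹ e′
      Ψ : Vec C T → Instance k (n)
      Ψ = instance-of
      Pr : Vec C T → ℝ
      Pr cs = Pr[outputs-1] 𝒜 (Ψ cs)
      Ψ≤M : ∀ cs → List⁺.length (Ψ cs) ℕ.≤ M
      Ψ≤M cs = subst (ℕ._≤ M) (sym (length-instance cs)) T≤M

    exceeds : ∀ {P : Set} → Dec P → ℚ
    exceeds (yes _) = 0ℚ
    exceeds (no _)  = 1ℚ

    low? : ∀ cs → Dec (val f (Ψ cs) ≤ ρ f + β)
    low? cs = val f (Ψ cs) ℚ.≤? ρ f + β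

    high-value : Vec C T → ℚ
    high-value cs = exceeds (low? cs)

    likely : Vec C T → ℚ
    likely cs = ∫[ σ ∈ Ω ] likelihood L σ cs

    yes-side : ∀ cs → Eventually (λ m → 1ℚ ≤ val f (Ψ cs) → ℤ.+ 2 / 3 ≤ seq (Pr cs) m + e′)
    yes-side cs = decide (1ℚ ℚ.≤? val f (Ψ cs))
      where
      decide : Dec (1ℚ ≤ val f (Ψ cs)) → Eventually (λ m → 1ℚ ≤ val f (Ψ cs) → ℤ.+ 2 / 3 ≤ seq (Pr cs) m + e′)
      decide (no val<1)  = 0 , λ _ _ 1≤val → contradiction 1≤val val<1
      decide (yes 1≤val) = eventually-map (λ m h _ → h)
        (proj₁ (solves (Ψ cs) (Ψ≤M cs)) (λ ε 0<ε → 0 , λ m _ → ℚ.≤-trans 1≤val (≤-by ε (ℚ.<⇒≤ 0<ε) refl)) e′ 0<e′)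

    -- Above ρ f + β this side takes no guarantee from the algorithm; there the trivial bound 1 is
    -- charged to `high-value`.
    no-side : ∀ cs → Eventually (λ m → seq (Pr cs) m ≤ (ℤ.+ 1 / 3 + e′) + high-value cs)
    no-side cs = decide (low? cs)
      where
      decide : (d : Dec (val f (Ψ cs) ≤ ρ f + β)) → Eventually (λ m → seq (Pr cs) m ≤ (ℤ.+ 1 / 3 + e′) + exceeds d)
      decide (yes val≤) = eventually-map (λ m h → ℚ.≤-trans h (ℚ.≤-reflexive (sym (ℚ.+-identityʳ (ℤ.+ 1 / 3 + e′)))))
        (proj₂ (solves (Ψ cs) (Ψ≤M cs)) val≤ℝ e′ 0<e′)
        where
        val≤ℝ : fromℚ (val f (Ψ cs)) ≤ℝ fromℚ (ρ f) +ℝ ε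
        val≤ℝ ε′ 0<ε′ = eventually-map (λ m β≤εₘ → ℚ.≤-trans val≤ (ℚ.≤-trans (ℚ.+-monoʳ-≤ (ρ f) β≤εₘ) (≤-by ε′ (ℚ.<⇒≤ 0<ε′) refl))) β≤
      decide (no _) = eventually-map (λ m h → ℚ.≤-trans h (from-yes (1ℚ + e′ ℚ.≤? (ℤ.+ 1 / 3 + e′) + 1ℚ))) (Pr≤1 𝒜 (Ψ cs) e′ 0<e′)

    signed : List (ℚ × Vec C T)
    signed = List.map (λ (w , cs) → w * (likely cs - 1ℚ) , cs) (atoms ν)

    advantage≤ : ∑ signed (λ (c , cs) → fromℚ c *ℝ Pr cs) ≤ℝ fromℚ (ℤ.+ 1 / 4)
    advantage≤ = averaged 𝒜 Ψ signed (ℤ.+ 1 / 4) (λ A → distinguishing≤ℝ A t p bias≤ loss≤)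

    -- Streams of value below 1 have planted density 0, so the planted average of the output is
    -- nearly 2/3 or more. On random streams it is at most about 1/3 + 1/20. The advantage 1/4, the
    -- failures 1/20 and three errors 1/100 add up to 0.33, just below the gap 1/3.
    no-algorithm : (∫[ cs ∈ ν ] high-value cs) ≤ ℤ.+ 1 / 20 → ⊥
    no-algorithm rare = absurd (eventually-× (advantage≤ e′ 0<e′)
      (uniform-Vec uniform-C T _
        (λ cs → eventually-× (yes-side cs) (no-side cs))))
      where
      Sides : ℕ → Set
      Sides m = seq (∑ signed (λ (c , cs) → fromℚ c *ℝ Pr cs)) m ≤ ℤ.+ 1 / 4 + e′ ×
        (∀ cs → (1ℚ ≤ val f (Ψ cs) → ℤ.+ 2 / 3 ≤ seq (Pr cs) m + e′) ×
                seq (Pr cs) m ≤ (ℤ.+ 1 / 3 + e′) + high-value cs)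
      absurd : Eventually Sides → ⊥
      absurd (m , h) = contradict (h m ℕ.≤-refl)
        where
        contradict : Sides m → ⊥
        contradict (adv≤ , sides) = <⇒≱ (from-yes ((ℤ.+ 1 / 4 + e′) + ((ℤ.+ 1 / 3 + e′) + ℤ.+ 1 / 20) ℚ.<? (ℤ.+ 2 / 3 - e′))) (begin
          ℤ.+ 2 / 3 - e′
            ≤⟨ planted≥ ⟩
          (∫[ cs ∈ ν ] likely cs * π cs)
            ≡⟨ trans (∫-cong ν (λ cs → split (likely cs) (π cs))) (∫-+ ν _ _) ⟩
          (∫[ cs ∈ ν ] (likely cs - 1ℚ) * π cs) + ∫ ν π
            ≤⟨ ℚ.+-mono-≤ difference≤ random≤ ⟩
          (ℤ.+ 1 / 4 + e′) + ((ℤ.+ 1 / 3 + e′) + ℤ.+ 1 / 20) ∎)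
          where
          π : Vec C T → ℚ
          π cs = seq (Pr cs) m
          split : ∀ l p → l * p ≡ (l - 1ℚ) * p + p
          split = solve-∀ ℚ-ring
          difference≤ : (∫[ cs ∈ ν ] (likely cs - 1ℚ) * π cs) ≤ ℤ.+ 1 / 4 + e′
          difference≤ = subst (_≤ ℤ.+ 1 / 4 + e′)
            (trans (seq-∑ signed _ m) (integrate-∑ℚ (atoms ν) (λ cs → likely cs - 1ℚ) π)) adv≤
          random≤ : ∫ ν π ≤ (ℤ.+ 1 / 3 + e′) + ℤ.+ 1 / 20
          random≤ = begin
            ∫ ν π
              ≤⟨ ∫-mono ν (λ cs → proj₂ (sides cs)) ⟩
            (∫[ cs ∈ ν ] (ℤ.+ 1 / 3 + e′) + high-value cs)
              ≡⟨ trans (∫-+ ν _ _) (cong (_+ (∫[ cs ∈ ν ] high-value cs)) (∫-const ν ν₁ (ℤ.+ 1 / 3 + e′))) ⟩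
            (ℤ.+ 1 / 3 + e′) + (∫[ cs ∈ ν ] high-value cs)
              ≤⟨ ℚ.+-monoʳ-≤ (ℤ.+ 1 / 3 + e′) rare ⟩
            (ℤ.+ 1 / 3 + e′) + ℤ.+ 1 / 20 ∎
          ∫likely : ∫ ν likely ≡ 1ℚ
          ∫likely = trans (∫-swap ν Ω _) (trans (∫-cong Ω (λ σ → ∫-likelihood μ L ∫L σ T)) (cube-isProbability (n)))
          0≤likelihood : ∀ σ {t} (cs : Vec C t) → 0ℚ ≤ likelihood L σ cs
          0≤likelihood σ []       = 0≤1
          0≤likelihood σ (c ∷ cs) = *-nonneg (0≤L σ c) (0≤likelihood σ cs)
          pointwise : ∀ cs → likely cs * (ℤ.+ 2 / 3 - e′) ≤ likely cs * π cs
          pointwise cs = decide (1ℚ ℚ.≤? val f (Ψ cs))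
            where
            decide : Dec (1ℚ ≤ val f (Ψ cs)) → likely cs * (ℤ.+ 2 / 3 - e′) ≤ likely cs * π cs
            decide (yes 1≤val) = *-monoˡ-≤ (likely cs) (∫-nonneg Ω (λ σ → 0≤likelihood σ cs))
              (≤-by ((π cs + e′) - ℤ.+ 2 / 3) (0≤q-p (proj₁ (sides cs) 1≤val)) (identity (π cs)))
              where
              identity : ∀ p → p ≡ (ℤ.+ 2 / 3 - ℤ.+ 1 / 100) + ((p + ℤ.+ 1 / 100) - ℤ.+ 2 / 3)
              identity = solve-∀ ℚ-ring
            decide (no val<1) = ℚ.≤-reflexive (trans (cong (_* (ℤ.+ 2 / 3 - e′)) likely≡0)
              (trans (ℚ.*-zeroˡ (ℤ.+ 2 / 3 - e′)) (sym (trans (cong (_* π cs) likely≡0) (ℚ.*-zeroˡ (π cs))))))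
              where
              likely≡0 : likely cs ≡ 0ℚ
              likely≡0 = trans (∫-cong Ω (planted-satisfiable cs val<1)) (∫-0 Ω)
          planted≥ : ℤ.+ 2 / 3 - e′ ≤ (∫[ cs ∈ ν ] likely cs * π cs)
          planted≥ = begin
            ℤ.+ 2 / 3 - e′                                   ≡⟨ ℚ.*-identityˡ (ℤ.+ 2 / 3 - e′) ⟨
            1ℚ * (ℤ.+ 2 / 3 - e′)                            ≡⟨ cong (_* (ℤ.+ 2 / 3 - e′)) ∫likely ⟨
            ∫ ν likely * (ℤ.+ 2 / 3 - e′)                    ≡⟨ ∫-*ʳ ν likely (ℤ.+ 2 / 3 - e′) ⟨
            (∫[ cs ∈ ν ] likely cs * (ℤ.+ 2 / 3 - e′))       ≤⟨ ∫-mono ν pointwise ⟩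
            (∫[ cs ∈ ν ] likely cs * π cs)                   ∎

    0≤high-value : ∀ cs → 0ℚ ≤ high-value cs
    0≤high-value cs = decide (low? cs)
      where
      decide : ∀ {P : Set} (d : Dec P) → 0ℚ ≤ exceeds d
      decide (yes _) = ℚ.≤-refl
      decide (no  _) = 0≤1

    failure : ∀ h lam → 0ℚ ≤ lam → 0ℚ ≤ β → ι h ≡ (ρ f + β) * ι T →
      (∫[ cs ∈ ν ] high-value cs) * (1ℚ + lam) ^ h ≤ 2ℚ ^ n * (1ℚ + lam * ρ f) ^ T
    failure h lam 0≤lam 0≤β ιh≡ = union-bound μ μ₁ (λ σ c → satisfies f σ (encode c)) (ρ f)
      0≤ρ rate lam 0≤lam T h high-value 0≤high-value cases
      where
      0≤ρ : 0ℚ ≤ ρ f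
      0≤ρ = subst (0ℚ ≤_) (sym (ρ≡∫ f)) (∫-nonneg (cube k) (λ y → 0≤indicator (f y)))
        where
        0≤indicator : ∀ b → 0ℚ ≤ indicator b
        0≤indicator true  = 0≤1
        0≤indicator false = ℚ.≤-refl
      cases : ∀ cs → high-value cs ≡ 0ℚ ⊎ (high-value cs ≤ 1ℚ × ∃ λ σ → h ℕ.≤ satisfied σ cs)
      cases cs = decide (low? cs)
        where
        reached : (∃ λ σ → ρ f + β < valAt f (Ψ cs) σ) → ∃ λ σ → h ℕ.≤ satisfied σ cs
        reached (σ , large) = σ , ι-cancel-≤ (begin
          ι h                               ≡⟨ ιh≡ ⟩
          (ρ f + β) * ι T                   ≤⟨ *-monoʳ-≤ (ι T) (0≤ι T) (ℚ.<⇒≤ large) ⟩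
          valAt f (Ψ cs) σ * ι T            ≡⟨ valAt-instance cs σ ⟩
          ι (satisfied σ cs)                ∎)
        decide : (d : Dec (val f (Ψ cs) ≤ ρ f + β)) → exceeds d ≡ 0ℚ ⊎ (exceeds d ≤ 1ℚ × ∃ λ σ → h ℕ.≤ satisfied σ cs)
        decide (yes _)   = inj₁ refl
        decide (no val≰) = inj₂ (ℚ.≤-refl , reached (val-attained f (Ψ cs) (+-nonneg 0≤ρ 0≤β) val≰))

zipWith-tabulate : ∀ {C : Set} {n} (h : A → B → C) (xs : Vec A n) (g : Fin n → B) →
  Vec.zipWith h xs (Vec.tabulate g) ≡ Vec.tabulate (λ i → h (Vec.lookup xs i) (g i))
zipWith-tabulate h []       g = refl
zipWith-tabulate h (x ∷ xs) g = cong (h x (g zero) ∷_) (zipWith-tabulate h xs (g ∘ suc))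

-- Numerical estimates

ℕ-^-distrib-* : ∀ m n o → (m ℕ.* n) ℕ.^ o ≡ m ℕ.^ o ℕ.* n ℕ.^ o
ℕ-^-distrib-* m n zero    = refl
ℕ-^-distrib-* m n (suc o) = trans (cong (m ℕ.* n ℕ.*_) (ℕ-^-distrib-* m n o)) (interchange m n (m ℕ.^ o) (n ℕ.^ o))
  where
  open ℕ-Solver.+-*-Solver
  interchange : ∀ a b c d → a ℕ.* b ℕ.* (c ℕ.* d) ≡ a ℕ.* c ℕ.* (b ℕ.* d)
  interchange = solve 4 (λ a b c d → a :* b :* (c :* d) := a :* c :* (b :* d)) refl

module _ where
  open ℕ.≤-Reasoning

  n<2^n : ∀ n → n ℕ.< 2 ℕ.^ n
  n<2^n zero    = ℕ.s≤s ℕ.z≤n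
  n<2^n (suc n) = begin
    suc (suc n)                        ≡⟨ ℕ.+-comm 1 (suc n) ⟩
    suc n ℕ.+ 1                        ≤⟨ ℕ.+-mono-≤ (n<2^n n) (ℕ.≤-trans (ℕ.m^n>0 2 n) (ℕ.≤-reflexive (sym (ℕ.+-identityʳ (2 ℕ.^ n))))) ⟩
    2 ℕ.^ suc n                        ∎

  bracket : ∀ b → 2 ℕ.≤ b → ∀ n → ∃ λ p → b ℕ.^ p ℕ.≤ suc n × suc n ℕ.< b ℕ.^ suc p
  bracket b 2≤b zero = 0 , ℕ.≤-refl , ℕ.≤-trans 2≤b (ℕ.≤-reflexive (sym (ℕ.*-identityʳ b)))
  bracket b 2≤b (suc n) = extend (bracket b 2≤b n)
    where
    extend : (∃ λ p → b ℕ.^ p ℕ.≤ suc n × suc n ℕ.< b ℕ.^ suc p) → ∃ λ p → b ℕ.^ p ℕ.≤ suc (suc n) × suc (suc n) ℕ.< b ℕ.^ suc p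
    extend (p , lo , hi) = decide (suc (suc n) ℕ.<? b ℕ.^ suc p)
      where
      decide : Dec (suc (suc n) ℕ.< b ℕ.^ suc p) → ∃ λ p → b ℕ.^ p ℕ.≤ suc (suc n) × suc (suc n) ℕ.< b ℕ.^ suc p
      decide (yes hi′) = p , ℕ.m≤n⇒m≤1+n lo , hi′
      decide (no ¬hi′) = suc p , ℕ.≮⇒≥ ¬hi′ , ℕ.≤-<-trans hi (ℕ.^-monoʳ-< b 2≤b (ℕ.n<1+n (suc p)))

  bracket-≥ : ∀ b → 2 ℕ.≤ b → ∀ {p q n} → b ℕ.^ q ℕ.≤ n → n ℕ.< b ℕ.^ suc p → q ℕ.≤ p
  bracket-≥ b@(suc _) 2≤b {p} {q} lo hi with q ℕ.≤? p
  ... | yes q≤p = q≤p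
  ... | no q≰p  = contradiction (ℕ.<-≤-trans hi (ℕ.≤-trans (ℕ.^-monoʳ-≤ b (ℕ.≰⇒> q≰p)) lo)) (ℕ.<-irrefl refl)

  -- At p = 3 + 2a this is a (5 + 2a) ≤ 8 · 4ᵃ; afterwards the left side grows by a while the right
  -- side doubles.
  linear≤exponential : ∀ a p → 3 ℕ.+ (a ℕ.+ a) ℕ.≤ p → a ℕ.* (2 ℕ.+ p) ℕ.≤ 2 ℕ.^ p
  linear≤exponential a p a≤p = subst (λ p → a ℕ.* (2 ℕ.+ p) ℕ.≤ 2 ℕ.^ p) (ℕ.m∸n+n≡m a≤p) (go (p ℕ.∸ (3 ℕ.+ (a ℕ.+ a))))
    where
    eight : ∀ a → a ℕ.+ (5 ℕ.+ a) ℕ.≤ 8 ℕ.* suc a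
    eight a = subst (a ℕ.+ (5 ℕ.+ a) ℕ.≤_) (identity a) (ℕ.m≤m+n (a ℕ.+ (5 ℕ.+ a)) (3 ℕ.+ 6 ℕ.* a))
      where
      open ℕ-Solver.+-*-Solver
      identity : ∀ a → a ℕ.+ (5 ℕ.+ a) ℕ.+ (3 ℕ.+ 6 ℕ.* a) ≡ 8 ℕ.* suc a
      identity = solve 1 (λ a → a :+ (con 5 :+ a) :+ (con 3 :+ con 6 :* a) := con 8 :* (con 1 :+ a)) refl
    go : ∀ j → a ℕ.* (2 ℕ.+ (j ℕ.+ (3 ℕ.+ (a ℕ.+ a)))) ℕ.≤ 2 ℕ.^ (j ℕ.+ (3 ℕ.+ (a ℕ.+ a)))
    go zero    = begin
      a ℕ.* (5 ℕ.+ (a ℕ.+ a))               ≡⟨ cong (a ℕ.*_) (trans (sym (ℕ.+-assoc 5 a a)) (trans (ℕ.+-comm (5 ℕ.+ a) a) refl)) ⟩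
      a ℕ.* (a ℕ.+ (5 ℕ.+ a))               ≤⟨ ℕ.*-mono-≤ (ℕ.<⇒≤ (n<2^n a)) (ℕ.≤-trans (eight a) (ℕ.*-monoʳ-≤ 8 (n<2^n a))) ⟩
      2 ℕ.^ a ℕ.* (8 ℕ.* 2 ℕ.^ a)           ≡⟨ regroup (2 ℕ.^ a) ⟩
      8 ℕ.* (2 ℕ.^ a ℕ.* 2 ℕ.^ a)           ≡⟨ cong (8 ℕ.*_) (ℕ.^-distribˡ-+-* 2 a a) ⟨
      8 ℕ.* 2 ℕ.^ (a ℕ.+ a)                 ≡⟨ ℕ.^-distribˡ-+-* 2 3 (a ℕ.+ a) ⟨
      2 ℕ.^ (3 ℕ.+ (a ℕ.+ a))               ∎
      where
      open ℕ-Solver.+-*-Solver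
      regroup : ∀ x → x ℕ.* (8 ℕ.* x) ≡ 8 ℕ.* (x ℕ.* x)
      regroup = solve 1 (λ x → x :* (con 8 :* x) := con 8 :* (x :* x)) refl
    go (suc j) = begin
      a ℕ.* suc (2 ℕ.+ q)                    ≡⟨ ℕ.*-suc a (2 ℕ.+ q) ⟩
      a ℕ.+ a ℕ.* (2 ℕ.+ q)                  ≤⟨ ℕ.+-mono-≤ (ℕ.≤-trans (ℕ.m≤m*n a (2 ℕ.+ q)) (go j)) (ℕ.≤-trans (go j) (ℕ.≤-reflexive (sym (ℕ.+-identityʳ (2 ℕ.^ q))))) ⟩
      2 ℕ.^ suc q                            ∎
      where q = j ℕ.+ (3 ℕ.+ (a ℕ.+ a))

  -- A comparison of exponents of 2: 100 C is below 2^(100C), n below 2^(4k(p+2)), and s below 2ᵖ.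
  -- By the growth hypothesis the first two exponents together are at most 2ᵖ, and 2ᵖ + 2ᵖ =
  -- 2^(p+1).
  memory-estimate : ∀ k C n p s → n ℕ.< (16 ℕ.^ k) ℕ.^ (2 ℕ.+ p) → 4 ℕ.* s ℕ.< 2 ℕ.^ (2 ℕ.+ p) →
    (100 ℕ.* C ℕ.+ 4 ℕ.* k) ℕ.* (2 ℕ.+ p) ℕ.≤ 2 ℕ.^ p →
    100 ℕ.* (C ℕ.* n) ℕ.* 2 ℕ.^ s ℕ.≤ 2 ℕ.^ (2 ℕ.^ suc p)
  memory-estimate k C n p s n< s< growth = begin
    100 ℕ.* (C ℕ.* n) ℕ.* 2 ℕ.^ s
      ≡⟨ cong (ℕ._* 2 ℕ.^ s) (sym (ℕ.*-assoc 100 C n)) ⟩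
    100 ℕ.* C ℕ.* n ℕ.* 2 ℕ.^ s
      ≤⟨ ℕ.*-mono-≤ (ℕ.*-mono-≤ (ℕ.<⇒≤ (n<2^n (100 ℕ.* C))) (ℕ.<⇒≤ n<))
           (ℕ.^-monoʳ-≤ 2 (ℕ.<⇒≤ s<2^p)) ⟩
    2 ℕ.^ (100 ℕ.* C) ℕ.* (16 ℕ.^ k) ℕ.^ (2 ℕ.+ p) ℕ.* 2 ℕ.^ (2 ℕ.^ p)
      ≡⟨ cong (λ t → 2 ℕ.^ (100 ℕ.* C) ℕ.* t ℕ.* 2 ℕ.^ (2 ℕ.^ p)) (trans (cong (ℕ._^ (2 ℕ.+ p)) (ℕ.^-*-assoc 2 4 k)) (ℕ.^-*-assoc 2 (4 ℕ.* k) (2 ℕ.+ p))) ⟩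
    2 ℕ.^ (100 ℕ.* C) ℕ.* 2 ℕ.^ (4 ℕ.* k ℕ.* (2 ℕ.+ p)) ℕ.* 2 ℕ.^ (2 ℕ.^ p)
      ≡⟨ cong (ℕ._* 2 ℕ.^ (2 ℕ.^ p)) (ℕ.^-distribˡ-+-* 2 (100 ℕ.* C) (4 ℕ.* k ℕ.* (2 ℕ.+ p))) ⟨
    2 ℕ.^ (100 ℕ.* C ℕ.+ 4 ℕ.* k ℕ.* (2 ℕ.+ p)) ℕ.* 2 ℕ.^ (2 ℕ.^ p)
      ≤⟨ ℕ.*-monoˡ-≤ (2 ℕ.^ (2 ℕ.^ p)) (ℕ.^-monoʳ-≤ 2 (begin
           100 ℕ.* C ℕ.+ 4 ℕ.* k ℕ.* (2 ℕ.+ p)                   ≤⟨ ℕ.+-monoˡ-≤ _ (ℕ.m≤m*n (100 ℕ.* C) (2 ℕ.+ p)) ⟩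
           100 ℕ.* C ℕ.* (2 ℕ.+ p) ℕ.+ 4 ℕ.* k ℕ.* (2 ℕ.+ p)     ≡⟨ ℕ.*-distribʳ-+ (2 ℕ.+ p) (100 ℕ.* C) (4 ℕ.* k) ⟨
           (100 ℕ.* C ℕ.+ 4 ℕ.* k) ℕ.* (2 ℕ.+ p)                 ≤⟨ growth ⟩
           2 ℕ.^ p                                               ∎)) ⟩
    2 ℕ.^ (2 ℕ.^ p) ℕ.* 2 ℕ.^ (2 ℕ.^ p)
      ≡⟨ ℕ.^-distribˡ-+-* 2 (2 ℕ.^ p) (2 ℕ.^ p) ⟨
    2 ℕ.^ (2 ℕ.^ p ℕ.+ 2 ℕ.^ p)
      ≡⟨ cong (λ t → 2 ℕ.^ (2 ℕ.^ p ℕ.+ t)) (ℕ.+-identityʳ (2 ℕ.^ p)) ⟨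
    2 ℕ.^ (2 ℕ.^ suc p) ∎
    where
    s<2^p : s ℕ.< 2 ℕ.^ p
    s<2^p = ℕ.*-cancelˡ-< 4 s (2 ℕ.^ p) (subst (4 ℕ.* s ℕ.<_) (ℕ.^-distribˡ-+-* 2 2 p) s<)

  -- The slack between 3 and 16 absorbs the constant: 3 · 5 ≤ 16, and the power of 5 exceeds p,
  -- hence B.
  bias-estimate : ∀ k B n p → (16 ℕ.^ suc k) ℕ.^ p ℕ.≤ n → B ℕ.≤ p → B ℕ.* (3 ℕ.^ suc k) ℕ.^ p ℕ.≤ n
  bias-estimate k B n p 16≤n B≤p = begin
    B ℕ.* (3 ℕ.^ suc k) ℕ.^ p
      ≤⟨ ℕ.*-monoˡ-≤ ((3 ℕ.^ suc k) ℕ.^ p) (ℕ.≤-trans B≤p (ℕ.≤-trans (ℕ.<⇒≤ (n<2^n p)) (ℕ.^-monoˡ-≤ p 2≤5^k))) ⟩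
    (5 ℕ.^ suc k) ℕ.^ p ℕ.* (3 ℕ.^ suc k) ℕ.^ p
      ≡⟨ trans (cong (ℕ._^ p) (ℕ-^-distrib-* 5 3 (suc k))) (ℕ-^-distrib-* (5 ℕ.^ suc k) (3 ℕ.^ suc k) p) ⟨
    (15 ℕ.^ suc k) ℕ.^ p
      ≤⟨ ℕ.^-monoˡ-≤ p (ℕ.^-monoˡ-≤ (suc k) (ℕ.n≤1+n 15)) ⟩
    (16 ℕ.^ suc k) ℕ.^ p
      ≤⟨ 16≤n ⟩
    n ∎
    where
    2≤5^k : 2 ℕ.≤ 5 ℕ.^ suc k
    2≤5^k = ℕ.≤-trans (ℕ.s≤s (ℕ.s≤s ℕ.z≤n)) (ℕ.*-monoʳ-≤ 5 (ℕ.m^n>0 5 k))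

module _ where
  open ℚ.≤-Reasoning

  -- With y = T b ≤ 1/101 the power is at most 1/(1 - y) ≤ 101/100, again from Bernoulli for 1 - b
  -- and (1 + b)(1 - b) ≤ 1.
  power-estimate : ∀ t b → 0ℚ ≤ b → ι 101 * (ι (suc t) * b) ≤ 1ℚ → (1ℚ + b) ^ suc t ≤ 1ℚ + ℤ.+ 1 / 100
  power-estimate t b 0≤b small = begin
    (1ℚ + b) ^ T
      ≡⟨ ℚ.*-identityʳ ((1ℚ + b) ^ T) ⟨
    (1ℚ + b) ^ T * 1ℚ
      ≤⟨ *-monoˡ-≤ ((1ℚ + b) ^ T) (^-nonneg T 0≤1+b) (≤-by (ℤ.+ 1 / 100 * (1ℚ - ι 101 * y))
           (*-nonneg (ℚ.nonNegative⁻¹ (ℤ.+ 1 / 100)) (0≤q-p small)) hundredth) ⟩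
    (1ℚ + b) ^ T * ((1ℚ - y) * (ℤ.+ 101 / 100))
      ≡⟨ ℚ.*-assoc ((1ℚ + b) ^ T) (1ℚ - y) (ℤ.+ 101 / 100) ⟨
    (1ℚ + b) ^ T * (1ℚ - y) * (ℤ.+ 101 / 100)
      ≤⟨ *-monoʳ-≤ (ℤ.+ 101 / 100) (ℚ.nonNegative⁻¹ (ℤ.+ 101 / 100)) product≤1 ⟩
    1ℚ * (ℤ.+ 101 / 100)
      ≡⟨⟩
    1ℚ + ℤ.+ 1 / 100 ∎
    where
    T = suc t
    y = ι T * b
    0≤y = *-nonneg (0≤ι T) 0≤b
    0≤1+b = +-nonneg 0≤1 0≤b
    y≤1 : y ≤ 1ℚ
    y≤1 = ℚ.≤-trans (subst (_≤ ι 101 * y) (ℚ.*-identityˡ y) (*-monoʳ-≤ y 0≤y (ι-mono-≤ {1} {101} (ℕ.s≤s ℕ.z≤n)))) small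
    b≤1 : b ≤ 1ℚ
    b≤1 = ℚ.≤-trans (≤-by (ι t * b) (*-nonneg (0≤ι t) 0≤b) (expand (ι t) b)) y≤1
      where
      expand : ∀ t b → (1ℚ + t) * b ≡ b + t * b
      expand = solve-∀ ℚ-ring
    hundredth : (1ℚ - y) * (ℤ.+ 101 / 100) ≡ 1ℚ + ℤ.+ 1 / 100 * (1ℚ - ι 101 * y)
    hundredth = trans (identity y) (cong (λ c → 1ℚ + ℤ.+ 1 / 100 * (1ℚ - c * y)) (sym (ι≡/1 101)))
      where
      identity : ∀ y → (1ℚ - y) * (ℤ.+ 101 / 100) ≡ 1ℚ + ℤ.+ 1 / 100 * (1ℚ - ℤ.+ 101 / 1 * y)
      identity = solve-∀ ℚ-ring
    minus : ∀ a b → 1ℚ - a * b ≡ 1ℚ + a * (- b)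
    minus = solve-∀ ℚ-ring
    difference : ∀ b → 1ℚ ≡ (1ℚ + b) * (1ℚ - b) + b * b
    difference = solve-∀ ℚ-ring
    product≤1 : (1ℚ + b) ^ T * (1ℚ - y) ≤ 1ℚ
    product≤1 = begin
      (1ℚ + b) ^ T * (1ℚ - y)              ≡⟨ cong ((1ℚ + b) ^ T *_) (minus (ι T) b) ⟩
      (1ℚ + b) ^ T * (1ℚ + ι T * (- b))    ≤⟨ *-monoˡ-≤ ((1ℚ + b) ^ T) (^-nonneg T 0≤1+b) (bernoulli T (0≤q-p b≤1)) ⟩
      (1ℚ + b) ^ T * (1ℚ - b) ^ T          ≡⟨ ^-distrib-* (1ℚ + b) (1ℚ - b) T ⟨
      ((1ℚ + b) * (1ℚ - b)) ^ T            ≤⟨ ^-mono-≤ T (*-nonneg 0≤1+b (0≤q-p b≤1)) (≤-by (b * b) (p*p-nonneg b) (difference b)) ⟩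
      1ℚ ^ T                               ≡⟨ 1^n≡1 T ⟩
      1ℚ                                   ∎

  squares≡^ : ∀ p x → squares p x ≡ x ^ (2 ℕ.^ p)
  squares≡^ zero    x = sym (ℚ.*-identityʳ x)
  squares≡^ (suc p) x = trans (cong (λ t → t * t) (squares≡^ p x))
    (trans (sym (^-homo-* x (2 ℕ.^ p) (2 ℕ.^ p))) (cong (λ m → x ^ (2 ℕ.^ p ℕ.+ m)) (sym (ℕ.+-identityʳ (2 ℕ.^ p)))))

  loss-estimate : ∀ T s p → 100 ℕ.* T ℕ.* 2 ℕ.^ s ℕ.≤ 2 ℕ.^ (2 ℕ.^ p) →
    ι T * ((∫[ _ ∈ states s ] 1ℚ) * squares p ½) ≤ ℤ.+ 1 / 100
  loss-estimate T s p small = begin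
    ι T * ((∫[ _ ∈ states s ] 1ℚ) * q)
      ≡⟨ cong (λ t → ι T * (t * q)) (total-states s) ⟩
    ι T * (2ℚ ^ s * q)
      ≡⟨ regroup (ι T) (2ℚ ^ s) q ⟩
    ℤ.+ 1 / 100 * ((ℤ.+ 100 / 1 * ι T * 2ℚ ^ s) * q)
      ≤⟨ *-monoˡ-≤ (ℤ.+ 1 / 100) (ℚ.nonNegative⁻¹ (ℤ.+ 1 / 100)) (*-monoʳ-≤ q (squares-nonneg p (ℚ.nonNegative⁻¹ ½)) small′) ⟩
    ℤ.+ 1 / 100 * (squares p 2ℚ * q)
      ≡⟨ cong (ℤ.+ 1 / 100 *_) (trans (sym (squares-* p 2ℚ ½)) (trans (squares≡^ p 1ℚ) (1^n≡1 (2 ℕ.^ p)))) ⟩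
    ℤ.+ 1 / 100 * 1ℚ
      ≡⟨⟩
    ℤ.+ 1 / 100 ∎
    where
    q = squares p ½
    regroup : ∀ t s q → t * (s * q) ≡ ℤ.+ 1 / 100 * ((ℤ.+ 100 / 1 * t * s) * q)
    regroup = solve-∀ ℚ-ring
    small′ : ℤ.+ 100 / 1 * ι T * 2ℚ ^ s ≤ squares p 2ℚ
    small′ = begin
      ℤ.+ 100 / 1 * ι T * 2ℚ ^ s            ≡⟨ cong₂ (λ a b → a * ι T * b) (sym (ι≡/1 100)) (sym (ι-^ 2 s)) ⟩
      ι 100 * ι T * ι (2 ℕ.^ s)             ≡⟨ trans (ι-* (100 ℕ.* T) (2 ℕ.^ s)) (cong (_* ι (2 ℕ.^ s)) (ι-* 100 T)) ⟨
      ι (100 ℕ.* T ℕ.* 2 ℕ.^ s)             ≤⟨ ι-mono-≤ small ⟩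
      ι (2 ℕ.^ (2 ℕ.^ p))                   ≡⟨ ι-^ 2 (2 ℕ.^ p) ⟩
      2ℚ ^ (2 ℕ.^ p)                        ≡⟨ squares≡^ p 2ℚ ⟨
      squares p 2ℚ                          ∎

  -- Multiplied by n, the left side contains n² x² = (n/N)² ≤ (2k)²: one n comes from the length C n
  -- of the stream and the other is the one to be gained from the hypothesis.
  kernel-estimate : ∀ k C n N p x → 0ℚ ≤ x → ι N * x ≡ 1ℚ → 1 ℕ.≤ n → n ℕ.≤ 2 ℕ.* k ℕ.* N →
    101 ℕ.* (C ℕ.* (2 ℕ.* 2 ℕ.^ k ℕ.* (2 ℕ.* k ℕ.* (2 ℕ.* k)))) ℕ.* (3 ℕ.^ k) ℕ.^ p ℕ.≤ n →
    ι 101 * (ι (C ℕ.* n) * (2ℚ * (3ℚ ^ k) ^ p * (2ℚ ^ k * (x * x)))) ≤ 1ℚ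
  kernel-estimate k C n@(suc n-1) N p x 0≤x Nx≡1 1≤n n≤ small = ℚ.*-cancelʳ-≤-pos (ι n) {{ℚ.positive (0<ι n-1)}} (begin
    ι 101 * (ι (C ℕ.* n) * (2ℚ * (3ℚ ^ k) ^ p * (2ℚ ^ k * (x * x)))) * ι n
      ≡⟨ cong (λ t → ι 101 * (t * (2ℚ * (3ℚ ^ k) ^ p * (2ℚ ^ k * (x * x)))) * ι n) (ι-* C n) ⟩
    ι 101 * (ι C * ι n * (2ℚ * (3ℚ ^ k) ^ p * (2ℚ ^ k * (x * x)))) * ι n
      ≡⟨ regroup (ι 101) (ι C) (ι n) 2ℚ ((3ℚ ^ k) ^ p) (2ℚ ^ k) x ⟩
    ι 101 * (ι C * (2ℚ * 2ℚ ^ k * ((ι n * x) * (ι n * x)))) * (3ℚ ^ k) ^ p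
      ≤⟨ *-monoʳ-≤ _ (^-nonneg p (^-nonneg k (ℚ.nonNegative⁻¹ 3ℚ))) (*-monoˡ-≤ (ι 101) (0≤ι 101)
           (*-monoˡ-≤ (ι C) (0≤ι C) (*-monoˡ-≤ (2ℚ * 2ℚ ^ k) (*-nonneg (ℚ.nonNegative⁻¹ 2ℚ) (^-nonneg k (ℚ.nonNegative⁻¹ 2ℚ)))
             (*-mono-≤ 0≤nx (0≤ι (2 ℕ.* k)) nx≤ nx≤)))) ⟩
    ι 101 * (ι C * (2ℚ * 2ℚ ^ k * (ι (2 ℕ.* k) * ι (2 ℕ.* k)))) * (3ℚ ^ k) ^ p
      ≡⟨ fold ⟨
    ι (101 ℕ.* (C ℕ.* (2 ℕ.* 2 ℕ.^ k ℕ.* (2 ℕ.* k ℕ.* (2 ℕ.* k)))) ℕ.* (3 ℕ.^ k) ℕ.^ p)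
      ≤⟨ ι-mono-≤ small ⟩
    ι n
      ≡⟨ ℚ.*-identityˡ (ι n) ⟨
    1ℚ * ι n ∎)
    where
    0≤nx = *-nonneg (0≤ι n) 0≤x
    nx≤ : ι n * x ≤ ι (2 ℕ.* k)
    nx≤ = begin
      ι n * x                        ≤⟨ *-monoʳ-≤ x 0≤x (ι-mono-≤ n≤) ⟩
      ι (2 ℕ.* k ℕ.* N) * x          ≡⟨ cong (_* x) (ι-* (2 ℕ.* k) N) ⟩
      ι (2 ℕ.* k) * ι N * x          ≡⟨ ℚ.*-assoc (ι (2 ℕ.* k)) (ι N) x ⟩
      ι (2 ℕ.* k) * (ι N * x)        ≡⟨ trans (cong (ι (2 ℕ.* k) *_) Nx≡1) (ℚ.*-identityʳ (ι (2 ℕ.* k))) ⟩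
      ι (2 ℕ.* k)                    ∎
    regroup : ∀ h C n t T K x → h * (C * n * (t * T * (K * (x * x)))) * n ≡ h * (C * (t * K * ((n * x) * (n * x)))) * T
    regroup = solve-∀ ℚ-ring
    fold : ι (101 ℕ.* (C ℕ.* (2 ℕ.* 2 ℕ.^ k ℕ.* (2 ℕ.* k ℕ.* (2 ℕ.* k)))) ℕ.* (3 ℕ.^ k) ℕ.^ p) ≡
      ι 101 * (ι C * (2ℚ * 2ℚ ^ k * (ι (2 ℕ.* k) * ι (2 ℕ.* k)))) * (3ℚ ^ k) ^ p
    fold = trans (ι-* (101 ℕ.* W) ((3 ℕ.^ k) ℕ.^ p)) (cong₂ _*_
      (trans (ι-* 101 W) (cong (ι 101 *_) (trans (ι-* C _) (cong (ι C *_) (trans (ι-* (2 ℕ.* 2 ℕ.^ k) (2 ℕ.* k ℕ.* (2 ℕ.* k)))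
        (cong₂ _*_ (trans (ι-* 2 (2 ℕ.^ k)) (cong (2ℚ *_) (ι-^ 2 k))) (ι-* (2 ℕ.* k) (2 ℕ.* k))))))))
      (trans (ι-^ (3 ℕ.^ k) p) (cong (_^ p) (ι-^ 3 k))))
      where W = C ℕ.* (2 ℕ.* 2 ℕ.^ k ℕ.* (2 ℕ.* k ℕ.* (2 ℕ.* k)))

archimedean : ∀ {p} → 0ℚ < p → ∃ λ e → 1ℚ ≤ p * ι (suc e)
archimedean {p} 0<p = go p (ℚ.positive 0<p)
  where
  go : ∀ p → ℚ.Positive p → ∃ λ e → 1ℚ ≤ p * ι (suc e)
  go p@(ℚ.mkℚ (ℤ.+ suc a) d _) _ = d , subst (1ℚ ≤_)
    (sym (trans (cong (_* ι (suc d)) (sym (ℚ.↥p/↧p≡p p))) (/*ι (suc a) d))) (ι-mono-≤ {1} {suc a} (ℕ.s≤s ℕ.z≤n))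

-- The m-th power of `gap` leaves w (1 + X/3)^m ≤ 2^(n+1). Since 3 e X = 1, Bernoulli gives (1 +
-- X/3)^(351e) ≥ 1 + 117 e X = 40, so w ≤ 20^(-(n+1)): 2^(n+1) pays for the union bound and the rest
-- for the failure.
rare-failure : ∀ K R e n q lam X w → 0ℚ ≤ w → 0ℚ ≤ q → 0ℚ ≤ lam → 0ℚ ≤ X → ι 3 * ι e * X ≡ 1ℚ →
  (1ℚ + lam * q) ^ (K ℕ.* e) * (1ℚ + X * (ℤ.+ 1 / 3)) ≤ (1ℚ + lam) ^ (R ℕ.* e ℕ.+ K) →
  w * (1ℚ + lam) ^ ((R ℕ.* e ℕ.+ K) ℕ.* (351 ℕ.* e ℕ.* suc n)) ≤
    2ℚ ^ suc n * (1ℚ + lam * q) ^ (K ℕ.* e ℕ.* (351 ℕ.* e ℕ.* suc n)) →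
  w ≤ ℤ.+ 1 / 20
rare-failure K R e n q lam X w 0≤w 0≤q 0≤lam 0≤X eX≡ gap total = begin
  w
    ≡⟨ twentieth w ⟩
  (w * 20ℚ) * (ℤ.+ 1 / 20)
    ≤⟨ *-monoʳ-≤ (ℤ.+ 1 / 20) (ℚ.nonNegative⁻¹ (ℤ.+ 1 / 20)) (ℚ.≤-trans (*-monoˡ-≤ w 0≤w 20≤20ⁿ) w20ⁿ≤1) ⟩
  1ℚ * (ℤ.+ 1 / 20)
    ≡⟨ ℚ.*-identityˡ (ℤ.+ 1 / 20) ⟩
  ℤ.+ 1 / 20 ∎
  where
  open ℚ.≤-Reasoning
  20ℚ = ℤ.+ 20 / 1
  m = 351 ℕ.* e ℕ.* suc n
  ξ = X * (ℤ.+ 1 / 3)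
  Y = (1ℚ + lam * q) ^ (K ℕ.* e ℕ.* m)
  0<1+lq : 0ℚ < 1ℚ + lam * q
  0<1+lq = ℚ.<-≤-trans (ℚ.positive⁻¹ 1ℚ) (≤-by {1ℚ} (lam * q) (*-nonneg 0≤lam 0≤q) refl)
  0≤1+ξ : 0ℚ ≤ 1ℚ + ξ
  0≤1+ξ = +-nonneg 0≤1 (*-nonneg 0≤X (ℚ.nonNegative⁻¹ (ℤ.+ 1 / 3)))
  twentieth : ∀ w → w ≡ (w * (ℤ.+ 20 / 1)) * (ℤ.+ 1 / 20)
  twentieth = solve-∀ ℚ-ring
  forty : 2ℚ * 20ℚ ≤ (1ℚ + ξ) ^ (351 ℕ.* e)
  forty = begin
    2ℚ * 20ℚ                           ≡⟨⟩
    1ℚ + ℤ.+ 39 / 1 * 1ℚ               ≡⟨ cong (λ t → 1ℚ + ℤ.+ 39 / 1 * t) eX≡ ⟨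
    1ℚ + ℤ.+ 39 / 1 * (ι 3 * ι e * X)  ≡⟨ cong (1ℚ +_) (regroup (ι e) X) ⟩
    1ℚ + ℤ.+ 351 / 1 * ι e * ξ         ≡⟨ cong (λ t → 1ℚ + t * ξ) (trans (ι-* 351 e) (cong (_* ι e) (ι≡/1 351))) ⟨
    1ℚ + ι (351 ℕ.* e) * ξ             ≤⟨ bernoulli (351 ℕ.* e) 0≤1+ξ ⟩
    (1ℚ + ξ) ^ (351 ℕ.* e)             ∎
    where
    regroup : ∀ e X → ℤ.+ 39 / 1 * ((1ℚ + (1ℚ + (1ℚ + 0ℚ))) * e * X) ≡ ℤ.+ 351 / 1 * e * (X * (ℤ.+ 1 / 3))
    regroup = solve-∀ ℚ-ring
  growth : (2ℚ * 20ℚ) ^ suc n * Y ≤ (1ℚ + lam) ^ ((R ℕ.* e ℕ.+ K) ℕ.* m)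
  growth = begin
    (2ℚ * 20ℚ) ^ suc n * Y
      ≤⟨ *-monoʳ-≤ Y (^-nonneg (K ℕ.* e ℕ.* m) (ℚ.<⇒≤ 0<1+lq)) (ℚ.≤-trans (^-mono-≤ (suc n) (ℚ.nonNegative⁻¹ (2ℚ * 20ℚ)) forty)
           (ℚ.≤-reflexive (sym (^-* (1ℚ + ξ) (351 ℕ.* e) (suc n))))) ⟩
    (1ℚ + ξ) ^ m * Y
      ≡⟨ ℚ.*-comm ((1ℚ + ξ) ^ m) Y ⟩
    Y * (1ℚ + ξ) ^ m
      ≡⟨ trans (cong (_* (1ℚ + ξ) ^ m) (^-* (1ℚ + lam * q) (K ℕ.* e) m)) (sym (^-distrib-* ((1ℚ + lam * q) ^ (K ℕ.* e)) (1ℚ + ξ) m)) ⟩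
    ((1ℚ + lam * q) ^ (K ℕ.* e) * (1ℚ + ξ)) ^ m
      ≤⟨ ^-mono-≤ m (*-nonneg (^-nonneg (K ℕ.* e) (ℚ.<⇒≤ 0<1+lq)) 0≤1+ξ) gap ⟩
    ((1ℚ + lam) ^ (R ℕ.* e ℕ.+ K)) ^ m
      ≡⟨ ^-* (1ℚ + lam) (R ℕ.* e ℕ.+ K) m ⟨
    (1ℚ + lam) ^ ((R ℕ.* e ℕ.+ K) ℕ.* m) ∎
  w40ⁿ≤2ⁿ : w * (2ℚ * 20ℚ) ^ suc n ≤ 2ℚ ^ suc n
  w40ⁿ≤2ⁿ = ℚ.*-cancelʳ-≤-pos Y {{ℚ.positive (^-pos (K ℕ.* e ℕ.* m) 0<1+lq)}} (begin
    w * (2ℚ * 20ℚ) ^ suc n * Y       ≡⟨ ℚ.*-assoc w ((2ℚ * 20ℚ) ^ suc n) Y ⟩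
    w * ((2ℚ * 20ℚ) ^ suc n * Y)     ≤⟨ *-monoˡ-≤ w 0≤w growth ⟩
    w * (1ℚ + lam) ^ ((R ℕ.* e ℕ.+ K) ℕ.* m)    ≤⟨ total ⟩
    2ℚ ^ suc n * Y                   ∎)
  w20ⁿ≤1 : w * 20ℚ ^ suc n ≤ 1ℚ
  w20ⁿ≤1 = ℚ.*-cancelʳ-≤-pos (2ℚ ^ suc n) {{ℚ.positive (0<2^ (suc n))}} (begin
    w * 20ℚ ^ suc n * 2ℚ ^ suc n       ≡⟨ trans (ℚ.*-assoc w _ _) (cong (w *_) (ℚ.*-comm (20ℚ ^ suc n) (2ℚ ^ suc n))) ⟩
    w * (2ℚ ^ suc n * 20ℚ ^ suc n)     ≡⟨ cong (w *_) (^-distrib-* 2ℚ 20ℚ (suc n)) ⟨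
    w * (2ℚ * 20ℚ) ^ suc n             ≤⟨ w40ⁿ≤2ⁿ ⟩
    2ℚ ^ suc n                         ≡⟨ ℚ.*-identityˡ (2ℚ ^ suc n) ⟨
    1ℚ * 2ℚ ^ suc n                    ∎)
  20≤20ⁿ : 20ℚ ≤ 20ℚ ^ suc n
  20≤20ⁿ = subst (_≤ 20ℚ ^ suc n) (ℚ.*-identityʳ 20ℚ) (*-monoˡ-≤ 20ℚ (ℚ.nonNegative⁻¹ 20ℚ) (1≤p⇒1≤p^n n (ℚ.≤ᵇ⇒≤ _)))

-- The hard instances and the choice of parameters

module PlantedInstances
  {k N : ℕ} (r : ℕ) (f : Predicate k)
  (x : ℚ) (0≤x : 0ℚ ≤ x) (x≤1 : x ≤ 1ℚ) (Nx≡1 : ι N * x ≡ 1ℚ) (approx : Approximation f x)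
  where

  open Approximation approx
  open Planted {k} {N} r D isProbability x 0≤x x≤1 Nx≡1 mean public

  encode : Sample → Constraint k (size k)
  variables (encode (js , b)) = Vec.tabulate (λ i → index i (Vec.lookup js i))
  signs     (encode (js , b)) = b
  distinct  (encode (js , b)) = Unique.tabulate⁺ (λ {i} {j} → index-injective i j (Vec.lookup js i) (Vec.lookup js j))

  satisfies-encode : ∀ σ c → satisfies f σ (encode c) ≡ f (pattern-at σ c)
  satisfies-encode σ (js , b) = cong f (zipWith-tabulate (λ b j → b Sign.* Vec.lookup σ j) b (λ i → index i (Vec.lookup js i)))

  rate : ∀ σ → (∫[ c ∈ μ ] indicator (satisfies f σ (encode c))) ≡ ρ f
  rate σ = trans (∫-μ (λ c → indicator (satisfies f σ (encode c)))) (trans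
    (∫-cong positions (λ js → trans
      (∫-cong (cube k) (λ b → cong indicator (satisfies-encode σ (js , b))))
      (trans (∫-translate k (λ i → Vec.lookup σ (index i (Vec.lookup js i))) (λ b → indicator (f b))) (sym (ρ≡∫ f)))))
    (∫-const positions positions-isProbability (ρ f)))

  module Hard = Reduction f (uniform-× (uniform-Vec (uniform-Fin N) k) (uniform-Vec uniform-Sign k)) encode
    μ μ-isProbability rate L 0≤L ∫L L-degree (λ σ c eq → L-support f support σ c (trans (sym (satisfies-encode σ c)) eq))
    κ 0≤κ kernel

size≡ : ∀ N r k → Blocks.size N r k ≡ r ℕ.+ k ℕ.* N
size≡ N r zero    = sym (ℕ.+-identityʳ r)
size≡ N r (suc k) = trans (cong (N ℕ.+_) (size≡ N r k)) (commute N r (k ℕ.* N))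
  where
  open ℕ-Solver.+-*-Solver
  commute : ∀ N r m → N ℕ.+ (r ℕ.+ m) ≡ r ℕ.+ (N ℕ.+ m)
  commute = solve 3 (λ N r m → N :+ (r :+ m) := r :+ (N :+ m)) refl

reciprocal-ι : ∀ {m} → 1 ℕ.≤ m → ∃ λ x → 0ℚ ≤ x × x * ι m ≡ 1ℚ
reciprocal-ι {suc m} _ = reciprocal (0<ι m)

module LowerBound
  (k′ : ℕ) (f : Predicate (suc k′)) (ind : SupportsOneWiseIndependence f)
  (ε : ℝ) (e′ : ℕ) (β : ℚ) (0≤β : 0ℚ ≤ β) (βe≡1 : β * ι (suc e′) ≡ 1ℚ) (β≤ε : Eventually (λ m → β ≤ seq ε m))
  where

  -- Here β = 1/e and ρ f = R/K. The stream has C n constraints: K e clears both denominators and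
  -- 351 e is what `rare-failure` asks for. The exponents in `memory-estimate` give `a`, the
  -- constants in `kernel-estimate` give `b`. In `p₀`, 4 replaces the 3 of `linear≤exponential`
  -- because the bracketing exponent is written `suc p`, and `b` is added for `bias-estimate`. The
  -- three summands of `n₀` make that exponent at least p₀, the blocks nonempty, and C n ≤ n².
  k e K R C a b p₀ n₀ : ℕ
  k  = suc k′
  e  = suc e′
  K  = 2 ℕ.^ k
  R  = count f (signVectors k)
  C  = K ℕ.* e ℕ.* (351 ℕ.* e)
  a  = 100 ℕ.* C ℕ.+ 4 ℕ.* k
  b  = 101 ℕ.* (C ℕ.* (2 ℕ.* 2 ℕ.^ k ℕ.* (2 ℕ.* k ℕ.* (2 ℕ.* k))))
  p₀ = (4 ℕ.+ (a ℕ.+ a)) ℕ.+ b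
  n₀ = (16 ℕ.^ k) ℕ.^ p₀ ℕ.+ (k ℕ.+ C)

  1≤K : 1 ℕ.≤ K
  1≤K = ℕ.m^n>0 2 k

  1≤C : 1 ℕ.≤ C
  1≤C = ℕ.*-mono-≤ (ℕ.*-mono-≤ 1≤K (ℕ.s≤s {n = e′} ℕ.z≤n)) (ℕ.*-mono-≤ {1} {351} (ℕ.s≤s ℕ.z≤n) (ℕ.s≤s {n = e′} ℕ.z≤n))

  ρK≡R : ρ f * ι K ≡ ι R
  ρK≡R = trans (cong (ρ f *_) (ι-^ 2 k)) (ρ*2^k f)

  indicator-bounds : ∀ b → 0ℚ ≤ indicator b × indicator b ≤ 1ℚ
  indicator-bounds true  = 0≤1 , ℚ.≤-refl
  indicator-bounds false = ℚ.≤-refl , 0≤1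

  0≤ρ : 0ℚ ≤ ρ f
  0≤ρ = subst (0ℚ ≤_) (sym (ρ≡∫ f)) (∫-nonneg (cube k) (λ x → proj₁ (indicator-bounds (f x))))

  ρ≤1 : ρ f ≤ 1ℚ
  ρ≤1 = subst₂ _≤_ (sym (ρ≡∫ f)) (cube-isProbability k) (∫-mono (cube k) (λ x → proj₂ (indicator-bounds (f x))))

  R≤K : R ℕ.≤ K
  R≤K = ι-cancel-≤ (subst₂ _≤_ ρK≡R (ℚ.*-identityˡ (ι K)) (*-monoʳ-≤ (ι K) (0≤ι K) ρ≤1))

  1≤3eK : 1 ℕ.≤ 3 ℕ.* e ℕ.* K
  1≤3eK = ℕ.*-mono-≤ {1} {3 ℕ.* e} (ℕ.s≤s ℕ.z≤n) 1≤K

  lam : ℚ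
  lam = proj₁ (reciprocal-ι 1≤3eK)
  0≤lam : 0ℚ ≤ lam
  0≤lam = proj₁ (proj₂ (reciprocal-ι 1≤3eK))
  lam*3eK≡1 : lam * ι (3 ℕ.* e ℕ.* K) ≡ 1ℚ
  lam*3eK≡1 = proj₂ (proj₂ (reciprocal-ι 1≤3eK))

  lam*ι≤1 : ∀ {m} → m ℕ.≤ 3 ℕ.* e ℕ.* K → lam * ι m ≤ 1ℚ
  lam*ι≤1 {m} m≤ = subst (lam * ι m ≤_) lam*3eK≡1 (*-monoˡ-≤ lam 0≤lam (ι-mono-≤ m≤))

  lam≡ : ι 3 * ι e * (lam * ι K) ≡ 1ℚ
  lam≡ = trans (commute (ι 3 * ι e) lam (ι K)) (trans
    (cong (lam *_) (sym (trans (ι-* (3 ℕ.* e) K) (cong (_* ι K) (ι-* 3 e))))) lam*3eK≡1)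
    where
    commute : ∀ a l K → a * (l * K) ≡ l * (a * K)
    commute = solve-∀ ℚ-ring

  X≤1 : lam * ι K ≤ 1ℚ
  X≤1 = lam*ι≤1 (ℕ.m≤n*m K (3 ℕ.* e))

  lam≤1 : lam ≤ 1ℚ
  lam≤1 = subst (_≤ 1ℚ) (ℚ.*-identityʳ lam) (lam*ι≤1 1≤3eK)

  -- The length of the stream is a multiple of the common denominator K e of ρ f and β, so the
  -- number of satisfied constraints at which a stream fails is an integer.
  threshold : ∀ m → ι ((R ℕ.* e ℕ.+ K) ℕ.* m) ≡ (ρ f + β) * ι (K ℕ.* e ℕ.* m)
  threshold m = trans
    (trans (ι-* (R ℕ.* e ℕ.+ K) m) (cong (_* ι m) (trans (ι-+ (R ℕ.* e) K) (cong (_+ ι K) (trans (ι-* R e) (cong (_* ι e) (sym ρK≡R)))))))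
    (trans (cong (λ t → (ρ f * ι K * ι e + t) * ι m) (sym (trans (cong (_* ι K) βe≡1) (ℚ.*-identityˡ (ι K)))))
    (trans (regroup (ρ f) (ι K) (ι e) β (ι m))
      (cong ((ρ f + β) *_) (sym (trans (ι-* (K ℕ.* e) m) (cong (_* ι m) (ι-* K e)))))))
    where
    regroup : ∀ q K e β m → (q * K * e + β * e * K) * m ≡ (q + β) * (K * e * m)
    regroup = solve-∀ ℚ-ring

  -- `n`, `t` and `p` are predecessors: there are `suc n` variables and `suc t` constraints, and the
  -- threshold exponent is `suc p`. The lower end of the bracket for `suc n` controls the bias, the
  -- upper end the memory loss.
  block-bound : ∀ N r n t p s → suc n ≡ Blocks.size N r k → suc t ≡ C ℕ.* suc n → 1 ℕ.≤ N → suc n ℕ.≤ 2 ℕ.* k ℕ.* N →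
    (16 ℕ.^ k) ℕ.^ suc p ℕ.≤ suc n → suc n ℕ.< (16 ℕ.^ k) ℕ.^ (2 ℕ.+ p) →
    b ℕ.≤ suc p → a ℕ.* (2 ℕ.+ p) ℕ.≤ 2 ℕ.^ p → 4 ℕ.* s ℕ.< 2 ℕ.^ (2 ℕ.+ p) →
    (𝒜 : RandomizedAlgorithm k (Blocks.size N r k) s) → ∀ M → suc t ℕ.≤ M → ¬ Solves f 1ℝ (fromℚ (ρ f) +ℝ ε) M 𝒜
  block-bound N r n t p s n≡ t≡ 1≤N n≤ lo hi b≤ growth 4s< 𝒜 M t≤M solves =
    P.Hard.no-algorithm 𝒜 t (suc p) M bias≤ loss≤ β ε β≤ε t≤M solves
      (rare-failure K R e n (ρ f) lam (lam * ι K) W (∫-nonneg (pow P.μ (suc t)) 0≤fails) 0≤ρ 0≤lam (*-nonneg 0≤lam (0≤ι K)) lam≡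
        (Chernoff.gap K R e R≤K (ρ f) 0≤ρ ρ≤1 ρK≡R lam 0≤lam lam≡ X≤1 lam≤1)
        (subst₂ (λ i j → W * (1ℚ + lam) ^ ((R ℕ.* e ℕ.+ K) ℕ.* m) ≤ 2ℚ ^ i * (1ℚ + lam * ρ f) ^ j) (sym n≡) T≡
          (P.Hard.failure 𝒜 t (suc p) M bias≤ loss≤ β ε β≤ε t≤M solves ((R ℕ.* e ℕ.+ K) ℕ.* m) lam 0≤lam 0≤β
            (trans (threshold m) (cong (λ j → (ρ f + β) * ι j) (sym T≡))))))
    where
    m = 351 ℕ.* e ℕ.* suc n
    T≡ : suc t ≡ K ℕ.* e ℕ.* m
    T≡ = trans t≡ (ℕ.*-assoc (K ℕ.* e) (351 ℕ.* e) (suc n))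
    x = proj₁ (reciprocal-ι 1≤N)
    0≤x = proj₁ (proj₂ (reciprocal-ι 1≤N))
    Nx≡1 : ι N * x ≡ 1ℚ
    Nx≡1 = trans (ℚ.*-comm (ι N) x) (proj₂ (proj₂ (reciprocal-ι 1≤N)))
    x≤1 : x ≤ 1ℚ
    x≤1 = subst₂ _≤_ (ℚ.*-identityˡ x) Nx≡1 (*-monoʳ-≤ x 0≤x (ι-mono-≤ 1≤N))
    0<x : 0ℚ < x
    0<x = 0≤∧≢0⇒> 0≤x (λ x≡0 → contradiction (trans (sym (ℚ.*-zeroʳ (ι N))) (trans (cong (ι N *_) (sym x≡0)) Nx≡1)) λ ())
    module P = PlantedInstances {k} {N} r f x 0≤x x≤1 Nx≡1 (rational-approximation ind x 0<x x≤1)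
    bias≤ : (1ℚ + 2ℚ * (3ℚ ^ k) ^ suc p * (2ℚ ^ k * (x * x))) ^ suc t ≤ 1ℚ + ℤ.+ 1 / 100
    bias≤ = power-estimate t _ (*-nonneg (*-nonneg (ℚ.nonNegative⁻¹ 2ℚ) (^-nonneg (suc p) (^-nonneg k (ℚ.nonNegative⁻¹ 3ℚ)))) P.0≤κ)
      (subst (λ i → ι 101 * (ι i * (2ℚ * (3ℚ ^ k) ^ suc p * (2ℚ ^ k * (x * x)))) ≤ 1ℚ) (sym t≡)
        (kernel-estimate k C (suc n) N (suc p) x 0≤x Nx≡1 (ℕ.s≤s ℕ.z≤n) n≤ (bias-estimate k′ b (suc n) (suc p) lo b≤)))
    loss≤ : ι (suc t) * ((∫[ _ ∈ states s ] 1ℚ) * squares (suc p) ½) ≤ ℤ.+ 1 / 100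
    loss≤ = subst (λ i → ι i * ((∫[ _ ∈ states s ] 1ℚ) * squares (suc p) ½) ≤ ℤ.+ 1 / 100) (sym t≡)
      (loss-estimate (C ℕ.* suc n) s (suc p) (memory-estimate k C (suc n) p s hi 4s< growth))
    W : ℚ
    W = ∫ (pow P.μ (suc t)) (P.Hard.high-value 𝒜 t (suc p) M bias≤ loss≤ β ε β≤ε t≤M solves)
    0≤fails = P.Hard.0≤high-value 𝒜 t (suc p) M bias≤ loss≤ β ε β≤ε t≤M solves

  no-small-space : ∀ n → n₀ ℕ.≤ n → ∀ s (𝒜 : RandomizedAlgorithm k n s) M → n ℕ.* n ℕ.≤ M →
    (4 ℕ.* s) ℕ.^ (k ℕ.* 4) ℕ.< n → ¬ Solves f 1ℝ (fromℚ (ρ f) +ℝ ε) M 𝒜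
  no-small-space (suc n) n₀≤n s 𝒜 M n²≤M small = dispatch (bracket (16 ℕ.^ k) 2≤16^k n)
    where
    2≤16^k : 2 ℕ.≤ 16 ℕ.^ k
    2≤16^k = ℕ.*-mono-≤ {2} {16} {1} (ℕ.s≤s (ℕ.s≤s ℕ.z≤n)) (ℕ.m^n>0 16 k′)
    N = suc n ℕ./ k
    r = suc n ℕ.% k
    n≡ : suc n ≡ Blocks.size N r k
    n≡ = trans (ℕ.m≡m%n+[m/n]*n (suc n) k) (trans (cong (r ℕ.+_) (ℕ.*-comm N k)) (sym (size≡ N r k)))
    k≤n : k ℕ.≤ suc n
    k≤n = ℕ.≤-trans (ℕ.≤-trans (ℕ.m≤m+n k C) (ℕ.m≤n+m (k ℕ.+ C) _)) n₀≤n
    1≤N : 1 ℕ.≤ N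
    1≤N = ℕ.m≥n⇒m/n>0 k≤n
    n≤ : suc n ℕ.≤ 2 ℕ.* k ℕ.* N
    n≤ = begin
      suc n                      ≡⟨ trans n≡ (size≡ N r k) ⟩
      r ℕ.+ k ℕ.* N              ≤⟨ ℕ.+-monoˡ-≤ (k ℕ.* N) (ℕ.≤-trans (ℕ.<⇒≤ (ℕ.m%n<n (suc n) k))
                                      (ℕ.≤-trans (ℕ.≤-reflexive (sym (ℕ.*-identityʳ k))) (ℕ.*-monoʳ-≤ k 1≤N))) ⟩
      k ℕ.* N ℕ.+ k ℕ.* N        ≡⟨ double k N ⟩
      2 ℕ.* k ℕ.* N              ∎
      where
      open ℕ.≤-Reasoning
      open ℕ-Solver.+-*-Solver
      double : ∀ k N → k ℕ.* N ℕ.+ k ℕ.* N ≡ 2 ℕ.* k ℕ.* N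
      double = solve 2 (λ k N → k :* N :+ k :* N := con 2 :* k :* N) refl
    T≤M : C ℕ.* suc n ℕ.≤ M
    T≤M = ℕ.≤-trans (ℕ.*-monoˡ-≤ (suc n) (ℕ.≤-trans (ℕ.≤-trans (ℕ.m≤n+m C k) (ℕ.m≤n+m (k ℕ.+ C) _)) n₀≤n)) n²≤M
    1≤T : 1 ℕ.≤ C ℕ.* suc n
    1≤T = ℕ.*-mono-≤ 1≤C (ℕ.s≤s {n = n} ℕ.z≤n)
    t = ℕ.pred (C ℕ.* suc n)
    t≡ : suc t ≡ C ℕ.* suc n
    t≡ = ℕ.suc-pred (C ℕ.* suc n) {{ℕ.>-nonZero 1≤T}}
    dispatch : (∃ λ p → (16 ℕ.^ k) ℕ.^ p ℕ.≤ suc n × suc n ℕ.< (16 ℕ.^ k) ℕ.^ suc p) → ¬ Solves f 1ℝ (fromℚ (ρ f) +ℝ ε) M 𝒜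
    dispatch (p , lo , hi) = large p lo hi (bracket-≥ (16 ℕ.^ k) 2≤16^k (ℕ.≤-trans (ℕ.m≤m+n _ (k ℕ.+ C)) n₀≤n) hi)
      where
      large : ∀ p → (16 ℕ.^ k) ℕ.^ p ℕ.≤ suc n → suc n ℕ.< (16 ℕ.^ k) ℕ.^ suc p → p₀ ℕ.≤ p → ¬ Solves f 1ℝ (fromℚ (ρ f) +ℝ ε) M 𝒜
      large zero    lo hi ()
      large (suc p) lo hi p₀≤p = transport n≡ 𝒜
        where
        -- The upper end of the bracket is 16^(k(p+2)) = (2^(p+2))^(4k), which is where the exponent
        -- 4k of the space bound comes from.
        4s< : 4 ℕ.* s ℕ.< 2 ℕ.^ (2 ℕ.+ p)
        4s< = ℕ.≰⇒> (λ ≤4s → ℕ.<-irrefl refl (ℕ.<-trans small (ℕ.<-≤-trans hi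
          (ℕ.≤-trans (ℕ.≤-reflexive powers) (ℕ.^-monoˡ-≤ (k ℕ.* 4) ≤4s)))))
          where
          powers : (16 ℕ.^ k) ℕ.^ (2 ℕ.+ p) ≡ (2 ℕ.^ (2 ℕ.+ p)) ℕ.^ (k ℕ.* 4)
          powers = trans (trans (cong (ℕ._^ (2 ℕ.+ p)) (ℕ.^-*-assoc 2 4 k)) (ℕ.^-*-assoc 2 (4 ℕ.* k) (2 ℕ.+ p)))
            (trans (cong (2 ℕ.^_) (trans (cong (ℕ._* (2 ℕ.+ p)) (ℕ.*-comm 4 k)) (ℕ.*-comm (k ℕ.* 4) (2 ℕ.+ p))))
              (sym (ℕ.^-*-assoc 2 (2 ℕ.+ p) (k ℕ.* 4))))
        -- The type of the algorithm mentions the number of variables, which equals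
        -- `Blocks.size N r k` only propositionally; generalising it to `j` lets the equation be
        -- matched.
        transport : ∀ {j} → j ≡ Blocks.size N r k → (𝒜 : RandomizedAlgorithm k j s) → ¬ Solves f 1ℝ (fromℚ (ρ f) +ℝ ε) M 𝒜
        transport refl 𝒜 = block-bound N r n t p s n≡ t≡ 1≤N n≤ lo hi
            (ℕ.≤-trans (ℕ.m≤n+m b (4 ℕ.+ (a ℕ.+ a))) p₀≤p)
            (linear≤exponential a p (ℕ.≤-pred (ℕ.≤-trans (ℕ.m≤m+n (4 ℕ.+ (a ℕ.+ a)) b) p₀≤p)))
            4s< 𝒜 M (subst (ℕ._≤ M) (sym t≡) T≤M)

theorem1p3 : (k : ℕ) .{{_ : NonZero k}} (f : Predicate k) →
    SupportsOneWiseIndependence f → ApproximationResistant f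
theorem1p3 zero {{()}} f ind
-- The polynomial is n². The length C n depends on ε through C, while the polynomial is fixed before
-- ε; a square dominates C n for all n ≥ C.
theorem1p3 k@(suc k′) f ind = (0 ∷ 0 ∷ 1 ∷ []) , λ P P₀≤P ε 0<ε →
  δ , ℚ.positive⁻¹ δ , requires P P₀≤P ε 0<ε
  where
  δ c : ℚ
  -- δ = 1/(4k) and c = 1/4; the second argument is the denominator minus one. The space bound then
  -- reads n ≤ (4s)^(4k).
  δ = ℚ.mkℚ (ℤ.+ 1) (3 ℕ.+ k′ ℕ.* 4) (ℕ.1-coprimeTo (k ℕ.* 4))
  c = ℚ.mkℚ (ℤ.+ 1) 3 (ℕ.1-coprimeTo 4)
  requires : ∀ P → (∀ n → eval (0 ∷ 0 ∷ 1 ∷ []) n ℕ.≤ eval P n) → ∀ (ε : ℝ) → 0ℝ <ℝ ε →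
    RequiresSpace f 1ℝ (fromℚ (ρ f) +ℝ ε) P δ
  requires P P₀≤P ε (ε₁ , 0<ε₁ , M , ε₁≤) = choose (archimedean 0<ε₁)
    where
    choose : (∃ λ e → 1ℚ ≤ ε₁ * ι (suc e)) → RequiresSpace f 1ℝ (fromℚ (ρ f) +ℝ ε) P δ
    choose (e , 1≤) = c , ℚ.positive⁻¹ c , n₀ , λ n n₀≤n s 𝒜 solves →
      ℕ.≮⇒≥ (λ small → no-small-space n n₀≤n s 𝒜 (eval P n) (ℕ.≤-trans (ℕ.≤-reflexive (square n)) (P₀≤P n))
        (subst ((4 ℕ.* s) ℕ.^ (k ℕ.* 4) ℕ.<_) (unit n) small) solves)
      where
      β = proj₁ (reciprocal (0<ι e))
      0≤β = proj₁ (proj₂ (reciprocal (0<ι e)))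
      βe≡1 = proj₂ (proj₂ (reciprocal (0<ι e)))
      β≤ε₁ : β ≤ ε₁
      β≤ε₁ = ℚ.*-cancelʳ-≤-pos (ι (suc e)) {{ℚ.positive (0<ι e)}} (subst (_≤ ε₁ * ι (suc e)) (sym βe≡1) 1≤)
      open LowerBound k′ f ind ε e β 0≤β βe≡1
        (M , λ m M≤m → ℚ.≤-trans β≤ε₁ (subst (_≤ seq ε m) (ℚ.+-identityˡ ε₁) (ε₁≤ m M≤m)))
        using (n₀; no-small-space)
      open ℕ-Solver.+-*-Solver
      square : ∀ n → n ℕ.* n ≡ 0 ℕ.+ n ℕ.* (0 ℕ.+ n ℕ.* (1 ℕ.+ n ℕ.* 0))
      square = solve 1 (λ n → n :* n := con 0 :+ n :* (con 0 :+ n :* (con 1 :+ n :* con 0))) refl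
      unit : ∀ n → 1 ℕ.^ (k ℕ.* 4) ℕ.* n ℕ.^ 1 ≡ n
      unit n = trans (cong₂ ℕ._*_ (ℕ.^-zeroˡ (k ℕ.* 4)) (ℕ.*-identityʳ n)) (ℕ.*-identityˡ n)
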